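{- Let $A_{k,n}(q)$ be as defined in the context, for integers $1\le k\le n$, and set $A_{k,n}(q)=0$ for $0\le n<k$. Define $A_k(q,x)=\sum_{n\ge 0}A_{k,n}(q)x^n$ and $A(q,x,y)=\sum_{k\ge1}\sum_{n\ge 0}A_{k,n}(q)x^ny^k$. Then $$A(q,x,y)=\frac{ -y}{q(1-x)}+\sum_{i\ge1}\frac{y^i\,(q^{2i+1}-y)}{q^{i^2+i+1}\left(q^i-q^i[i+1]x+[i]xy\right)},$$ for every $k\ge1$ $$A_k(q,x)=\sum_{i=0}^{k-1}(-1)^{i+k}\frac{x^{k-i-1}[i]^{k-i-1}}{q^{ki+i+1}(1-[i+1]x)^{k-i}}+\sum_{i=0}^{k}(-1)^{i+k}\frac{x^{k-i}[i]^{k-i}}{q^{ki}(1-[i+1]x)^{k-i+1}},$$ and for all $1\le k\le n$ $$A_{k,n}(q)=q^{ -k^2}\sum_{i=0}^{k-1}(-1)^i\binom{n}{i}\left(q^{ki}[k-i]^i[k-i+1]^{n-i}-q^{(k+1)i}[k-i-1]^i[k-i]^{n-i}\right)=\sum_{i=0}^{k-1}\binom{n}{i}q^{ -(k-i)^2}\left([i-k]^i[k-i+1]^{n-i}-[i-k+1]^i[k-i]^{n-i}\right).$$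
   Context: For any integer $m$, $[m]=\frac{1-q^m}{1-q}$; so $[m]=1+q+\dots+q^{m-1}$ for $m\ge0$ (with $[0]=0$), and the convention $0^0=1$ is used (e.g. $[0]^0=1$). All rational expressions are expanded as formal power series in $x,y$ with coefficients in $\mathbb{Z}[q,q^{ -1}]$ (each denominator has an invertible constant term). Fix integers $1\le k\le n$. A partition $\lambda=(\lambda_1\ge\dots\ge\lambda_k\ge0)$ is contained in the $k\times(n-k)$ rectangle if $\lambda_1\le n-k$; its Young diagram $Y_\lambda$ is the left-justified array of boxes with $\lambda_i$ boxes in row $i$ (rows numbered top to bottom). A $\hbox{Le}$-diagram (written $\Gamma$-diagram reflected) $(\lambda,D)_{k,n}$ is such a $\lambda$ (possibly empty) together with a filling $D:Y_\lambda\to\{0,1\}$ such that there is no box filled with $0$ which has a box filled with $1$ above it in the same column and a box filled with $1$ to its left in the same row. Its rank is the number of $1$'s in $D$. $A_{k,n}(q)=\sum q^{\mathrm{rank}(\lambda,D)}$, the sum over all Le-diagrams $(\lambda,D)_{k,n}$ with $\lambda$ contained in the $k\times(n-k)$ rectangle. (By Postnikov, the coefficient of $q^r$ in $A_{k,n}(q)$ is also the number of $r$-dimensional cells in the cell decomposition of the totally nonnegative Grassmannian $Gr_{k,n}^+$.) -}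

module Defs where

open import Data.Nat as ℕ using (ℕ; zero; suc; _≤ᵇ_)
open import Data.Integer as ℤ using (ℤ; +_; -[1+_])
open import Data.Bool using (Bool; true; false; _∧_; not; if_then_else_)
open import Data.List using (List; []; _∷_; map; concatMap; upTo; filterᵇ; length; replicate; _++_; foldr)
open import Data.Bool.ListAction using (all; any)
open import Data.Product using (_×_; _,_; proj₂)
open import Data.Nat.Combinatorics using (_C_)
open import Data.Maybe using (Maybe; just; nothing)
open import Relation.Binary.PropositionalEquality using (_≡_)

-- Polynomials in q with integer coefficients: coefficient lists,
-- lowest degree first.

Poly : Set
Poly = List ℤ

padd : Poly → Poly → Poly
padd [] r = r
padd (a ∷ p) [] = a ∷ p
padd (a ∷ p) (b ∷ r) = (a ℤ.+ b) ∷ padd p r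

pscale : ℤ → Poly → Poly
pscale a p = map (a ℤ.*_) p

pmul : Poly → Poly → Poly
pmul [] r = []
pmul (a ∷ p) r = padd (pscale a r) (+ 0 ∷ pmul p r)

pshift : ℕ → Poly → Poly
pshift t p = replicate t (+ 0) ++ p

coeff : Poly → ℕ → ℤ
coeff [] i = + 0
coeff (a ∷ p) zero = a
coeff (a ∷ p) (suc i) = coeff p i

-- Laurent polynomials Z[q,q^{-1}]:  s ⋆ p  denotes  q^{-s} · p(q).

record L : Set where
  constructor _⋆_
  field
    sh : ℕ
    po : Poly

infixl 6 _+L_ _-L_
infixl 7 _*L_
infix 4 _≈L_

_+L_ : L → L → L
(s ⋆ p) +L (t ⋆ r) = (s ℕ.+ t) ⋆ padd (pshift t p) (pshift s r)

_*L_ : L → L → L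
(s ⋆ p) *L (t ⋆ r) = (s ℕ.+ t) ⋆ pmul p r

negL : L → L
negL (s ⋆ p) = s ⋆ map ℤ.-_ p

_-L_ : L → L → L
a -L b = a +L negL b

-- equality of Laurent polynomials: q^{-s} p = q^{-t} r  iff  q^t p = q^s r
_≈L_ : L → L → Set
(s ⋆ p) ≈L (t ⋆ r) = ∀ i → coeff (pshift t p) i ≡ coeff (pshift s r) i

0L 1L : L
0L = 0 ⋆ []
1L = 0 ⋆ (+ 1 ∷ [])

cL : ℤ → L
cL z = 0 ⋆ (z ∷ [])

qpow : ℤ → L
qpow (+ n) = 0 ⋆ pshift n (+ 1 ∷ [])
qpow -[1+ n ] = suc n ⋆ (+ 1 ∷ [])

-- a^m  (a^0 = 1, so in particular 0^0 = 1)
powL : L → ℕ → L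
powL a zero = 1L
powL a (suc m) = powL a m *L a

sgn : ℕ → L
sgn m = powL (cL (ℤ.- (+ 1))) m

-- q-integers [m] = (1 - q^m)/(1 - q):
--   [j]  = 1 + q + ... + q^{j-1}            (j ≥ 0)
--   [-j] = -q^{-j} (1 + q + ... + q^{j-1})   (j ≥ 1)
br : ℤ → L
br (+ j) = 0 ⋆ replicate j (+ 1)
br -[1+ j ] = negL (suc j ⋆ replicate (suc j) (+ 1))

lsum : ℕ → (ℕ → L) → L
lsum zero f = 0L
lsum (suc m) f = lsum m f +L f m

allLists : ℕ → ℕ → List (List ℕ)
allLists zero m = [] ∷ []
allLists (suc k) m = concatMap (λ a → map (a ∷_) (allLists k m)) (upTo (suc m))

nonincr : List ℕ → Bool
nonincr [] = true
nonincr (a ∷ []) = true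
nonincr (a ∷ b ∷ l) = (b ≤ᵇ a) ∧ nonincr (b ∷ l)

partitions : ℕ → ℕ → List (List ℕ)
partitions k m = filterᵇ nonincr (allLists k m)

allBools : ℕ → List (List Bool)
allBools zero = [] ∷ []
allBools (suc l) = concatMap (λ b → map (b ∷_) (allBools l)) (true ∷ false ∷ [])

-- a filling D of Y_λ : row i (top to bottom) is a word of length λ_i
Filling : Set
Filling = List (List Bool)

fillings : List ℕ → List Filling
fillings [] = [] ∷ []
fillings (l ∷ ls) = concatMap (λ r → map (r ∷_) (fillings ls)) (allBools l)

at : {A : Set} → List A → ℕ → Maybe A
at [] i = nothing
at (a ∷ l) zero = just a
at (a ∷ l) (suc i) = at l i

entry : Filling → ℕ → ℕ → Maybe Bool
entry D i j with at D i
... | nothing = nothing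
... | just row = at row j

isOne : Filling → ℕ → ℕ → Bool
isOne D i j with entry D i j
... | just true = true
... | _ = false

isZero : Filling → ℕ → ℕ → Bool
isZero D i j with entry D i j
... | just false = true
... | _ = false

leOK : Filling → Bool
leOK D = all (λ i → all (λ j →
            not (isZero D i j
                 ∧ any (λ i' → isOne D i' j) (upTo i)
                 ∧ any (λ j' → isOne D i j') (upTo j)))
           (upTo (rowLen i))) (upTo (length D))
  where
  rowLen : ℕ → ℕ
  rowLen i with at D i
  ... | nothing = 0
  ... | just row = length row

countTrue : List Bool → ℕ
countTrue [] = 0
countTrue (true ∷ l) = suc (countTrue l)
countTrue (false ∷ l) = countTrue l

rank : Filling → ℕ
rank D = foldr (λ row acc → countTrue row ℕ.+ acc) 0 D

LeDiagrams : ℕ → ℕ → List (List ℕ × Filling)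
LeDiagrams k n = concatMap (λ la → map (la ,_) (filterᵇ leOK (fillings la)))
                           (partitions k (n ℕ.∸ k))

A : ℕ → ℕ → L
A k n = if k ≤ᵇ n
        then foldr (λ d acc → qpow (+ rank (proj₂ d)) +L acc) 0L (LeDiagrams k n)
        else 0L

-- Formal power series in x, y over Z[q,q^{-1}]:
-- F n k is the coefficient of x^n y^k.

PS : Set
PS = ℕ → ℕ → L

infixl 6 _+S_ _-S_
infixl 7 _*S_
infix 4 _≈S_

_≈S_ : PS → PS → Set
F ≈S G = ∀ n k → F n k ≈L G n k

_+S_ : PS → PS → PS
(F +S G) n k = F n k +L G n k

negS : PS → PS
negS F n k = negL (F n k)

_-S_ : PS → PS → PS
F -S G = F +S negS G

_*S_ : PS → PS → PS
(F *S G) n k = lsum (suc n) λ a → lsum (suc k) λ b → F a b *L G (n ℕ.∸ a) (k ℕ.∸ b)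

sc : L → PS → PS
sc c F n k = c *L F n k

cS : L → PS
cS c zero zero = c
cS c _ _ = 0L

oneS : PS
oneS = cS 1L

X Y : PS
X (suc zero) zero = 1L
X _ _ = 0L
Y zero (suc zero) = 1L
Y _ _ = 0L

powS : PS → ℕ → PS
powS F zero = oneS
powS F (suc m) = powS F m *S F

sumS : ℕ → (ℕ → PS) → PS
sumS m f n k = lsum m (λ i → f i n k)

-- Inverse of a series D whose constant term c is a unit, given u = c^{-1}:
--   1/D = u · Σ_{m ≥ 0} (1 - u D)^m ;
-- since 1 - uD has no constant term, only m ≤ n + k contribute to x^n y^k.
inv : L → PS → PS
inv u D n k = u *L lsum (suc (n ℕ.+ k)) (λ m → powS (oneS -S sc u D) m n k)

-- Σ_{i ≥ 1} y^i S_i  (coefficient of x^n y^k only involves i ≤ k)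
ySum : (ℕ → PS) → PS
ySum S n k = lsum k (λ j → S (suc j) n (k ℕ.∸ suc j))

Aser : PS
Aser n zero = 0L
Aser n (suc k) = A (suc k) n

Ak : ℕ → PS
Ak k n zero = A k n
Ak k n (suc _) = 0L

zq : ℕ → L
zq e = qpow (+ e)

zqi : ℕ → L
zqi e = qpow (ℤ.- (+ e))

RHS1 : PS
RHS1 = negS Y *S inv (zqi 1) (cS (zq 1) *S (oneS -S X))
       +S ySum (λ i →
           (cS (zq (2 ℕ.* i ℕ.+ 1)) -S Y)
           *S inv (zqi (i ℕ.* i ℕ.+ i ℕ.+ 1 ℕ.+ i))
                  (cS (zq (i ℕ.* i ℕ.+ i ℕ.+ 1))
                   *S (cS (zq i) -S sc (zq i *L br (+ (suc i))) X +S sc (br (+ i)) (X *S Y))))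

RHS2 : ℕ → PS
RHS2 k =
  sumS k (λ i →
    sc (sgn (i ℕ.+ k)) (powS X (k ℕ.∸ i ℕ.∸ 1) *S cS (powL (br (+ i)) (k ℕ.∸ i ℕ.∸ 1)))
    *S inv (zqi (k ℕ.* i ℕ.+ i ℕ.+ 1))
           (cS (zq (k ℕ.* i ℕ.+ i ℕ.+ 1)) *S powS (oneS -S sc (br (+ (suc i))) X) (k ℕ.∸ i)))
  +S sumS (suc k) (λ i →
    sc (sgn (i ℕ.+ k)) (powS X (k ℕ.∸ i) *S cS (powL (br (+ i)) (k ℕ.∸ i)))
    *S inv (zqi (k ℕ.* i))
           (cS (zq (k ℕ.* i)) *S powS (oneS -S sc (br (+ (suc i))) X) (k ℕ.∸ i ℕ.+ 1)))

binL : ℕ → ℕ → L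
binL n i = cL (+ (n C i))

RHS3a : ℕ → ℕ → L
RHS3a k n = zqi (k ℕ.* k) *L lsum k (λ i →
  sgn i *L binL n i *L
    (zq (k ℕ.* i) *L powL (br (+ k ℤ.- + i)) i *L powL (br (+ k ℤ.- + i ℤ.+ + 1)) (n ℕ.∸ i)
     -L zq (suc k ℕ.* i) *L powL (br (+ k ℤ.- + i ℤ.- + 1)) i *L powL (br (+ k ℤ.- + i)) (n ℕ.∸ i)))

RHS3b : ℕ → ℕ → L
RHS3b k n = lsum k (λ i →
  binL n i *L zqi ((k ℕ.∸ i) ℕ.* (k ℕ.∸ i)) *L
    (powL (br (+ i ℤ.- + k)) i *L powL (br (+ k ℤ.- + i ℤ.+ + 1)) (n ℕ.∸ i)
     -L powL (br (+ i ℤ.- + k ℤ.+ + 1)) i *L powL (br (+ k ℤ.- + i)) (n ℕ.∸ i)))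

{-# OPTIONS --safe #-}
-- Fill a Le-diagram row by row.  If S is the set of columns with a 1 above the rows still to be
-- filled, multiply the generating function of the remaining fillings by w^|S| and sum over S.
-- For w = q [s], s ≥ 0, filling a row expresses the sum for s through the sums for s and s + 1 of
-- the remaining rows, and adding a column multiplies it by 1 + w = [s+1].  Collecting all shapes of
-- semiperimeter n into a series G_n(s) in y, with y marking rows and d_s = [s+1] - y q^{-s} [s],
--   G_0(s) = 1,   G_{n+1}(s) = d_s G_n(s) + y q^{-s} [s+1] G_n(s+1),
-- and A_{k,n} is the coefficient of y^k in G_n(0), where only S = ∅ counts.  This bidiagonal
-- recurrence is diagonalised by G_n(s) = Σ_e a(s,e) d_{s+e}^n, where Σ_e a(s,e) = 1 is a telescoping
-- Gaussian binomial sum.  For s = 0 this reads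
--   Σ_n G_n(0) x^n = Σ_{e≥0} (y^e q^{-e²} - y^{e+1} q^{-(e+1)²}) / (1 - x d_e),
-- and expanding the powers of d_e gives the other formulas.
module Submission where

open import Defs hiding (A; X; Y)
open import Algebra.Bundles using (CommutativeRing; RawRing)
import Algebra.Morphism.RingMonomorphism as RingMonomorphism
open import Algebra.Morphism.Structures using (IsRingMonomorphism)
open import Data.Bool using (Bool; true; false; _∧_; _∨_; not; if_then_else_)
open import Data.Bool.ListAction using (all; any)
import Data.Bool.Properties as 𝔹P
open import Data.Integer as ℤ using (ℤ; +_; -[1+_])
import Data.Integer.Properties as ℤP
open import Data.List using (List; []; _∷_; _++_; map; concatMap; filterᵇ; applyUpTo; upTo; length; replicate; foldr)
open import Data.List.Relation.Unary.All as All using (All; []; _∷_)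
open import Data.Maybe using (Maybe; just; nothing; fromMaybe)
open import Data.Nat as ℕ using (ℕ; zero; suc; _≤_)
open import Data.Nat.Combinatorics using (_C_; nCn≡1; nCk≡nC[n∸k]; k>n⇒nCk≡0; nCk+nC[k+1]≡[n+1]C[k+1])
import Data.Nat.Properties as ℕP
open import Data.Nat.Solver using (module +-*-Solver)
open import Data.Product using (_×_; _,_; ∃; proj₁; proj₂)
open import Data.Sum using (inj₁; inj₂)
open import Function using (_∘_; id)
open import Level using (0ℓ)
open import Relation.Binary.PropositionalEquality as ≡ using (_≡_)
open import Relation.Nullary using (yes; no)

-- The parameters q [s] are the orbit of 0 under w ↦ q (1 + w), which is what a row does to the
-- weight of a column once a 1 stands further left in the row. Summing over the position of the
-- first 1 gives a difference quotient with denominator q [s+1] - q [s] = q^{s+1}, a unit only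
-- because q is inverted. So the argument runs over any commutative ring with `p * q ≈ 1#`, and
-- Laurent polynomials are shown to form such a ring. The expansion of G_n(s) has infinitely many
-- terms, and no limits are available in an arbitrary ring. It is replaced by a congruence modulo
-- y^M with an explicit remainder; the coupling to s + 1 carries a factor y, which pays for knowing
-- G_n(s+1) to one order less. Up to division the coefficients a(s,e) are forced: comparing powers
-- of the d's ties a(s,e+1) to a(s+1,e), and the total 1 at n = 0 then fixes a(s,0). Since [e] need
-- not be cancellable, they are written down with Gaussian binomials and verified.

-- Polynomial identities with integer coefficients in a commutative ring.

module IntegerSolver {c ℓ} (K : CommutativeRing c ℓ) where
  open CommutativeRing K
  open import Algebra.Properties.Ring ring using (-‿distribˡ-*; -‿distribʳ-*)
  open import Algebra.Properties.AbelianGroup +-abelianGroup using (⁻¹-∙-comm; ε⁻¹≈ε; ⁻¹-involutive)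
  open import Algebra.Properties.Semiring.Mult.TCOptimised semiring using (1+×; ×-homo-+; ×1-homo-*) renaming (_×_ to _·_)
  open import Algebra.Solver.Ring.AlmostCommutativeRing using (fromCommutativeRing; _-Raw-AlmostCommutative⟶_)
  open import Relation.Binary.Reasoning.Setoid setoid

  -- Equality in `K` need not be decidable, so cancellation of coefficients is decided in ℤ and
  -- carried over by this homomorphism. The optimised multiple makes 0 and 1 go to `0#` and `1#`
  -- definitionally, so constants in solved identities match the goals.
  fromℤ : ℤ → Carrier
  fromℤ (+ n)    = n · 1#
  fromℤ -[1+ n ] = - (suc n · 1#)

  fromℤ-neg : ∀ i → fromℤ (ℤ.- i) ≈ - fromℤ i
  fromℤ-neg (+ zero)  = sym ε⁻¹≈ε
  fromℤ-neg (+ suc n) = refl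
  fromℤ-neg -[1+ n ]  = sym (⁻¹-involutive _)

  fromℤ-⊖ : ∀ m n → fromℤ (m ℤ.⊖ n) ≈ m · 1# - n · 1#
  fromℤ-⊖ m zero = sym (trans (+-congˡ ε⁻¹≈ε) (+-identityʳ _))
  fromℤ-⊖ zero (suc n) = sym (+-identityˡ _)
  fromℤ-⊖ (suc m) (suc n) = begin
    fromℤ (suc m ℤ.⊖ suc n)          ≡⟨ ≡.cong fromℤ (ℤP.[1+m]⊖[1+n]≡m⊖n m n) ⟩
    fromℤ (m ℤ.⊖ n)                  ≈⟨ fromℤ-⊖ m n ⟩
    m · 1# - n · 1#                  ≈⟨ +-congʳ (trans (+-congʳ (-‿inverseʳ 1#)) (+-identityˡ _)) ⟨
    1# - 1# + m · 1# - n · 1#        ≈⟨ +-congʳ (+-assoc _ _ _) ⟩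
    1# + (- 1# + m · 1#) - n · 1#    ≈⟨ +-congʳ (+-congˡ (+-comm _ _)) ⟩
    1# + (m · 1# - 1#) - n · 1#      ≈⟨ +-congʳ (+-assoc _ _ _) ⟨
    1# + m · 1# - 1# - n · 1#        ≈⟨ +-assoc _ _ _ ⟩
    1# + m · 1# + (- 1# - n · 1#)    ≈⟨ +-cong (sym (1+× m 1#)) (trans (⁻¹-∙-comm _ _) (-‿cong (sym (1+× n 1#)))) ⟩
    suc m · 1# - suc n · 1#          ∎

  fromℤ-+ : ∀ i j → fromℤ (i ℤ.+ j) ≈ fromℤ i + fromℤ j
  fromℤ-+ (+ m)    (+ n)    = ×-homo-+ 1# m n
  fromℤ-+ (+ m)    -[1+ n ] = fromℤ-⊖ m (suc n)
  fromℤ-+ -[1+ m ] (+ n)    = trans (fromℤ-⊖ n (suc m)) (+-comm _ _)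
  fromℤ-+ -[1+ m ] -[1+ n ] = begin
    - (suc (suc (m ℕ.+ n)) · 1#)        ≡⟨ ≡.cong (λ k → - (suc k · 1#)) (≡.sym (ℕP.+-suc m n)) ⟩
    - ((suc m ℕ.+ suc n) · 1#)          ≈⟨ -‿cong (×-homo-+ 1# (suc m) (suc n)) ⟩
    - (suc m · 1# + suc n · 1#)         ≈⟨ ⁻¹-∙-comm _ _ ⟨
    - (suc m · 1#) - suc n · 1#         ∎

  fromℤ-*⁺ : ∀ m j → fromℤ (+ m ℤ.* j) ≈ m · 1# * fromℤ j
  fromℤ-*⁺ m (+ n) = begin
    fromℤ (+ m ℤ.* + n)  ≡⟨ ≡.cong fromℤ (≡.sym (ℤP.pos-* m n)) ⟩
    (m ℕ.* n) · 1#       ≈⟨ ×1-homo-* m n ⟩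
    m · 1# * n · 1#      ∎
  fromℤ-*⁺ m -[1+ n ] = begin
    fromℤ (+ m ℤ.* -[1+ n ])          ≡⟨ ≡.cong fromℤ (≡.sym (ℤP.neg-distribʳ-* (+ m) (+ suc n))) ⟩
    fromℤ (ℤ.- (+ m ℤ.* + suc n))     ≈⟨ fromℤ-neg (+ m ℤ.* + suc n) ⟩
    - fromℤ (+ m ℤ.* + suc n)         ≈⟨ -‿cong (fromℤ-*⁺ m (+ suc n)) ⟩
    - (m · 1# * suc n · 1#)           ≈⟨ -‿distribʳ-* _ _ ⟩
    m · 1# * - (suc n · 1#)           ∎

  fromℤ-* : ∀ i j → fromℤ (i ℤ.* j) ≈ fromℤ i * fromℤ j
  fromℤ-* (+ m)    j = fromℤ-*⁺ m j
  fromℤ-* -[1+ m ] j = begin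
    fromℤ (-[1+ m ] ℤ.* j)          ≡⟨ ≡.cong fromℤ (≡.sym (ℤP.neg-distribˡ-* (+ suc m) j)) ⟩
    fromℤ (ℤ.- (+ suc m ℤ.* j))     ≈⟨ fromℤ-neg (+ suc m ℤ.* j) ⟩
    - fromℤ (+ suc m ℤ.* j)         ≈⟨ -‿cong (fromℤ-*⁺ (suc m) j) ⟩
    - (suc m · 1# * fromℤ j)        ≈⟨ -‿distribˡ-* _ _ ⟩
    - (suc m · 1#) * fromℤ j        ∎

  private
    morphism : ℤ.+-*-rawRing -Raw-AlmostCommutative⟶ fromCommutativeRing K
    morphism = record
      { ⟦_⟧ = fromℤ ; +-homo = fromℤ-+ ; *-homo = fromℤ-* ; -‿homo = fromℤ-neg
      ; 0-homo = refl ; 1-homo = refl }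

    coeff≟ : ∀ i j → Maybe (fromℤ i ≈ fromℤ j)
    coeff≟ i j with i ℤP.≟ j
    ... | yes ≡.refl = just refl
    ... | no _       = nothing

  open import Algebra.Solver.Ring ℤ.+-*-rawRing (fromCommutativeRing K) morphism coeff≟ public
    using (solve; _:=_; _:+_; _:*_; _:-_; :-_; con)

-- Finite sums over initial segments.

module RangeSum {c ℓ} (K : CommutativeRing c ℓ) where
  open CommutativeRing K
  open IntegerSolver K
  open import Relation.Binary.Reasoning.Setoid setoid

  ∑ : ℕ → (ℕ → Carrier) → Carrier
  ∑ zero    f = 0#
  ∑ (suc n) f = ∑ n f + f n

  ∑-cong< : ∀ n {f g} → (∀ i → i ℕ.< n → f i ≈ g i) → ∑ n f ≈ ∑ n g
  ∑-cong< zero    f≈g = refl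
  ∑-cong< (suc n) f≈g =
    +-cong (∑-cong< n λ i i<n → f≈g i (ℕP.m≤n⇒m≤1+n i<n)) (f≈g n ℕP.≤-refl)

  ∑-cong : ∀ n {f g} → (∀ i → f i ≈ g i) → ∑ n f ≈ ∑ n g
  ∑-cong n f≈g = ∑-cong< n λ i _ → f≈g i

  ∑-zero : ∀ n → ∑ n (λ _ → 0#) ≈ 0#
  ∑-zero zero    = refl
  ∑-zero (suc n) = trans (+-identityʳ _) (∑-zero n)

  ∑-+ : ∀ n f g → ∑ n (λ i → f i + g i) ≈ ∑ n f + ∑ n g
  ∑-+ zero    f g = sym (+-identityʳ 0#)
  ∑-+ (suc n) f g = trans (+-congʳ (∑-+ n f g))
    (solve 4 (λ a b c d → (a :+ b) :+ (c :+ d) := (a :+ c) :+ (b :+ d)) refl _ _ _ _)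

  ∑-*ˡ : ∀ n x f → ∑ n (λ i → x * f i) ≈ x * ∑ n f
  ∑-*ˡ zero    x f = sym (zeroʳ x)
  ∑-*ˡ (suc n) x f = trans (+-congʳ (∑-*ˡ n x f)) (sym (distribˡ x _ _))

  ∑-head : ∀ n f → ∑ (suc n) f ≈ f 0 + ∑ n (λ i → f (suc i))
  ∑-head zero    f = +-comm _ _
  ∑-head (suc n) f = trans (+-congʳ (∑-head n f)) (+-assoc _ _ _)

-- q-integers and Gaussian binomial coefficients.

module QNumbers {c ℓ} (K : CommutativeRing c ℓ) (q : CommutativeRing.Carrier K) where
  open CommutativeRing K
  open IntegerSolver K
  open import Algebra.Properties.CommutativeSemiring.Exp commutativeSemiring
  open import Relation.Binary.Reasoning.Setoid setoid

  [_] : ℕ → Carrier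
  [ zero ]  = 0#
  [ suc n ] = 1# + q * [ n ]

  [+] : ∀ m n → [ m ℕ.+ n ] ≈ [ m ] + q ^ m * [ n ]
  [+] zero    n = solve 1 (λ x → x := con (+ 0) :+ con (+ 1) :* x) refl _
  [+] (suc m) n = begin
    1# + q * [ m ℕ.+ n ]                ≈⟨ +-congˡ (*-congˡ ([+] m n)) ⟩
    1# + q * ([ m ] + q ^ m * [ n ])    ≈⟨ solve 4 (λ q x y z → con (+ 1) :+ q :* (x :+ y :* z) := (con (+ 1) :+ q :* x) :+ q :* y :* z) refl _ _ _ _ ⟩
    1# + q * [ m ] + q * q ^ m * [ n ]  ∎

  [suc] : ∀ n → [ suc n ] ≈ [ n ] + q ^ n
  [suc] n = begin
    [ suc n ]                ≡⟨ ≡.cong [_] (ℕP.+-comm 1 n) ⟩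
    [ n ℕ.+ 1 ]              ≈⟨ [+] n 1 ⟩
    [ n ] + q ^ n * [ 1 ]    ≈⟨ solve 3 (λ x y q → x :+ y :* (con (+ 1) :+ q :* con (+ 0)) := x :+ y) refl _ _ _ ⟩
    [ n ] + q ^ n            ∎

  -- Stands in for the quotient (1 - q^n)/(1 - q), as 1 - q need not be invertible.
  [1-q]* : ∀ n → (1# - q) * [ n ] ≈ 1# - q ^ n
  [1-q]* zero    = solve 1 (λ q → (con (+ 1) :- q) :* con (+ 0) := con (+ 1) :- con (+ 1)) refl _
  [1-q]* (suc n) = begin
    (1# - q) * (1# + q * [ n ])           ≈⟨ solve 2 (λ q x → (con (+ 1) :- q) :* (con (+ 1) :+ q :* x) := con (+ 1) :- q :+ q :* ((con (+ 1) :- q) :* x)) refl _ _ ⟩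
    1# - q + q * ((1# - q) * [ n ])       ≈⟨ +-congˡ (*-congˡ ([1-q]* n)) ⟩
    1# - q + q * (1# - q ^ n)             ≈⟨ solve 2 (λ q x → con (+ 1) :- q :+ q :* (con (+ 1) :- x) := con (+ 1) :- q :* x) refl _ _ ⟩
    1# - q * q ^ n                        ∎

  -- qbin s e is the Gaussian binomial coefficient "s + e choose s".
  qbin : ℕ → ℕ → Carrier
  qbin zero    e       = 1#
  qbin (suc s) zero    = 1#
  qbin (suc s) (suc e) = qbin (suc s) e + q ^ suc e * qbin s (suc e)

  qbin-1 : ∀ s → qbin s 1 ≈ [ suc s ]
  qbin-1 zero    = solve 1 (λ q → con (+ 1) := con (+ 1) :+ q :* con (+ 0)) refl _
  qbin-1 (suc s) = begin
    1# + q * 1# * qbin s 1   ≈⟨ +-congˡ (*-cong (*-identityʳ q) (qbin-1 s)) ⟩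
    1# + q * [ suc s ]       ∎

  -- Both sides are [s+e+1]!/([s]! [e]!). Factorials cannot be divided out in a general ring, so the
  -- identity is proved from the Pascal rule by a double induction.
  qbin-absorb : ∀ s e → [ suc s ] * qbin (suc s) e ≈ [ suc e ] * qbin s (suc e)
  qbin-absorb s zero = begin
    [ suc s ] * 1#        ≈⟨ *-congʳ (qbin-1 s) ⟨
    qbin s 1 * 1#         ≈⟨ solve 2 (λ b q → b :* con (+ 1) := (con (+ 1) :+ q :* con (+ 0)) :* b) refl _ _ ⟩
    [ 1 ] * qbin s 1      ∎
  qbin-absorb s (suc e) = begin
    [ suc s ] * (qbin (suc s) e + q ^ suc e * qbin s (suc e))
      ≈⟨ solve 4 (λ a b c d → a :* (b :+ c :* d) := a :* b :+ c :* a :* d) refl _ _ _ _ ⟩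
    [ suc s ] * qbin (suc s) e + q ^ suc e * [ suc s ] * qbin s (suc e)
      ≈⟨ +-congʳ (qbin-absorb s e) ⟩
    [ suc e ] * qbin s (suc e) + q ^ suc e * [ suc s ] * qbin s (suc e)
      ≈⟨ distribʳ _ _ _ ⟨
    ([ suc e ] + q ^ suc e * [ suc s ]) * qbin s (suc e)
      ≈⟨ *-congʳ ([+] (suc e) (suc s)) ⟨
    [ suc e ℕ.+ suc s ] * qbin s (suc e)
      ≡⟨ ≡.cong (λ n → [ n ] * qbin s (suc e)) (ℕP.+-suc (suc e) s) ⟩
    [ suc (suc e) ℕ.+ s ] * qbin s (suc e)
      ≈⟨ lower s ⟩
    [ suc (suc e) ] * qbin s (suc (suc e)) ∎
    where
    -- Both sides are [s+e+2]!/([s]! [e+1]!). The recursive call to `qbin-absorb` is at a smaller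
    -- first argument.
    lower : ∀ s → [ suc (suc e) ℕ.+ s ] * qbin s (suc e) ≈ [ suc (suc e) ] * qbin s (suc (suc e))
    lower zero = reflexive (≡.cong (λ n → [ n ] * 1#) (ℕP.+-identityʳ (suc (suc e))))
    lower (suc s) = begin
      [ suc (suc e) ℕ.+ suc s ] * qbin (suc s) (suc e)
        ≈⟨ *-congʳ ([+] (suc (suc e)) (suc s)) ⟩
      ([ suc (suc e) ] + q ^ suc (suc e) * [ suc s ]) * qbin (suc s) (suc e)
        ≈⟨ solve 4 (λ a b c d → (a :+ b :* c) :* d := a :* d :+ b :* (c :* d)) refl _ _ _ _ ⟩
      [ suc (suc e) ] * qbin (suc s) (suc e) + q ^ suc (suc e) * ([ suc s ] * qbin (suc s) (suc e))
        ≈⟨ +-congˡ (*-congˡ (qbin-absorb s (suc e))) ⟩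
      [ suc (suc e) ] * qbin (suc s) (suc e) + q ^ suc (suc e) * ([ suc (suc e) ] * qbin s (suc (suc e)))
        ≈⟨ solve 4 (λ a b c d → a :* b :+ c :* (a :* d) := a :* (b :+ c :* d)) refl _ _ _ _ ⟩
      [ suc (suc e) ] * qbin (suc s) (suc (suc e)) ∎

  -- The two Pascal rules differ by (1 - q) times the difference of the two sides of `qbin-absorb`,
  -- because 1 - q^n = (1 - q) [n].
  qbin-pascal′ : ∀ s e → qbin (suc s) (suc e) ≈ qbin s (suc e) + q ^ suc s * qbin (suc s) e
  qbin-pascal′ s e = begin
    a + v * b
      ≈⟨ solve 4 (λ a b u v → a :+ v :* b := b :+ u :* a :+ ((con (+ 1) :- u) :* a :- (con (+ 1) :- v) :* b)) refl a b u v ⟩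
    b + u * a + ((1# - u) * a - (1# - v) * b)
      ≈⟨ +-congˡ (+-cong (*-congʳ ([1-q]* (suc s))) (-‿cong (*-congʳ ([1-q]* (suc e))))) ⟨
    b + u * a + ((1# - q) * [ suc s ] * a - (1# - q) * [ suc e ] * b)
      ≈⟨ +-congˡ (+-cong (*-assoc _ _ _) (-‿cong (*-assoc _ _ _))) ⟩
    b + u * a + ((1# - q) * ([ suc s ] * a) - (1# - q) * ([ suc e ] * b))
      ≈⟨ +-congˡ (+-congʳ (*-congˡ (qbin-absorb s e))) ⟩
    b + u * a + ((1# - q) * ([ suc e ] * b) - (1# - q) * ([ suc e ] * b))
      ≈⟨ trans (+-congˡ (-‿inverseʳ _)) (+-identityʳ _) ⟩
    b + u * a ∎
    where
    a b u v : Carrier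
    a = qbin (suc s) e
    b = qbin s (suc e)
    u = q ^ suc s
    v = q ^ suc e

-- Powers of the inverse of q.

module InversePowers {c ℓ} (K : CommutativeRing c ℓ) (q p : CommutativeRing.Carrier K)
  (pq≈1 : CommutativeRing._≈_ K (CommutativeRing._*_ K p q) (CommutativeRing.1# K)) where
  open CommutativeRing K
  open IntegerSolver K
  open import Algebra.Properties.CommutativeSemiring.Exp commutativeSemiring
  open import Relation.Binary.Reasoning.Setoid setoid

  p^*q^ : ∀ n → p ^ n * q ^ n ≈ 1#
  p^*q^ zero    = *-identityʳ 1#
  p^*q^ (suc n) = begin
    p * p ^ n * (q * q ^ n)    ≈⟨ solve 4 (λ a b c d → a :* b :* (c :* d) := (a :* c) :* (b :* d)) refl _ _ _ _ ⟩
    p * q * (p ^ n * q ^ n)    ≈⟨ *-cong pq≈1 (p^*q^ n) ⟩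
    1# * 1#                    ≈⟨ *-identityʳ 1# ⟩
    1#                         ∎

  p^+*q^ : ∀ m n → p ^ (m ℕ.+ n) * q ^ n ≈ p ^ m
  p^+*q^ m n = begin
    p ^ (m ℕ.+ n) * q ^ n     ≈⟨ *-congʳ (^-homo-* p m n) ⟩
    p ^ m * p ^ n * q ^ n     ≈⟨ *-assoc _ _ _ ⟩
    p ^ m * (p ^ n * q ^ n)   ≈⟨ *-congˡ (p^*q^ n) ⟩
    p ^ m * 1#                ≈⟨ *-identityʳ _ ⟩
    p ^ m                     ∎

-- Diagonalisation of the bidiagonal recurrence.

module ClosedForm {c ℓ} (K : CommutativeRing c ℓ) (q p y : CommutativeRing.Carrier K)
  (pq≈1 : CommutativeRing._≈_ K (CommutativeRing._*_ K p q) (CommutativeRing.1# K)) where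
  open CommutativeRing K
  open IntegerSolver K
  open RangeSum K
  open QNumbers K q
  open InversePowers K q p pq≈1
  open import Algebra.Properties.CommutativeSemiring.Exp commutativeSemiring
  open import Relation.Binary.Reasoning.Setoid setoid

  d : ℕ → Carrier
  d s = [ suc s ] - y * (p ^ s * [ s ])

  -- The gap between two diagonal entries. Its factor `[ e ]` vanishes at `e = 0` and is the one
  -- that `qbin-absorb` trades for `[ suc s ]`.
  d-+ : ∀ s e → d (s ℕ.+ e) ≈ d s + [ e ] * (q ^ suc s - y * p ^ (s ℕ.+ e))
  d-+ s e = begin
    [ suc s ℕ.+ e ] - y * (p ^ (s ℕ.+ e) * [ s ℕ.+ e ])
      ≈⟨ +-cong ([+] (suc s) e) (-‿cong (*-congˡ (*-congˡ (trans (reflexive (≡.cong [_] (ℕP.+-comm s e))) ([+] e s))))) ⟩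
    [ suc s ] + q ^ suc s * [ e ] - y * (p ^ (s ℕ.+ e) * ([ e ] + q ^ e * [ s ]))
      ≈⟨ solve 7 (λ a b c y v w x → a :+ b :* c :- y :* (v :* (c :+ w :* x)) := a :- y :* (v :* w :* x) :+ c :* (b :- y :* v)) refl _ _ _ _ _ _ _ ⟩
    [ suc s ] - y * (p ^ (s ℕ.+ e) * q ^ e * [ s ]) + [ e ] * (q ^ suc s - y * p ^ (s ℕ.+ e))
      ≈⟨ +-congʳ (+-congˡ (-‿cong (*-congˡ (*-congʳ (p^+*q^ s e))))) ⟩
    d s + [ e ] * (q ^ suc s - y * p ^ (s ℕ.+ e)) ∎

  -- The q-shifted factorial (y p^i; p)_s.
  W : ℕ → ℕ → Carrier
  W zero    i = 1#
  W (suc s) i = W s i * (1# - y * p ^ (i ℕ.+ s))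

  W-front : ∀ s i → W (suc s) i ≈ (1# - y * p ^ i) * W s (suc i)
  W-front zero i = begin
    1# * (1# - y * p ^ (i ℕ.+ 0))   ≈⟨ *-comm _ _ ⟩
    (1# - y * p ^ (i ℕ.+ 0)) * 1#   ≡⟨ ≡.cong (λ j → (1# - y * p ^ j) * 1#) (ℕP.+-identityʳ i) ⟩
    (1# - y * p ^ i) * 1#           ∎
  W-front (suc s) i = begin
    W (suc s) i * (1# - y * p ^ (i ℕ.+ suc s))
      ≈⟨ *-cong (W-front s i) (reflexive (≡.cong (λ j → 1# - y * p ^ j) (ℕP.+-suc i s))) ⟩
    (1# - y * p ^ i) * W s (suc i) * (1# - y * p ^ (suc i ℕ.+ s))
      ≈⟨ *-assoc _ _ _ ⟩
    (1# - y * p ^ i) * W (suc s) (suc i) ∎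

  -- The exponent is (s+e)² - s², the sum of the odd numbers 2(s+j)+1 for j < e; this is why the
  -- powers `p ^ (2 * (s + e) + 1)` accompany it.
  h : ℕ → ℕ → Carrier
  h s e = p ^ (e ℕ.* (2 ℕ.* s ℕ.+ e))

  h-sucˡ : ∀ s e → h s (suc e) ≈ p ^ (2 ℕ.* s ℕ.+ 1) * h (suc s) e
  h-sucˡ s e = trans (reflexive (≡.cong (p ^_) (expo s e))) (^-homo-* p (2 ℕ.* s ℕ.+ 1) _)
    where
    open +-*-Solver using () renaming (solve to solveℕ; _:=_ to _:=ℕ_; _:+_ to _:+ℕ_; _:*_ to _:*ℕ_; con to conℕ)
    expo : ∀ s e → suc e ℕ.* (2 ℕ.* s ℕ.+ suc e) ≡ 2 ℕ.* s ℕ.+ 1 ℕ.+ e ℕ.* (2 ℕ.* suc s ℕ.+ e)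
    expo = solveℕ 2 (λ s e → (conℕ 1 :+ℕ e) :*ℕ (conℕ 2 :*ℕ s :+ℕ (conℕ 1 :+ℕ e)) :=ℕ conℕ 2 :*ℕ s :+ℕ conℕ 1 :+ℕ e :*ℕ (conℕ 2 :*ℕ (conℕ 1 :+ℕ s) :+ℕ e)) ≡.refl

  h-sucʳ : ∀ s e → h s (suc e) ≈ h s e * p ^ (2 ℕ.* (s ℕ.+ e) ℕ.+ 1)
  h-sucʳ s e = trans (reflexive (≡.cong (p ^_) (expo s e))) (^-homo-* p (e ℕ.* (2 ℕ.* s ℕ.+ e)) _)
    where
    open +-*-Solver using () renaming (solve to solveℕ; _:=_ to _:=ℕ_; _:+_ to _:+ℕ_; _:*_ to _:*ℕ_; con to conℕ)
    expo : ∀ s e → suc e ℕ.* (2 ℕ.* s ℕ.+ suc e) ≡ e ℕ.* (2 ℕ.* s ℕ.+ e) ℕ.+ (2 ℕ.* (s ℕ.+ e) ℕ.+ 1)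
    expo = solveℕ 2 (λ s e → (conℕ 1 :+ℕ e) :*ℕ (conℕ 2 :*ℕ s :+ℕ (conℕ 1 :+ℕ e)) :=ℕ e :*ℕ (conℕ 2 :*ℕ s :+ℕ e) :+ℕ (conℕ 2 :*ℕ (s :+ℕ e) :+ℕ conℕ 1)) ≡.refl

  p^odd : ∀ n → p ^ (2 ℕ.* n ℕ.+ 1) ≈ p * (p ^ n * p ^ n)
  p^odd n = begin
    p ^ (2 ℕ.* n ℕ.+ 1)               ≡⟨ ≡.cong (p ^_) (≡.trans (ℕP.+-comm _ 1) (≡.cong (λ m → suc (n ℕ.+ m)) (ℕP.+-identityʳ n))) ⟩
    p * p ^ (n ℕ.+ n)                 ≈⟨ *-congˡ (^-homo-* p n n) ⟩
    p * (p ^ n * p ^ n)               ∎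

  -- `a s e` is the weight of `d (s + e) ^ n` in the solution: `a-shift` ties it to the neighbour s
  -- + 1, and `∑a≈1` is its normalisation. `T` is the boundary term of the telescoping sum that
  -- proves the latter.
  a T : ℕ → ℕ → Carrier
  a s e = qbin s e * y ^ e * h s e * (1# - y * p ^ (2 ℕ.* (s ℕ.+ e) ℕ.+ 1)) * W s (suc (s ℕ.+ e))
  T s e = qbin s e * y ^ e * h s e * W s (s ℕ.+ e)

  -- This is the recurrence compared at the power of `d (s + suc e)`: the gap of `d-+` must be
  -- supplied by the coupling to s + 1. Absorption changes the binomial, and the factor p^{2s+1}
  -- split off from `h` is p^{s+1} p^s: its part p^{s+1} turns the gap into 1 - y p^{2s+e+2}, the
  -- missing last factor of `W (suc s)`, while p^s goes to the coupling.
  a-shift : ∀ s e → [ suc e ] * (q ^ suc s - y * p ^ (s ℕ.+ suc e)) * a s (suc e)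
                  ≈ y * (p ^ s * [ suc s ]) * a (suc s) e
  a-shift s e rewrite ℕP.+-suc s e = begin
    [ suc e ] * (q ^ suc s - y * P) * (b * (y * y ^ e) * h s (suc e) * X * V)
      ≈⟨ *-congˡ (*-congʳ (*-congʳ (*-congˡ (trans (h-sucˡ s e) (*-congʳ (p^odd s)))))) ⟩
    [ suc e ] * (q * q ^ s - y * P) * (b * (y * y ^ e) * (p * (u * u) * H) * X * V)
      ≈⟨ solve 12 (λ E q r y P b Y p u H X V →
           E :* (q :* r :- y :* P) :* (b :* (y :* Y) :* (p :* (u :* u) :* H) :* X :* V)
           := (E :* b) :* u :* (p :* q :* (u :* r) :- y :* (p :* (u :* P))) :* (y :* Y :* H :* X :* V))
           refl _ _ _ _ _ _ _ _ _ _ _ _ ⟩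
    [ suc e ] * b * u * (p * q * (u * q ^ s) - y * (p * (u * P))) * (y * y ^ e * H * X * V)
      ≈⟨ *-congʳ (*-cong (*-congʳ (sym (qbin-absorb s e))) (+-cong (trans (*-cong pq≈1 (p^*q^ s)) (*-identityʳ 1#)) (-‿cong (*-congˡ expo)))) ⟩
    [ suc s ] * b′ * u * (1# - y * p ^ (suc (suc (s ℕ.+ e)) ℕ.+ s)) * (y * y ^ e * H * X * V)
      ≈⟨ solve 9 (λ S b u Z y Y H X V →
           S :* b :* u :* Z :* (y :* Y :* H :* X :* V) := y :* (u :* S) :* (b :* Y :* H :* X :* (V :* Z)))
           refl _ _ _ _ _ _ _ _ _ ⟩
    y * (u * [ suc s ]) * (b′ * y ^ e * H * X * (V * (1# - y * p ^ (suc (suc (s ℕ.+ e)) ℕ.+ s)))) ∎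
    where
    P u b b′ H X V : Carrier
    P = p ^ suc (s ℕ.+ e)
    u = p ^ s
    b = qbin s (suc e)
    b′ = qbin (suc s) e
    H = h (suc s) e
    X = 1# - y * p ^ (2 ℕ.* suc (s ℕ.+ e) ℕ.+ 1)
    V = W s (suc (suc (s ℕ.+ e)))
    expo : p * (u * P) ≈ p ^ (suc (suc (s ℕ.+ e)) ℕ.+ s)
    expo = *-congˡ (trans (*-comm _ _) (sym (^-homo-* p (suc (s ℕ.+ e)) s)))

  -- The certificate that makes the sum of the a s e over e telescope in s.
  a-telescope : ∀ s e → a (suc s) e + T (suc s) (suc e) ≈ a s (suc e) + T (suc s) e
  a-telescope s e rewrite ℕP.+-suc s e = begin
    A * Y * H * X * (V * (1# - y * p ^ (suc i ℕ.+ s))) + Z * (y * Y) * h (suc s) (suc e) * (V * (1# - y * p ^ (suc i ℕ.+ s)))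
      ≈⟨ +-cong (*-cong (*-congˡ X≈) (*-congˡ Q≈)) (*-cong (*-congˡ (trans (h-sucʳ (suc s) e) (*-congˡ P≈))) (*-congˡ Q≈)) ⟩
    A * Y * H * (1# - y * (p * (u * v * (u * v)))) * (V * (1# - y * (p * (u * (u * v))))) + Z * (y * Y) * (H * (p * (u * v * (u * v)))) * (V * (1# - y * (p * (u * (u * v)))))
      ≈⟨ solve 9 (λ A Z Y H V y p u v →
           A :* Y :* H :* (con (+ 1) :- y :* (p :* (u :* v :* (u :* v)))) :* (V :* (con (+ 1) :- y :* (p :* (u :* (u :* v))))) :+ Z :* (y :* Y) :* (H :* (p :* (u :* v :* (u :* v)))) :* (V :* (con (+ 1) :- y :* (p :* (u :* (u :* v)))))
           := Y :* H :* V :* (A :* (con (+ 1) :- y :* (p :* (u :* v :* (u :* v)))) :* (con (+ 1) :- y :* (p :* (u :* (u :* v)))) :+ y :* (p :* (u :* (u :* v))) :* (con (+ 1) :- y :* (p :* (u :* (u :* v)))) :* (Z :* v)))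
           refl _ _ _ _ _ _ _ _ _ ⟩
    Y * H * V * (A * (1# - y * (p * (u * v * (u * v)))) * (1# - y * (p * (u * (u * v)))) + y * (p * (u * (u * v))) * (1# - y * (p * (u * (u * v)))) * (Z * v))
      ≈⟨ *-congˡ (+-congˡ (*-congˡ C₁)) ⟩
    Y * H * V * (A * (1# - y * (p * (u * v * (u * v)))) * (1# - y * (p * (u * (u * v)))) + y * (p * (u * (u * v))) * (1# - y * (p * (u * (u * v)))) * (A * v + B))
      -- The two Pascal rules for `Z` read Z v = A v + B and Z u p = B u p + A. The identity holds
      -- up to the last summand, which compares the two resulting expressions for Z u p v and hence
      -- vanishes.
      ≈⟨ solve 9 (λ A B Y H V y p u v →
           Y :* H :* V :* (A :* (con (+ 1) :- y :* (p :* (u :* v :* (u :* v)))) :* (con (+ 1) :- y :* (p :* (u :* (u :* v)))) :+ y :* (p :* (u :* (u :* v))) :* (con (+ 1) :- y :* (p :* (u :* (u :* v)))) :* (A :* v :+ B))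
           := B :* (y :* Y) :* (p :* (u :* u) :* H) :* (con (+ 1) :- y :* (p :* (u :* v :* (u :* v)))) :* V :+ A :* Y :* H :* ((con (+ 1) :- y :* (u :* v)) :* V) :+ Y :* H :* V :* (y :* u :* (v :* (B :* (u :* p) :+ A) :- u :* p :* (A :* v :+ B))))
           refl A B Y H V y p u v ⟩
    B * (y * Y) * (p * (u * u) * H) * (1# - y * (p * (u * v * (u * v)))) * V + A * Y * H * ((1# - y * (u * v)) * V) + Y * H * V * (y * u * (v * (B * (u * p) + A) - u * p * (A * v + B)))
      ≈⟨ +-congˡ (*-congˡ (*-congˡ (+-cong (*-congˡ C₂) (-‿cong (*-congˡ C₁))))) ⟨
    B * (y * Y) * (p * (u * u) * H) * (1# - y * (p * (u * v * (u * v)))) * V + A * Y * H * ((1# - y * (u * v)) * V) + Y * H * V * (y * u * (v * (Z * (u * p)) - u * p * (Z * v)))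
      ≈⟨ solve 10 (λ A B Z Y H V y p u v →
           B :* (y :* Y) :* (p :* (u :* u) :* H) :* (con (+ 1) :- y :* (p :* (u :* v :* (u :* v)))) :* V :+ A :* Y :* H :* ((con (+ 1) :- y :* (u :* v)) :* V) :+ Y :* H :* V :* (y :* u :* (v :* (Z :* (u :* p)) :- u :* p :* (Z :* v)))
           := B :* (y :* Y) :* (p :* (u :* u) :* H) :* (con (+ 1) :- y :* (p :* (u :* v :* (u :* v)))) :* V :+ A :* Y :* H :* ((con (+ 1) :- y :* (u :* v)) :* V))
           refl A B Z Y H V y p u v ⟩
    B * (y * Y) * (p * (u * u) * H) * (1# - y * (p * (u * v * (u * v)))) * V + A * Y * H * ((1# - y * (u * v)) * V)
      ≈⟨ +-cong (*-congʳ (*-cong (*-congˡ (trans (h-sucˡ s e) (*-congʳ (p^odd s)))) X≈)) (*-congˡ (trans (W-front s i) (*-congʳ (+-congˡ (-‿cong (*-congˡ i≈)))))) ⟨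
    B * (y * Y) * h s (suc e) * X * V + A * Y * H * W (suc s) i ∎
    where
    i : ℕ
    i = suc (s ℕ.+ e)
    A B Z Y H X V u v : Carrier
    A = qbin (suc s) e
    B = qbin s (suc e)
    Z = qbin (suc s) (suc e)
    Y = y ^ e
    H = h (suc s) e
    X = 1# - y * p ^ (2 ℕ.* i ℕ.+ 1)
    V = W s (suc i)
    u = p ^ s
    v = p ^ suc e
    i≈ : p ^ i ≈ u * v
    i≈ = trans (reflexive (≡.cong (p ^_) (≡.sym (ℕP.+-suc s e)))) (^-homo-* p s (suc e))
    P≈ : p ^ (2 ℕ.* i ℕ.+ 1) ≈ p * (u * v * (u * v))
    P≈ = trans (p^odd i) (*-congˡ (*-cong i≈ i≈))
    X≈ : X ≈ 1# - y * (p * (u * v * (u * v)))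
    X≈ = +-congˡ (-‿cong (*-congˡ P≈))
    Q≈ : 1# - y * p ^ (suc i ℕ.+ s) ≈ 1# - y * (p * (u * (u * v)))
    Q≈ = +-congˡ (-‿cong (*-congˡ (*-congˡ (trans (reflexive (≡.cong (p ^_) (ℕP.+-comm i s))) (trans (^-homo-* p s i) (*-congˡ i≈))))))
    C₁ : Z * v ≈ A * v + B
    C₁ = begin
      (A + q ^ suc e * B) * v         ≈⟨ solve 4 (λ a r b v → (a :+ r :* b) :* v := a :* v :+ b :* (v :* r)) refl _ _ _ _ ⟩
      A * v + B * (v * q ^ suc e)     ≈⟨ +-congˡ (trans (*-congˡ (p^*q^ (suc e))) (*-identityʳ B)) ⟩
      A * v + B                       ∎
    C₂ : Z * (u * p) ≈ B * (u * p) + A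
    C₂ = begin
      Z * (u * p)                                ≈⟨ *-congʳ (qbin-pascal′ s e) ⟩
      (B + q ^ suc s * A) * (u * p)              ≈⟨ solve 5 (λ b r a u p → (b :+ r :* a) :* (u :* p) := b :* (u :* p) :+ a :* (p :* u :* r)) refl _ _ _ _ _ ⟩
      B * (u * p) + A * (p ^ suc s * q ^ suc s)  ≈⟨ +-congˡ (trans (*-congˡ (p^*q^ (suc s))) (*-identityʳ A)) ⟩
      B * (u * p) + A                            ∎

  -- Summation of `a-telescope`; it starts from the coincidence of `a s 0` with `T (suc s) 0`. The
  -- sum for `s` has one term more, which is what later lowers the order of truncation by one.
  ∑a-suc : ∀ s M → ∑ M (a (suc s)) + T (suc s) M ≈ ∑ (suc M) (a s)
  ∑a-suc s zero rewrite ℕP.+-identityʳ s = begin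
    0# + 1# * 1# * 1# * (W s (suc s) * (1# - y * p ^ suc (s ℕ.+ s)))
      ≈⟨ solve 2 (λ w z → con (+ 0) :+ con (+ 1) :* con (+ 1) :* con (+ 1) :* (w :* z) := con (+ 0) :+ con (+ 1) :* con (+ 1) :* con (+ 1) :* z :* w) refl _ _ ⟩
    0# + 1# * 1# * 1# * (1# - y * p ^ suc (s ℕ.+ s)) * W s (suc s)
      ≈⟨ +-congˡ (*-congʳ (*-cong (*-congʳ (*-congʳ (sym (qbin-0 s)))) (+-congˡ (-‿cong (*-congˡ (trans (*-congˡ (^-homo-* p s s)) (sym (p^odd s)))))))) ⟩
    0# + qbin s 0 * 1# * 1# * (1# - y * p ^ (2 ℕ.* s ℕ.+ 1)) * W s (suc s) ∎
    where
    qbin-0 : ∀ s → qbin s 0 ≈ 1#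
    qbin-0 zero    = refl
    qbin-0 (suc s) = refl
  ∑a-suc s (suc M) = begin
    ∑ M (a (suc s)) + a (suc s) M + T (suc s) (suc M)    ≈⟨ +-assoc _ _ _ ⟩
    ∑ M (a (suc s)) + (a (suc s) M + T (suc s) (suc M))  ≈⟨ +-congˡ (a-telescope s M) ⟩
    ∑ M (a (suc s)) + (a s (suc M) + T (suc s) M)        ≈⟨ solve 3 (λ x y z → x :+ (y :+ z) := (x :+ z) :+ y) refl _ _ _ ⟩
    ∑ M (a (suc s)) + T (suc s) M + a s (suc M)          ≈⟨ +-congʳ (∑a-suc s M) ⟩
    ∑ (suc M) (a s) + a s (suc M)                        ∎

  -- For `s = 0` the binomials and `W` are 1 and each term is itself a difference,
  -- `a 0 e = T 0 e - T 0 (suc e)`, with `T 0 0 = 1`.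
  ∑a-zero : ∀ M → ∑ M (a 0) + T 0 M ≈ 1#
  ∑a-zero zero    = solve 0 (con (+ 0) :+ con (+ 1) :* con (+ 1) :* con (+ 1) :* con (+ 1) := con (+ 1)) refl
  ∑a-zero (suc M) = begin
    ∑ M (a 0) + a 0 M + 1# * (y * y ^ M) * h 0 (suc M) * 1#
      ≈⟨ +-congˡ (*-congʳ (*-congˡ (h-sucʳ 0 M))) ⟩
    ∑ M (a 0) + 1# * y ^ M * h 0 M * (1# - y * p ^ (2 ℕ.* M ℕ.+ 1)) * 1# + 1# * (y * y ^ M) * (h 0 M * p ^ (2 ℕ.* M ℕ.+ 1)) * 1#
      ≈⟨ solve 5 (λ S Y y h P → S :+ con (+ 1) :* Y :* h :* (con (+ 1) :- y :* P) :* con (+ 1) :+ con (+ 1) :* (y :* Y) :* (h :* P) :* con (+ 1) := S :+ con (+ 1) :* Y :* h :* con (+ 1)) refl _ _ _ _ _ ⟩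
    ∑ M (a 0) + T 0 M
      ≈⟨ ∑a-zero M ⟩
    1# ∎

  -- The infinite sum is 1, expressed as a congruence modulo y^M. Each step in `s` consumes one
  -- order of precision, and the boundary term `T (suc s) M` is itself divisible by y^M.
  ∑a≈1 : ∀ s M → ∃ λ r → 1# ≈ ∑ M (a s) + y ^ M * r
  ∑a≈1 zero M = h 0 M , trans (sym (∑a-zero M)) (+-congˡ (solve 2 (λ Y h → con (+ 1) :* Y :* h :* con (+ 1) := Y :* h) refl _ _))
  ∑a≈1 (suc s) M with ∑a≈1 s (suc M)
  ... | r , 1≈ = qbin (suc s) M * h (suc s) M * W (suc s) (suc s ℕ.+ M) + y * r , (begin
    1#
      ≈⟨ 1≈ ⟩
    ∑ (suc M) (a s) + y * y ^ M * r
      ≈⟨ +-congʳ (∑a-suc s M) ⟨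
    ∑ M (a (suc s)) + T (suc s) M + y * y ^ M * r
      ≈⟨ solve 7 (λ S b Y h w y r → S :+ b :* Y :* h :* w :+ y :* Y :* r := S :+ Y :* (b :* h :* w :+ y :* r)) refl _ _ _ _ _ _ _ ⟩
    ∑ M (a (suc s)) + y ^ M * (qbin (suc s) M * h (suc s) M * W (suc s) (suc s ℕ.+ M) + y * r) ∎)

  module Solution (G : ℕ → ℕ → Carrier) (G-zero : ∀ s → G 0 s ≈ 1#)
    (G-suc : ∀ n s → G (suc n) s ≈ d s * G n s + y * (p ^ s * [ suc s ]) * G n (suc s)) where

    private
      S : ℕ → ℕ → ℕ → Carrier
      S n s M = ∑ M (λ e → a s e * d (s ℕ.+ e) ^ n)

    -- The partial sums satisfy the recurrence exactly, with no truncation error: the gap at `e = 0`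
    -- is zero, and the remaining M terms become by `a-shift` the partial sum at s + 1.
    S-suc : ∀ n s M → S (suc n) s (suc M) ≈ d s * S n s (suc M) + y * (p ^ s * [ suc s ]) * S n (suc s) M
    S-suc n s M = begin
      ∑ (suc M) (λ e → a s e * (d (s ℕ.+ e) * d (s ℕ.+ e) ^ n))
        ≈⟨ ∑-cong (suc M) (λ e → trans (*-congˡ (*-congʳ (d-+ s e))) (solve 4 (λ a d x P → a :* ((d :+ x) :* P) := d :* (a :* P) :+ x :* a :* P) refl _ _ _ _)) ⟩
      ∑ (suc M) (λ e → d s * (a s e * d (s ℕ.+ e) ^ n) + δ e * a s e * d (s ℕ.+ e) ^ n)
        ≈⟨ ∑-+ (suc M) _ _ ⟩
      ∑ (suc M) (λ e → d s * (a s e * d (s ℕ.+ e) ^ n)) + ∑ (suc M) (λ e → δ e * a s e * d (s ℕ.+ e) ^ n)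
        ≈⟨ +-cong (∑-*ˡ (suc M) _ _) (∑-head M _) ⟩
      d s * S n s (suc M) + (δ 0 * a s 0 * d (s ℕ.+ 0) ^ n + ∑ M (λ e → δ (suc e) * a s (suc e) * d (s ℕ.+ suc e) ^ n))
        ≈⟨ +-congˡ (+-cong (solve 3 (λ x a P → con (+ 0) :* x :* a :* P := con (+ 0)) refl _ _ _)
             (∑-cong M (λ e → trans (*-cong (a-shift s e) (reflexive (≡.cong (λ i → d i ^ n) (ℕP.+-suc s e)))) (*-assoc _ _ _)))) ⟩
      d s * S n s (suc M) + (0# + ∑ M (λ e → y * (p ^ s * [ suc s ]) * (a (suc s) e * d (suc s ℕ.+ e) ^ n)))
        ≈⟨ +-congˡ (trans (+-identityˡ _) (∑-*ˡ M _ _)) ⟩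
      d s * S n s (suc M) + y * (p ^ s * [ suc s ]) * S n (suc s) M ∎
      where
      δ : ℕ → Carrier
      δ e = [ e ] * (q ^ suc s - y * p ^ (s ℕ.+ e))

    -- The value at s + 1 is needed only modulo y^M, because its coefficient contributes another y.
    -- At `M = 0` the claim is empty and `G n s` itself is the remainder.
    solution : ∀ n s M → ∃ λ r → G n s ≈ ∑ M (λ e → a s e * d (s ℕ.+ e) ^ n) + y ^ M * r
    solution n       s zero    = G n s , solve 1 (λ g → g := con (+ 0) :+ con (+ 1) :* g) refl _
    solution zero    s (suc M) with ∑a≈1 s (suc M)
    ... | r , 1≈ = r , trans (G-zero s) (trans 1≈ (+-congʳ (∑-cong (suc M) λ e → sym (*-identityʳ _))))
    solution (suc n) s (suc M) with solution n s (suc M) | solution n (suc s) M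
    ... | r₁ , eq₁ | r₂ , eq₂ = d s * r₁ + p ^ s * [ suc s ] * r₂ , (begin
      G (suc n) s
        ≈⟨ G-suc n s ⟩
      d s * G n s + y * (p ^ s * [ suc s ]) * G n (suc s)
        ≈⟨ +-cong (*-congˡ eq₁) (*-congˡ eq₂) ⟩
      d s * (S n s (suc M) + y * y ^ M * r₁) + y * (p ^ s * [ suc s ]) * (S n (suc s) M + y ^ M * r₂)
        ≈⟨ solve 8 (λ d S₁ y Y r₁ u S₂ r₂ → d :* (S₁ :+ y :* Y :* r₁) :+ y :* u :* (S₂ :+ Y :* r₂) := d :* S₁ :+ y :* u :* S₂ :+ y :* Y :* (d :* r₁ :+ u :* r₂)) refl _ _ _ _ _ _ _ _ ⟩
      d s * S n s (suc M) + y * (p ^ s * [ suc s ]) * S n (suc s) M + y * y ^ M * (d s * r₁ + p ^ s * [ suc s ] * r₂)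
        ≈⟨ +-congʳ (S-suc n s M) ⟨
      S (suc n) s (suc M) + y ^ suc M * (d s * r₁ + p ^ s * [ suc s ] * r₂) ∎)

-- The ring of formal power series over a commutative ring.

module Series {c ℓ} (R : CommutativeRing c ℓ) where
  open CommutativeRing R
  open IntegerSolver R
  open RangeSum R
  open import Relation.Binary.Reasoning.Setoid setoid

  Ser : Set c
  Ser = ℕ → Carrier

  infix 4 _≋_
  infixl 7 _⊛_

  _≋_ : Ser → Ser → Set ℓ
  F ≋ G = ∀ n → F n ≈ G n

  const : Carrier → Ser
  const x zero    = x
  const x (suc n) = 0#

  -- Written so that its tail is definitionally the series 1, which makes multiplication by it a
  -- shift.
  var : Ser
  var zero    = 0#
  var (suc n) = const 1# n

  -- The Cauchy product by recursion on the degree: F = F(0) + t F′ with F′ the tail of F. The ring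
  -- laws then follow by induction without reindexing of sums.
  _⊛_ : Ser → Ser → Ser
  (F ⊛ G) zero    = F 0 * G 0
  (F ⊛ G) (suc n) = F 0 * G (suc n) + (F ∘ suc ⊛ G) n

  ⊛-cong : ∀ {F F′ G G′} → F ≋ F′ → G ≋ G′ → F ⊛ G ≋ F′ ⊛ G′
  ⊛-cong F≋ G≋ zero    = *-cong (F≋ 0) (G≋ 0)
  ⊛-cong F≋ G≋ (suc n) = +-cong (*-cong (F≋ 0) (G≋ (suc n))) (⊛-cong (F≋ ∘ suc) G≋ n)

  -- The mirror image of the defining recursion, which is all that commutativity requires.
  ⊛-sucʳ : ∀ F G n → (F ⊛ G) (suc n) ≈ F (suc n) * G 0 + (F ⊛ (G ∘ suc)) n
  ⊛-sucʳ F G zero    = +-comm _ _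
  ⊛-sucʳ F G (suc n) = begin
    F 0 * G (suc (suc n)) + (F ∘ suc ⊛ G) (suc n)
      ≈⟨ +-congˡ (⊛-sucʳ (F ∘ suc) G n) ⟩
    F 0 * G (suc (suc n)) + (F (suc (suc n)) * G 0 + (F ∘ suc ⊛ G ∘ suc) n)
      ≈⟨ solve 3 (λ x y z → x :+ (y :+ z) := y :+ (x :+ z)) refl _ _ _ ⟩
    F (suc (suc n)) * G 0 + (F 0 * G (suc (suc n)) + (F ∘ suc ⊛ G ∘ suc) n) ∎

  ⊛-comm : ∀ F G → F ⊛ G ≋ G ⊛ F
  ⊛-comm F G zero    = *-comm _ _
  ⊛-comm F G (suc n) = begin
    F 0 * G (suc n) + (F ∘ suc ⊛ G) n   ≈⟨ +-cong (*-comm _ _) (⊛-comm (F ∘ suc) G n) ⟩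
    G (suc n) * F 0 + (G ⊛ F ∘ suc) n   ≈⟨ ⊛-sucʳ G F n ⟨
    (G ⊛ F) (suc n)                     ∎

  ⊛-distribʳ : ∀ H F G → (λ n → F n + G n) ⊛ H ≋ (λ n → (F ⊛ H) n + (G ⊛ H) n)
  ⊛-distribʳ H F G zero    = distribʳ _ _ _
  ⊛-distribʳ H F G (suc n) = trans (+-congˡ (⊛-distribʳ H (F ∘ suc) (G ∘ suc) n))
    (solve 5 (λ f g h x y → (f :+ g) :* h :+ (x :+ y) := (f :* h :+ x) :+ (g :* h :+ y)) refl _ _ _ _ _)

  ⊛-scale : ∀ x F G → (λ n → x * F n) ⊛ G ≋ (λ n → x * (F ⊛ G) n)
  ⊛-scale x F G zero    = *-assoc _ _ _
  ⊛-scale x F G (suc n) = trans (+-congˡ (⊛-scale x (F ∘ suc) G n))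
    (solve 4 (λ x f g y → x :* f :* g :+ x :* y := x :* (f :* g :+ y)) refl _ _ _ _)

  ⊛-assoc : ∀ F G H → (F ⊛ G) ⊛ H ≋ F ⊛ (G ⊛ H)
  ⊛-assoc F G H zero    = *-assoc _ _ _
  ⊛-assoc F G H (suc n) = begin
    F 0 * G 0 * H (suc n) + ((λ m → F 0 * G (suc m) + (F ∘ suc ⊛ G) m) ⊛ H) n
      ≈⟨ +-congˡ (⊛-distribʳ H _ _ n) ⟩
    F 0 * G 0 * H (suc n) + (((λ m → F 0 * G (suc m)) ⊛ H) n + ((F ∘ suc ⊛ G) ⊛ H) n)
      ≈⟨ +-congˡ (+-cong (⊛-scale (F 0) (G ∘ suc) H n) (⊛-assoc (F ∘ suc) G H n)) ⟩
    F 0 * G 0 * H (suc n) + (F 0 * (G ∘ suc ⊛ H) n + (F ∘ suc ⊛ (G ⊛ H)) n)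
      ≈⟨ solve 5 (λ f g h x y → f :* g :* h :+ (f :* x :+ y) := f :* (g :* h :+ x) :+ y) refl _ _ _ _ _ ⟩
    F 0 * (G 0 * H (suc n) + (G ∘ suc ⊛ H) n) + (F ∘ suc ⊛ (G ⊛ H)) n ∎

  0⊛ : ∀ F → (λ _ → 0#) ⊛ F ≋ (λ _ → 0#)
  0⊛ F zero    = zeroˡ _
  0⊛ F (suc n) = trans (+-cong (zeroˡ _) (0⊛ F n)) (+-identityʳ _)

  const-⊛ : ∀ x F → const x ⊛ F ≋ (λ n → x * F n)
  const-⊛ x F zero    = refl
  const-⊛ x F (suc n) = trans (+-congˡ (0⊛ F n)) (+-identityʳ _)

  seriesRing : CommutativeRing c ℓ
  seriesRing = record
    { Carrier = Ser
    ; _≈_ = _≋_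
    ; _+_ = λ F G n → F n + G n
    ; _*_ = _⊛_
    ; -_  = λ F n → - F n
    ; 0#  = λ _ → 0#
    ; 1#  = const 1#
    ; isCommutativeRing = record
      { isRing = record
        { +-isAbelianGroup = record
          { isGroup = record
            { isMonoid = record
              { isSemigroup = record
                { isMagma = record
                  { isEquivalence = record
                    { refl  = λ _ → refl
                    ; sym   = λ p n → sym (p n)
                    ; trans = λ p r n → trans (p n) (r n) }
                  ; ∙-cong = λ p r n → +-cong (p n) (r n) }
                ; assoc = λ _ _ _ _ → +-assoc _ _ _ }
              ; identity = (λ _ _ → +-identityˡ _) , (λ _ _ → +-identityʳ _) }
            ; inverse = (λ _ _ → -‿inverseˡ _) , (λ _ _ → -‿inverseʳ _)
            ; ⁻¹-cong = λ p n → -‿cong (p n) }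
          ; comm = λ _ _ _ → +-comm _ _ }
        ; *-cong = ⊛-cong
        ; *-assoc = ⊛-assoc
        ; *-identity = 1⊛ , (λ F n → trans (⊛-comm F _ n) (1⊛ F n))
        ; distrib = (λ H F G n → trans (⊛-comm H _ n) (trans (⊛-distribʳ H F G n) (+-cong (⊛-comm F H n) (⊛-comm G H n)))) , ⊛-distribʳ }
      ; *-comm = ⊛-comm } }
    where
    1⊛ : ∀ F → const 1# ⊛ F ≋ F
    1⊛ F n = trans (const-⊛ 1# F n) (*-identityˡ _)

  var-⊛-suc : ∀ F n → (var ⊛ F) (suc n) ≈ F n
  var-⊛-suc F n = trans (+-cong (zeroˡ _) (trans (const-⊛ 1# F n) (*-identityˡ _))) (+-identityˡ _)

  ⊛-∑ : ∀ F G n → (F ⊛ G) n ≈ ∑ (suc n) (λ a → F a * G (n ℕ.∸ a))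
  ⊛-∑ F G zero    = sym (+-identityˡ _)
  ⊛-∑ F G (suc n) = trans (+-congˡ (⊛-∑ (F ∘ suc) G n)) (sym (∑-head (suc n) _))

  private module S = CommutativeRing seriesRing
  open import Algebra.Properties.CommutativeSemiring.Exp S.commutativeSemiring using () renaming (_^_ to _^ˢ_)
  private module ∑S = RangeSum seriesRing

  ∑-coeff : ∀ m f n → ∑S.∑ m f n ≈ ∑ m (λ i → f i n)
  ∑-coeff zero    f n = refl
  ∑-coeff (suc m) f n = +-congʳ (∑-coeff m f n)

  var^-⊛-+ : ∀ m F n → (var ^ˢ m ⊛ F) (m ℕ.+ n) ≈ F n
  var^-⊛-+ zero    F n = S.*-identityˡ F n
  var^-⊛-+ (suc m) F n = begin
    (var ⊛ var ^ˢ m ⊛ F) (suc (m ℕ.+ n))     ≈⟨ ⊛-assoc var (var ^ˢ m) F (suc (m ℕ.+ n)) ⟩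
    (var ⊛ (var ^ˢ m ⊛ F)) (suc (m ℕ.+ n))   ≈⟨ var-⊛-suc (var ^ˢ m ⊛ F) (m ℕ.+ n) ⟩
    (var ^ˢ m ⊛ F) (m ℕ.+ n)                 ≈⟨ var^-⊛-+ m F n ⟩
    F n                                      ∎

  var^-⊛-< : ∀ m F {n} → n ℕ.< m → (var ^ˢ m ⊛ F) n ≈ 0#
  var^-⊛-< (suc m) F {zero}  _           = trans (⊛-assoc var (var ^ˢ m) F 0) (zeroˡ _)
  var^-⊛-< (suc m) F {suc n} (ℕ.s≤s n<m) = begin
    (var ⊛ var ^ˢ m ⊛ F) (suc n)     ≈⟨ ⊛-assoc var (var ^ˢ m) F (suc n) ⟩
    (var ⊛ (var ^ˢ m ⊛ F)) (suc n)   ≈⟨ var-⊛-suc (var ^ˢ m ⊛ F) n ⟩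
    (var ^ˢ m ⊛ F) n                 ≈⟨ var^-⊛-< m F n<m ⟩
    0#                               ∎

-- Fractions whose denominators are powers of one non-zero-divisor.

module Localization {c ℓ} (K : CommutativeRing c ℓ) (x : CommutativeRing.Carrier K) where
  open CommutativeRing K
  open IntegerSolver K
  open import Algebra.Properties.CommutativeSemiring.Exp commutativeSemiring
  open import Relation.Binary.Reasoning.Setoid setoid

  infix 4 _~_

  -- `s ÷ a` stands for a / x^s, in the order of arguments of `_⋆_`.
  record Frac : Set c where
    constructor _÷_
    field
      den : ℕ
      num : Carrier
  open Frac

  record _~_ (a b : Frac) : Set ℓ where
    constructor cross
    field
      uncross : x ^ den b * num a ≈ x ^ den a * num b
  open _~_ public

  module _ (cancel : ∀ n {a b} → x ^ n * a ≈ x ^ n * b → a ≈ b) where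

    -- Combining the two cross-multiplied equations leaves the middle denominator as a common
    -- factor; `cancel` removes it.
    ~-trans : ∀ {a b c} → a ~ b → b ~ c → a ~ c
    ~-trans {s ÷ a} {t ÷ b} {u ÷ c} (cross p) (cross r) = cross (cancel t (begin
      x ^ t * (x ^ u * a)  ≈⟨ solve 3 (λ t u a → t :* (u :* a) := u :* (t :* a)) refl _ _ _ ⟩
      x ^ u * (x ^ t * a)  ≈⟨ *-congˡ p ⟩
      x ^ u * (x ^ s * b)  ≈⟨ solve 3 (λ t u a → t :* (u :* a) := u :* (t :* a)) refl _ _ _ ⟩
      x ^ s * (x ^ u * b)  ≈⟨ *-congˡ r ⟩
      x ^ s * (x ^ t * c)  ≈⟨ solve 3 (λ t u a → t :* (u :* a) := u :* (t :* a)) refl _ _ _ ⟩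
      x ^ t * (x ^ s * c)  ∎))

    private
      ^+ : ∀ m n {a} → x ^ (m ℕ.+ n) * a ≈ x ^ m * x ^ n * a
      ^+ m n = *-congʳ (^-homo-* x m n)

      via : ∀ {a b a′ b′} → a ≈ a′ → b ≈ b′ → a′ ≈ b′ → a ≈ b
      via p r e = trans p (trans e (sym r))

      ^++ˡ : ∀ l m n {a} → x ^ (l ℕ.+ m ℕ.+ n) * a ≈ x ^ l * x ^ m * x ^ n * a
      ^++ˡ l m n = trans (^+ (l ℕ.+ m) n) (*-congʳ (*-congʳ (^-homo-* x l m)))

      ^++ʳ : ∀ l m n {a} → x ^ (l ℕ.+ (m ℕ.+ n)) * a ≈ x ^ l * (x ^ m * x ^ n) * a
      ^++ʳ l m n = trans (^+ l (m ℕ.+ n)) (*-congʳ (*-congˡ (^-homo-* x m n)))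

    fractions : CommutativeRing c ℓ
    fractions = record
      { Carrier = Frac
      ; _≈_ = _~_
      ; _+_ = λ a b → (den a ℕ.+ den b) ÷ (x ^ den b * num a + x ^ den a * num b)
      ; _*_ = λ a b → (den a ℕ.+ den b) ÷ (num a * num b)
      ; -_  = λ a → den a ÷ (- num a)
      ; 0#  = 0 ÷ 0#
      ; 1#  = 0 ÷ 1#
      ; isCommutativeRing = record
        { isRing = record
          { +-isAbelianGroup = record
            { isGroup = record
              { isMonoid = record
                { isSemigroup = record
                  { isMagma = record
                    { isEquivalence = record
                      { refl  = cross refl
                      ; sym   = λ p → cross (sym (uncross p))
                      ; trans = ~-trans }
                    ; ∙-cong = λ { {s ÷ a} {s′ ÷ a′} {t ÷ b} {t′ ÷ b′} (cross p) (cross r) → cross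
                        (via (^+ s′ t′) (^+ s t) (begin
                          x ^ s′ * x ^ t′ * (x ^ t * a + x ^ s * b)
                            ≈⟨ solve 6 (λ s s′ t t′ a b → s′ :* t′ :* (t :* a :+ s :* b) := t :* t′ :* (s′ :* a) :+ s :* s′ :* (t′ :* b)) refl _ _ _ _ _ _ ⟩
                          x ^ t * x ^ t′ * (x ^ s′ * a) + x ^ s * x ^ s′ * (x ^ t′ * b)
                            ≈⟨ +-cong (*-congˡ p) (*-congˡ r) ⟩
                          x ^ t * x ^ t′ * (x ^ s * a′) + x ^ s * x ^ s′ * (x ^ t * b′)
                            ≈⟨ solve 6 (λ s s′ t t′ a b → t :* t′ :* (s :* a) :+ s :* s′ :* (t :* b) := s :* t :* (t′ :* a :+ s′ :* b)) refl _ _ _ _ _ _ ⟩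
                          x ^ s * x ^ t * (x ^ t′ * a′ + x ^ s′ * b′) ∎)) } }
                  ; assoc = λ { (s ÷ a) (t ÷ b) (u ÷ c) → cross
                      (via (trans (^++ʳ s t u) (*-congˡ (+-congˡ (^+ s t)))) (trans (^++ˡ s t u) (*-congˡ (+-congʳ (^+ t u))))
                        (solve 6 (λ s t u a b c → s :* (t :* u) :* (u :* (t :* a :+ s :* b) :+ s :* t :* c) := s :* t :* u :* (t :* u :* a :+ s :* (u :* b :+ t :* c))) refl _ _ _ _ _ _)) } }
                ; identity = (λ { (s ÷ a) → cross (solve 2 (λ s a → s :* (s :* con (+ 0) :+ con (+ 1) :* a) := s :* a) refl _ _) })
                           , (λ { (s ÷ a) → cross (via refl (^+ s 0) (solve 2 (λ s a → s :* (con (+ 1) :* a :+ s :* con (+ 0)) := s :* con (+ 1) :* a) refl _ _)) }) }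
              ; inverse = (λ { (s ÷ a) → cross (via refl (^+ s s) (solve 2 (λ s a → con (+ 1) :* (s :* (:- a) :+ s :* a) := s :* s :* con (+ 0)) refl _ _)) })
                        , (λ { (s ÷ a) → cross (via refl (^+ s s) (solve 2 (λ s a → con (+ 1) :* (s :* a :+ s :* (:- a)) := s :* s :* con (+ 0)) refl _ _)) })
              ; ⁻¹-cong = λ { {s ÷ a} {t ÷ b} (cross p) → cross (begin
                  x ^ t * - a     ≈⟨ solve 2 (λ t a → t :* (:- a) := :- (t :* a)) refl _ _ ⟩
                  - (x ^ t * a)   ≈⟨ -‿cong p ⟩
                  - (x ^ s * b)   ≈⟨ solve 2 (λ t a → :- (t :* a) := t :* (:- a)) refl _ _ ⟩
                  x ^ s * - b     ∎) } }
            ; comm = λ { (s ÷ a) (t ÷ b) → cross (via (^+ t s) (^+ s t) (solve 4 (λ s t a b → t :* s :* (t :* a :+ s :* b) := s :* t :* (s :* b :+ t :* a)) refl _ _ _ _)) } }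
          ; *-cong = λ { {s ÷ a} {s′ ÷ a′} {t ÷ b} {t′ ÷ b′} (cross p) (cross r) → cross
              (via (^+ s′ t′) (^+ s t) (begin
                x ^ s′ * x ^ t′ * (a * b)      ≈⟨ solve 4 (λ s t a b → s :* t :* (a :* b) := s :* a :* (t :* b)) refl _ _ _ _ ⟩
                x ^ s′ * a * (x ^ t′ * b)      ≈⟨ *-cong p r ⟩
                x ^ s * a′ * (x ^ t * b′)      ≈⟨ solve 4 (λ s t a b → s :* a :* (t :* b) := s :* t :* (a :* b)) refl _ _ _ _ ⟩
                x ^ s * x ^ t * (a′ * b′)      ∎)) }
          ; *-assoc = λ { (s ÷ a) (t ÷ b) (u ÷ c) → cross
              (via (^++ʳ s t u) (^++ˡ s t u) (solve 6 (λ s t u a b c → s :* (t :* u) :* (a :* b :* c) := s :* t :* u :* (a :* (b :* c))) refl _ _ _ _ _ _)) }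
          ; *-identity = (λ { (s ÷ a) → cross (*-congˡ (*-identityˡ a)) })
                       , (λ { (s ÷ a) → cross (via refl (^+ s 0) (solve 2 (λ s a → s :* (a :* con (+ 1)) := s :* con (+ 1) :* a) refl _ _)) })
          ; distrib = (λ { (s ÷ a) (t ÷ b) (u ÷ c) → cross
                (via (trans (^+ (s ℕ.+ t) (s ℕ.+ u)) (*-congʳ (*-cong (^-homo-* x s t) (^-homo-* x s u))))
                     (trans (^++ʳ s t u) (*-congˡ (+-cong (^+ s u) (^+ s t))))
                  (solve 6 (λ s t u a b c → s :* t :* (s :* u) :* (a :* (u :* b :+ t :* c)) := s :* (t :* u) :* (s :* u :* (a :* b) :+ s :* t :* (a :* c))) refl _ _ _ _ _ _)) })
            , (λ { (s ÷ a) (t ÷ b) (u ÷ c) → cross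
                (via (trans (^+ (t ℕ.+ s) (u ℕ.+ s)) (*-congʳ (*-cong (^-homo-* x t s) (^-homo-* x u s))))
                     (trans (^++ˡ t u s) (*-congˡ (+-cong (^+ u s) (^+ t s))))
                  (solve 6 (λ s t u a b c → t :* s :* (u :* s) :* ((u :* b :+ t :* c) :* a) := t :* u :* s :* (u :* s :* (b :* a) :+ t :* s :* (c :* a))) refl _ _ _ _ _ _)) }) }
        ; *-comm = λ { (s ÷ a) (t ÷ b) → cross (via (^+ t s) (^+ s t) (solve 4 (λ s t a b → t :* s :* (a :* b) := s :* t :* (b :* a)) refl _ _ _ _)) } } }

-- Laurent polynomials form a commutative ring.

module Laurent where
  open Series ℤP.+-*-commutativeRing
  private module S = CommutativeRing seriesRing
  open import Algebra.Properties.CommutativeSemiring.Exp S.commutativeSemiring using (_^_)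
  open Localization seriesRing var

  coeff-padd : ∀ p r i → coeff (padd p r) i ≡ coeff p i ℤ.+ coeff r i
  coeff-padd []      r       i       = ≡.sym (ℤP.+-identityˡ _)
  coeff-padd (a ∷ p) []      i       = ≡.sym (ℤP.+-identityʳ _)
  coeff-padd (a ∷ p) (b ∷ r) zero    = ≡.refl
  coeff-padd (a ∷ p) (b ∷ r) (suc i) = coeff-padd p r i

  coeff-pscale : ∀ a p i → coeff (pscale a p) i ≡ a ℤ.* coeff p i
  coeff-pscale a []      i       = ≡.sym (ℤP.*-zeroʳ a)
  coeff-pscale a (b ∷ p) zero    = ≡.refl
  coeff-pscale a (b ∷ p) (suc i) = coeff-pscale a p i

  coeff-neg : ∀ p i → coeff (map ℤ.-_ p) i ≡ ℤ.- coeff p i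
  coeff-neg []      i       = ≡.refl
  coeff-neg (b ∷ p) zero    = ≡.refl
  coeff-neg (b ∷ p) (suc i) = coeff-neg p i

  coeff-pmul : ∀ p r → coeff (pmul p r) ≋ coeff p ⊛ coeff r
  coeff-pmul []      r i = ≡.sym (0⊛ (coeff r) i)
  coeff-pmul (a ∷ p) r i = ≡.trans (coeff-padd (pscale a r) (+ 0 ∷ pmul p r) i)
    (≡.trans (≡.cong (ℤ._+ coeff (+ 0 ∷ pmul p r) i) (coeff-pscale a r i)) (go i))
    where
    go : ∀ i → a ℤ.* coeff r i ℤ.+ coeff (+ 0 ∷ pmul p r) i ≡ (coeff (a ∷ p) ⊛ coeff r) i
    go zero    = ℤP.+-identityʳ _
    go (suc i) = ≡.cong (ℤ._+_ (a ℤ.* coeff r (suc i))) (coeff-pmul p r i)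

  coeff-pshift : ∀ t p → coeff (pshift t p) ≋ var ^ t ⊛ coeff p
  coeff-pshift zero    p i       = ≡.sym (S.*-identityˡ (coeff p) i)
  coeff-pshift (suc t) p zero    = ≡.sym (⊛-assoc var (var ^ t) (coeff p) 0)
  coeff-pshift (suc t) p (suc i) = ≡.trans (coeff-pshift t p i)
    (≡.sym (≡.trans (⊛-assoc var (var ^ t) (coeff p) (suc i)) (var-⊛-suc (var ^ t ⊛ coeff p) i)))

  var^-cancel : ∀ n {F G} → var ^ n ⊛ F ≋ var ^ n ⊛ G → F ≋ G
  var^-cancel n {F} {G} eq i =
    ≡.trans (≡.sym (var^-⊛-+ n F i)) (≡.trans (eq (n ℕ.+ i)) (var^-⊛-+ n G i))

  frac : L → Frac
  frac (s ⋆ p) = s ÷ coeff p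

  toFrac : ∀ {a b} → a ≈L b → frac a ~ frac b
  toFrac {s ⋆ p} {t ⋆ r} eq = cross λ i →
    ≡.trans (≡.sym (coeff-pshift t p i)) (≡.trans (eq i) (coeff-pshift s r i))

  fromFrac : ∀ {a b} → frac a ~ frac b → a ≈L b
  fromFrac {s ⋆ p} {t ⋆ r} (cross eq) i =
    ≡.trans (coeff-pshift t p i) (≡.trans (eq i) (≡.sym (coeff-pshift s r i)))

  rawLaurent : RawRing 0ℓ 0ℓ
  rawLaurent = record { Carrier = L ; _≈_ = _≈L_ ; _+_ = _+L_ ; _*_ = _*L_ ; -_ = negL ; 0# = 0L ; 1# = 1L }

  coeff-1 : coeff (+ 1 ∷ []) ≋ const (+ 1)
  coeff-1 zero    = ≡.refl
  coeff-1 (suc i) = ≡.refl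

  private
    num≋ : ∀ s {F G} → F ≋ G → (s ÷ F) ~ (s ÷ G)
    num≋ s F≋G = cross (⊛-cong {F = var ^ s} (λ _ → ≡.refl) F≋G)

  -- Coefficient lists are not unique representatives, because of trailing zeros, so the ring laws
  -- are not proved on lists. They are pulled back from power series with the variable inverted,
  -- where equality is the same cross-multiplication as in `_≈L_`; this is also why the map is
  -- injective.
  frac-isRingMonomorphism :
    IsRingMonomorphism rawLaurent (CommutativeRing.rawRing (fractions var^-cancel)) frac
  frac-isRingMonomorphism = record
    { isRingHomomorphism = record
      { isSemiringHomomorphism = record
        { isNearSemiringHomomorphism = record
          { +-isMonoidHomomorphism = record
            { isMagmaHomomorphism = record
              { isRelHomomorphism = record { cong = λ {a} {b} → toFrac {a} {b} }
              ; homo = λ { (s ⋆ p) (t ⋆ r) → num≋ (s ℕ.+ t) λ i →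
                  ≡.trans (coeff-padd (pshift t p) (pshift s r) i)
                          (≡.cong₂ ℤ._+_ (coeff-pshift t p i) (coeff-pshift s r i)) } }
            ; ε-homo = num≋ 0 λ _ → ≡.refl }
          ; *-homo = λ { (s ⋆ p) (t ⋆ r) → num≋ (s ℕ.+ t) (coeff-pmul p r) } }
        ; 1#-homo = num≋ 0 coeff-1 }
      ; -‿homo = λ { (s ⋆ p) → num≋ s (coeff-neg p) } }
    ; injective = λ {a} {b} → fromFrac {a} {b} }

  laurentRing : CommutativeRing 0ℓ 0ℓ
  laurentRing = record
    { isCommutativeRing = RingMonomorphism.isCommutativeRing frac-isRingMonomorphism
        (CommutativeRing.isCommutativeRing (fractions var^-cancel)) }

-- The Le condition as a scan, row by row and box by box.

module LeCondition where
  open import Data.List using ([_])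
  open ≡ using (refl; sym; trans; cong; cong₂)

  allN anyN : ℕ → (ℕ → Bool) → Bool
  allN zero    f = true
  allN (suc n) f = f 0 ∧ allN n (f ∘ suc)
  anyN zero    f = false
  anyN (suc n) f = f 0 ∨ anyN n (f ∘ suc)

  all-applyUpTo : ∀ (P : ℕ → Bool) f n → all P (applyUpTo f n) ≡ allN n (P ∘ f)
  all-applyUpTo P f zero    = refl
  all-applyUpTo P f (suc n) = cong (P (f 0) ∧_) (all-applyUpTo P (f ∘ suc) n)

  any-applyUpTo : ∀ (P : ℕ → Bool) f n → any P (applyUpTo f n) ≡ anyN n (P ∘ f)
  any-applyUpTo P f zero    = refl
  any-applyUpTo P f (suc n) = cong (P (f 0) ∨_) (any-applyUpTo P (f ∘ suc) n)

  allN-cong : ∀ n {f g : ℕ → Bool} → (∀ i → f i ≡ g i) → allN n f ≡ allN n g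
  allN-cong zero    eq = refl
  allN-cong (suc n) eq = cong₂ _∧_ (eq 0) (allN-cong n (eq ∘ suc))

  anyN-cong : ∀ n {f g : ℕ → Bool} → (∀ i → f i ≡ g i) → anyN n f ≡ anyN n g
  anyN-cong zero    eq = refl
  anyN-cong (suc n) eq = cong₂ _∨_ (eq 0) (anyN-cong n (eq ∘ suc))

  isT isF : Maybe Bool → Bool
  isT (just true) = true
  isT _           = false
  isF (just false) = true
  isF _            = false

  row : Filling → ℕ → List Bool
  row D i = fromMaybe [] (at D i)

  isOne-row : ∀ D i j → isOne D i j ≡ isT (at (row D i) j)
  isOne-row D i j with at D i
  ... | nothing = refl
  ... | just r with at r j
  ...   | nothing    = refl
  ...   | just true  = refl
  ...   | just false = refl

  isZero-row : ∀ D i j → isZero D i j ≡ isF (at (row D i) j)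
  isZero-row D i j with at D i
  ... | nothing = refl
  ... | just r with at r j
  ...   | nothing    = refl
  ...   | just true  = refl
  ...   | just false = refl

  -- The Le condition for D when σ j records whether column j already has a 1 above the rows of D.
  le : (ℕ → Bool) → Filling → Bool
  le σ D = allN (length D) λ i → allN (length (row D i)) λ j →
    not (isF (at (row D i) j)
         ∧ (σ j ∨ anyN i (λ i′ → isT (at (row D i′) j)))
         ∧ anyN j (λ j′ → isT (at (row D i) j′)))

  private
    box : Filling → ℕ → ℕ → Bool
    box D i j = not (isZero D i j ∧ any (λ i′ → isOne D i′ j) (upTo i) ∧ any (λ j′ → isOne D i j′) (upTo j))

    -- The row length used by leOK is local to its definition; unification recovers it.
    rows : ∀ D → ∃ λ P → leOK D ≡ all P (upTo (length D))
    rows D = _ , refl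

    rows-box : ∀ D i → proj₁ (rows D) i ≡ all (box D i) (upTo (length (row D i)))
    rows-box D i with at D i
    ... | nothing = refl
    ... | just r  = refl

  leOK-le : ∀ D → leOK D ≡ le (λ _ → false) D
  leOK-le D = trans (all-applyUpTo (proj₁ (rows D)) id (length D)) (allN-cong (length D) onRow)
    where
    onBox : ∀ i j → box D i j
      ≡ not (isF (at (row D i) j) ∧ anyN i (λ i′ → isT (at (row D i′) j)) ∧ anyN j (λ j′ → isT (at (row D i) j′)))
    onBox i j = cong not (cong₂ _∧_ (isZero-row D i j) (cong₂ _∧_
      (trans (any-applyUpTo _ _ i) (anyN-cong i λ i′ → isOne-row D i′ j))
      (trans (any-applyUpTo _ _ j) (anyN-cong j λ j′ → isOne-row D i j′))))
    onRow : ∀ i → proj₁ (rows D) i ≡ allN (length (row D i)) (λ j →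
      not (isF (at (row D i) j) ∧ anyN i (λ i′ → isT (at (row D i′) j)) ∧ anyN j (λ j′ → isT (at (row D i) j′))))
    onRow i = trans (rows-box D i) (trans (all-applyUpTo (box D i) id (length (row D i)))
      (allN-cong (length (row D i)) (onBox i)))

  -- A list of Booleans serves as a set of columns. Past its end it reads `false`, so
  -- `replicate m false` is the empty set for every `m`.
  hd : List Bool → Bool
  hd []      = false
  hd (b ∷ S) = b

  tl : List Bool → List Bool
  tl []      = []
  tl (b ∷ S) = S

  get : List Bool → ℕ → Bool
  get S zero    = hd S
  get S (suc j) = get (tl S) j

  infixr 5 _∪_
  _∪_ : List Bool → List Bool → List Bool
  S ∪ []      = S
  S ∪ (b ∷ r) = (hd S ∨ b) ∷ (tl S ∪ r)

  -- f records whether the row has a 1 further left, S the columns with a 1 above.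
  rowOK : Bool → List Bool → List Bool → Bool
  rowOK f S []      = true
  rowOK f S (b ∷ r) = (b ∨ not (hd S ∧ f)) ∧ rowOK (f ∨ b) (tl S) r

  diagOK : List Bool → Filling → Bool
  diagOK S []      = true
  diagOK S (r ∷ D) = rowOK false S r ∧ diagOK (S ∪ r) D

  get-∪ : ∀ S r j → get (S ∪ r) j ≡ get S j ∨ isT (at r j)
  get-∪ S []          j       = sym (𝔹P.∨-identityʳ _)
  get-∪ S (true ∷ r)  zero    = refl
  get-∪ S (false ∷ r) zero    = refl
  get-∪ S (b ∷ r)     (suc j) = get-∪ (tl S) r j

  -- The flag `f` is there for the induction: moving past the first box transfers its entry from the
  -- range of `anyN` to `f`.
  rowOK-le : ∀ f S r → allN (length r) (λ j → not (isF (at r j) ∧ get S j ∧ (f ∨ anyN j (λ j′ → isT (at r j′))))) ≡ rowOK f S r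
  rowOK-le f S []      = refl
  rowOK-le f S (b ∷ r) = cong₂ _∧_ (first b)
    (trans (allN-cong (length r) λ j → cong (λ x → not (isF (at r j) ∧ get (tl S) j ∧ x))
              (trans (cong (λ x → f ∨ (x ∨ anyN j (λ j′ → isT (at r j′)))) (isT-just b)) (sym (𝔹P.∨-assoc f b _))))
           (rowOK-le (f ∨ b) (tl S) r))
    where
    isT-just : ∀ b → isT (just b) ≡ b
    isT-just true  = refl
    isT-just false = refl
    first : ∀ b → not (isF (just b) ∧ hd S ∧ (f ∨ false)) ≡ b ∨ not (hd S ∧ f)
    first true  = refl
    first false = cong (λ x → not (hd S ∧ x)) (𝔹P.∨-identityʳ f)

  -- Likewise for rows: removing the top row transfers its 1's from the range of rows above to the
  -- column set, by `get-∪`.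
  diagOK-le : ∀ S D → le (get S) D ≡ diagOK S D
  diagOK-le S []      = refl
  diagOK-le S (r ∷ D) = cong₂ _∧_
    (trans (allN-cong (length r) λ j → cong (λ x → not (isF (at r j) ∧ x ∧ anyN j (λ j′ → isT (at r j′)))) (𝔹P.∨-identityʳ _))
           (rowOK-le false S r))
    (trans (allN-cong (length D) λ i → allN-cong (length (row D i)) λ j →
              cong (λ x → not (isF (at (row D i) j) ∧ x ∧ anyN j (λ j′ → isT (at (row D i) j′))))
                (trans (sym (𝔹P.∨-assoc (get S j) _ _)) (cong (_∨ _) (sym (get-∪ S r j)))))
           (diagOK-le (S ∪ r) D))

  -- The width `m` is left free here; it will be the width of the ambient rectangle, so that all
  -- shapes start from the same column set.
  leOK-diagOK : ∀ m D → leOK D ≡ diagOK (replicate m false) D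
  leOK-diagOK m D = trans (leOK-le D) (trans
    (allN-cong (length D) λ i → allN-cong (length (row D i)) λ j →
      cong (λ x → not (isF (at (row D i) j) ∧ (x ∨ anyN i _) ∧ anyN j _)) (sym (get-false m j)))
    (diagOK-le (replicate m false) D))
    where
    get-false : ∀ m j → get (replicate m false) j ≡ false
    get-false zero    zero    = refl
    get-false zero    (suc j) = get-false zero j
    get-false (suc m) zero    = refl
    get-false (suc m) (suc j) = get-false m j

  ∪-snoc : ∀ S b r → length r ℕ.≤ length S → (S ++ [ b ]) ∪ r ≡ (S ∪ r) ++ [ b ]
  ∪-snoc S       b []      _             = refl
  ∪-snoc (s ∷ S) b (c ∷ r) (ℕ.s≤s r≤S) = cong (_ ∷_) (∪-snoc S b r r≤S)

  length-∪ : ∀ S r → length r ℕ.≤ length S → length (S ∪ r) ≡ length S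
  length-∪ S       []      _           = refl
  length-∪ (s ∷ S) (c ∷ r) (ℕ.s≤s r≤S) = cong suc (length-∪ S r r≤S)

  rowOK-snoc : ∀ f S b r → length r ℕ.≤ length S → rowOK f (S ++ [ b ]) r ≡ rowOK f S r
  rowOK-snoc f S       b []      _           = refl
  rowOK-snoc f (s ∷ S) b (c ∷ r) (ℕ.s≤s r≤S) = cong ((c ∨ not (s ∧ f)) ∧_) (rowOK-snoc (f ∨ c) S b r r≤S)

-- Generating functions of fillings: transfer along a row, summation over shapes.

module Tableaux {c ℓ} (R : CommutativeRing c ℓ) (q : CommutativeRing.Carrier R) where
  open CommutativeRing R
  open IntegerSolver R
  open RangeSum R
  open LeCondition
  open import Data.List using ([_])
  open import Algebra.Properties.CommutativeSemiring.Exp commutativeSemiring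
  open import Relation.Binary.Reasoning.Setoid setoid

  χ : Bool → Carrier
  χ true  = 1#
  χ false = 0#

  χ-∧ : ∀ a b → χ (a ∧ b) ≈ χ a * χ b
  χ-∧ true  b = sym (*-identityˡ _)
  χ-∧ false b = sym (zeroˡ _)

  ∑ₗ : ∀ {a} {A : Set a} → List A → (A → Carrier) → Carrier
  ∑ₗ []      f = 0#
  ∑ₗ (x ∷ l) f = f x + ∑ₗ l f

  module _ {a} {A : Set a} where

    ∑ₗ-cong : ∀ (l : List A) {f g} → (∀ x → f x ≈ g x) → ∑ₗ l f ≈ ∑ₗ l g
    ∑ₗ-cong []      f≈g = refl
    ∑ₗ-cong (x ∷ l) f≈g = +-cong (f≈g x) (∑ₗ-cong l f≈g)

    ∑ₗ-++ : ∀ (l m : List A) f → ∑ₗ (l ++ m) f ≈ ∑ₗ l f + ∑ₗ m f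
    ∑ₗ-++ []      m f = sym (+-identityˡ _)
    ∑ₗ-++ (x ∷ l) m f = trans (+-congˡ (∑ₗ-++ l m f)) (sym (+-assoc _ _ _))

    ∑ₗ-*ˡ : ∀ (l : List A) x f → ∑ₗ l (λ a → x * f a) ≈ x * ∑ₗ l f
    ∑ₗ-*ˡ []      x f = sym (zeroʳ x)
    ∑ₗ-*ˡ (a ∷ l) x f = trans (+-congˡ (∑ₗ-*ˡ l x f)) (sym (distribˡ x _ _))

    ∑ₗ-filterᵇ : ∀ P (l : List A) f → ∑ₗ (filterᵇ P l) f ≈ ∑ₗ l (λ x → χ (P x) * f x)
    ∑ₗ-filterᵇ P []      f = refl
    ∑ₗ-filterᵇ P (x ∷ l) f with P x
    ... | true  = +-cong (sym (*-identityˡ _)) (∑ₗ-filterᵇ P l f)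
    ... | false = trans (∑ₗ-filterᵇ P l f) (sym (trans (+-congʳ (zeroˡ _)) (+-identityˡ _)))

  module _ {a b} {A : Set a} {B : Set b} where

    ∑ₗ-map : ∀ (h : A → B) l f → ∑ₗ (map h l) f ≈ ∑ₗ l (f ∘ h)
    ∑ₗ-map h []      f = refl
    ∑ₗ-map h (x ∷ l) f = +-congˡ (∑ₗ-map h l f)

    ∑ₗ-concatMap : ∀ (h : A → List B) l f → ∑ₗ (concatMap h l) f ≈ ∑ₗ l (λ x → ∑ₗ (h x) f)
    ∑ₗ-concatMap h []      f = refl
    ∑ₗ-concatMap h (x ∷ l) f = trans (∑ₗ-++ (h x) (concatMap h l) f) (+-congˡ (∑ₗ-concatMap h l f))

  ∑ₗ-applyUpTo : ∀ {a} {A : Set a} (h : ℕ → A) n f → ∑ₗ (applyUpTo h n) f ≈ ∑ n (f ∘ h)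
  ∑ₗ-applyUpTo h zero    f = refl
  ∑ₗ-applyUpTo h (suc n) f = trans (+-congˡ (∑ₗ-applyUpTo (h ∘ suc) n f)) (sym (∑-head n (f ∘ h)))

  -- Words of length `l` serve both as rows of a filling and as column sets. The recursion also
  -- gives `bsum-cong` access to the length of the word.
  bsum : ℕ → (List Bool → Carrier) → Carrier
  bsum zero    f = f []
  bsum (suc l) f = bsum l (f ∘ (true ∷_)) + bsum l (f ∘ (false ∷_))

  bsum-cong : ∀ l {f g} → (∀ r → length r ≡ l → f r ≈ g r) → bsum l f ≈ bsum l g
  bsum-cong zero    f≈g = f≈g [] ≡.refl
  bsum-cong (suc l) f≈g = +-cong (bsum-cong l λ r len → f≈g (true ∷ r) (≡.cong suc len))
                                 (bsum-cong l λ r len → f≈g (false ∷ r) (≡.cong suc len))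

  bsum-+ : ∀ l f g → bsum l (λ r → f r + g r) ≈ bsum l f + bsum l g
  bsum-+ zero    f g = refl
  bsum-+ (suc l) f g = trans (+-cong (bsum-+ l _ _) (bsum-+ l _ _))
    (solve 4 (λ a b c d → (a :+ b) :+ (c :+ d) := (a :+ c) :+ (b :+ d)) refl _ _ _ _)

  bsum-*ˡ : ∀ l x f → bsum l (λ r → x * f r) ≈ x * bsum l f
  bsum-*ˡ zero    x f = refl
  bsum-*ˡ (suc l) x f = trans (+-cong (bsum-*ˡ l x _) (bsum-*ˡ l x _)) (sym (distribˡ x _ _))

  bsum-snoc : ∀ l f → bsum (suc l) f ≈ bsum l (λ r → f (r ++ [ true ]) + f (r ++ [ false ]))
  bsum-snoc zero    f = refl
  bsum-snoc (suc l) f = +-cong (bsum-snoc l (f ∘ (true ∷_))) (bsum-snoc l (f ∘ (false ∷_)))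

  ∑ₗ-allBools : ∀ l f → ∑ₗ (allBools l) f ≈ bsum l f
  ∑ₗ-allBools zero    f = +-identityʳ _
  ∑ₗ-allBools (suc l) f = begin
    ∑ₗ (concatMap (λ b → map (b ∷_) (allBools l)) (true ∷ false ∷ [])) f
      ≈⟨ ∑ₗ-concatMap (λ b → map (b ∷_) (allBools l)) (true ∷ false ∷ []) f ⟩
    ∑ₗ (map (true ∷_) (allBools l)) f + (∑ₗ (map (false ∷_) (allBools l)) f + 0#)
      ≈⟨ +-cong (half true) (trans (+-identityʳ _) (half false)) ⟩
    bsum (suc l) f ∎
    where
    half : ∀ b → ∑ₗ (map (b ∷_) (allBools l)) f ≈ bsum l (f ∘ (b ∷_))
    half b = trans (∑ₗ-map (b ∷_) (allBools l) f) (∑ₗ-allBools l _)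

  -- The transfer operator of one row: `H` is evaluated at the column set that the rows below will
  -- see.
  rowSum : Bool → ℕ → List Bool → (List Bool → Carrier) → Carrier
  rowSum f l S H = bsum l (λ r → χ (rowOK f S r) * (q ^ countTrue r * H (S ∪ r)))

  -- Rank generating function of the Le-fillings of the rows ls under columns of which S have a 1 above.
  weight : List Bool → List ℕ → Carrier
  weight S []       = 1#
  weight S (l ∷ ls) = rowSum false l S (λ S′ → weight S′ ls)

  ∑ₗ-fillings : ∀ S ls → ∑ₗ (fillings ls) (λ D → χ (diagOK S D) * q ^ rank D) ≈ weight S ls
  ∑ₗ-fillings S []       = trans (+-identityʳ _) (*-identityʳ _)
  ∑ₗ-fillings S (l ∷ ls) = begin
    ∑ₗ (concatMap (λ r → map (r ∷_) (fillings ls)) (allBools l)) f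
      ≈⟨ ∑ₗ-concatMap _ (allBools l) f ⟩
    ∑ₗ (allBools l) (λ r → ∑ₗ (map (r ∷_) (fillings ls)) f)
      ≈⟨ ∑ₗ-cong (allBools l) onRow ⟩
    ∑ₗ (allBools l) (λ r → χ (rowOK false S r) * (q ^ countTrue r * weight (S ∪ r) ls))
      ≈⟨ ∑ₗ-allBools l _ ⟩
    weight S (l ∷ ls) ∎
    where
    f : Filling → Carrier
    f D = χ (diagOK S D) * q ^ rank D
    onRow : ∀ r → ∑ₗ (map (r ∷_) (fillings ls)) f ≈ χ (rowOK false S r) * (q ^ countTrue r * weight (S ∪ r) ls)
    onRow r = begin
      ∑ₗ (map (r ∷_) (fillings ls)) f
        ≈⟨ ∑ₗ-map (r ∷_) (fillings ls) f ⟩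
      ∑ₗ (fillings ls) (λ D → χ (rowOK false S r ∧ diagOK (S ∪ r) D) * q ^ (countTrue r ℕ.+ rank D))
        ≈⟨ ∑ₗ-cong (fillings ls) (λ D → trans (*-cong (χ-∧ (rowOK false S r) _) (^-homo-* q (countTrue r) (rank D)))
             (solve 4 (λ a b c d → a :* b :* (c :* d) := a :* c :* (b :* d)) refl _ _ _ _)) ⟩
      ∑ₗ (fillings ls) (λ D → χ (rowOK false S r) * q ^ countTrue r * (χ (diagOK (S ∪ r) D) * q ^ rank D))
        ≈⟨ ∑ₗ-*ˡ (fillings ls) _ _ ⟩
      χ (rowOK false S r) * q ^ countTrue r * ∑ₗ (fillings ls) (λ D → χ (diagOK (S ∪ r) D) * q ^ rank D)
        ≈⟨ *-congˡ (∑ₗ-fillings (S ∪ r) ls) ⟩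
      χ (rowOK false S r) * q ^ countTrue r * weight (S ∪ r) ls
        ≈⟨ *-assoc _ _ _ ⟩
      χ (rowOK false S r) * (q ^ countTrue r * weight (S ∪ r) ls) ∎

  -- No remaining row reaches the added column, so no box can be affected by a 1 in it.
  weight-snoc : ∀ S b ls → All (ℕ._≤ length S) ls → weight (S ++ [ b ]) ls ≈ weight S ls
  weight-snoc S b []       _            = refl
  weight-snoc S b (l ∷ ls) (l≤S ∷ ls≤S) = bsum-cong l onRow
    where
    onRow : ∀ r → length r ≡ l → χ (rowOK false (S ++ [ b ]) r) * (q ^ countTrue r * weight ((S ++ [ b ]) ∪ r) ls)
                               ≈ χ (rowOK false S r) * (q ^ countTrue r * weight (S ∪ r) ls)
    onRow r ≡.refl = *-cong (reflexive (≡.cong χ (rowOK-snoc false S b r l≤S))) (*-congˡ (trans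
      (reflexive (≡.cong (λ S′ → weight S′ ls) (∪-snoc S b r l≤S)))
      (weight-snoc (S ∪ r) b ls (≡.subst (λ n → All (ℕ._≤ n) ls) (≡.sym (length-∪ S r l≤S)) ls≤S))))

  colSum : Carrier → ℕ → (List Bool → Carrier) → Carrier
  colSum w m H = bsum m (λ S → w ^ countTrue S * H S)

  colSum-head : ∀ w m H → colSum w (suc m) H ≈ w * colSum w m (H ∘ (true ∷_)) + colSum w m (H ∘ (false ∷_))
  colSum-head w m H = +-congʳ (trans (bsum-cong m λ S _ → *-assoc _ _ _) (bsum-*ˡ m w _))

  colSum-+ : ∀ w m F G → colSum w m (λ S → F S + G S) ≈ colSum w m F + colSum w m G
  colSum-+ w m F G = trans (bsum-cong m λ S _ → distribˡ _ _ _) (bsum-+ m _ _)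

  colSum-*ˡ : ∀ w m x F → colSum w m (λ S → x * F S) ≈ x * colSum w m F
  colSum-*ˡ w m x F = trans (bsum-cong m λ S _ → solve 3 (λ a b c → a :* (b :* c) := b :* (a :* c)) refl _ _ _) (bsum-*ˡ m x _)

  colSum-cong : ∀ w m {F G} → (∀ S → length S ≡ m → F S ≈ G S) → colSum w m F ≈ colSum w m G
  colSum-cong w m F≈G = bsum-cong m λ S len → *-congˡ (F≈G S len)

  colSum-snoc : ∀ w m {F} → (∀ S b → length S ≡ m → F (S ++ [ b ]) ≈ F S) → colSum w (suc m) F ≈ (1# + w) * colSum w m F
  colSum-snoc w m {F} F-snoc = begin
    colSum w (suc m) F
      ≈⟨ bsum-snoc m (λ S → w ^ countTrue S * F S) ⟩
    bsum m (λ S → w ^ countTrue (S ++ [ true ]) * F (S ++ [ true ]) + w ^ countTrue (S ++ [ false ]) * F (S ++ [ false ]))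
      ≈⟨ bsum-cong m (λ S len → trans
           (+-cong (*-cong (reflexive (≡.cong (w ^_) (count-true S))) (F-snoc S true len))
                   (*-cong (reflexive (≡.cong (w ^_) (count-false S))) (F-snoc S false len)))
           (solve 3 (λ w x f → w :* x :* f :+ x :* f := (con (+ 1) :+ w) :* (x :* f)) refl _ _ _)) ⟩
    bsum m (λ S → (1# + w) * (w ^ countTrue S * F S))
      ≈⟨ bsum-*ˡ m (1# + w) _ ⟩
    (1# + w) * colSum w m F ∎
    where
    count-true : ∀ S → countTrue (S ++ [ true ]) ≡ suc (countTrue S)
    count-true []          = ≡.refl
    count-true (true ∷ S)  = ≡.cong suc (count-true S)
    count-true (false ∷ S) = count-true S
    count-false : ∀ S → countTrue (S ++ [ false ]) ≡ countTrue S
    count-false []          = ≡.refl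
    count-false (true ∷ S)  = ≡.cong suc (count-false S)
    count-false (false ∷ S) = count-false S

  colSum-zero : ∀ m F → colSum 0# m F ≈ F (replicate m false)
  colSum-zero zero    F = *-identityˡ _
  colSum-zero (suc m) F = begin
    colSum 0# (suc m) F                                                        ≈⟨ colSum-head 0# m F ⟩
    0# * colSum 0# m (F ∘ (true ∷_)) + colSum 0# m (F ∘ (false ∷_))           ≈⟨ trans (+-congʳ (zeroˡ _)) (+-identityˡ _) ⟩
    colSum 0# m (F ∘ (false ∷_))                                               ≈⟨ colSum-zero m _ ⟩
    F (false ∷ replicate m false)                                              ∎

  rowSum-suc : ∀ f l s S H → rowSum f (suc l) (s ∷ S) H
    ≈ q * rowSum (f ∨ true) l S (H ∘ ((s ∨ true) ∷_)) + χ (not (s ∧ f)) * rowSum (f ∨ false) l S (H ∘ ((s ∨ false) ∷_))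
  rowSum-suc f l s S H = +-cong
    (trans (bsum-cong l λ r _ → solve 4 (λ a q b h → a :* (q :* b :* h) := q :* (a :* (b :* h))) refl _ _ _ _) (bsum-*ˡ l q _))
    (trans (bsum-cong l λ r _ → trans (*-congʳ (χ-∧ (not (s ∧ f)) _)) (*-assoc _ _ _)) (bsum-*ˡ l _ _))

  module _ (w : Carrier) where
    private
      qz : Carrier
      qz = q * (1# + w)

    -- With a 1 further left the columns act independently. A column occupied afterwards either was
    -- occupied and is forced to receive a 1, with weight w q, or receives its first 1, with weight
    -- q; together q (1 + w). A column empty afterwards was empty and receives 0, with weight 1.
    colSum-rowSum-true : ∀ l H → colSum w l (λ S → rowSum true l S H) ≈ colSum qz l H
    colSum-rowSum-true zero    H = *-congˡ (trans (*-identityˡ _) (*-identityˡ _))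
    colSum-rowSum-true (suc l) H = begin
      colSum w (suc l) (λ S → rowSum true (suc l) S H)
        ≈⟨ colSum-head w l (λ S → rowSum true (suc l) S H) ⟩
      w * colSum w l (λ S → rowSum true (suc l) (true ∷ S) H) + colSum w l (λ S → rowSum true (suc l) (false ∷ S) H)
        ≈⟨ +-cong (*-congˡ (colSum-cong w l λ S _ → trans (rowSum-suc true l true S H) (trans (+-congˡ (zeroˡ _)) (+-identityʳ _))))
                  (colSum-cong w l λ S _ → trans (rowSum-suc true l false S H) (+-congˡ (*-identityˡ _))) ⟩
      w * colSum w l (λ S → q * rowSum true l S H₁) + colSum w l (λ S → q * rowSum true l S H₁ + rowSum true l S H₀)
        ≈⟨ +-cong (*-congˡ (colSum-*ˡ w l q _)) (trans (colSum-+ w l _ _) (+-congʳ (colSum-*ˡ w l q _))) ⟩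
      w * (q * colSum w l (λ S → rowSum true l S H₁)) + (q * colSum w l (λ S → rowSum true l S H₁) + colSum w l (λ S → rowSum true l S H₀))
        ≈⟨ solve 4 (λ w q a b → w :* (q :* a) :+ (q :* a :+ b) := q :* (con (+ 1) :+ w) :* a :+ b) refl _ _ _ _ ⟩
      qz * colSum w l (λ S → rowSum true l S H₁) + colSum w l (λ S → rowSum true l S H₀)
        ≈⟨ +-cong (*-congˡ (colSum-rowSum-true l H₁)) (colSum-rowSum-true l H₀) ⟩
      qz * colSum qz l H₁ + colSum qz l H₀
        ≈⟨ colSum-head qz l H ⟨
      colSum qz (suc l) H ∎
      where
      H₁ H₀ : List Bool → Carrier
      H₁ = H ∘ (true ∷_)
      H₀ = H ∘ (false ∷_)

    -- Split by the position of the first 1 in the row. Columns before it keep their state and the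
    -- weight w; from that column on the weight is q (1 + w), and that column ends up occupied.
    -- Multiplied by the difference of the two weights, the sum over the position telescopes, and
    -- the row without a 1 adds `colSum w l H`.
    colSum-rowSum-false : ∀ l H →
      (qz - w) * colSum w l (λ S → rowSum false l S H) ≈ qz * colSum qz l H - w * colSum w l H
    colSum-rowSum-false zero    H =
      solve 3 (λ z w h → (z :- w) :* (con (+ 1) :* (con (+ 1) :* (con (+ 1) :* h))) := z :* (con (+ 1) :* h) :- w :* (con (+ 1) :* h)) refl _ _ _
    colSum-rowSum-false (suc l) H = begin
      (qz - w) * colSum w (suc l) (λ S → rowSum false (suc l) S H)
        ≈⟨ *-congˡ (colSum-head w l (λ S → rowSum false (suc l) S H)) ⟩
      (qz - w) * (w * colSum w l (λ S → rowSum false (suc l) (true ∷ S) H) + colSum w l (λ S → rowSum false (suc l) (false ∷ S) H))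
        ≈⟨ *-congˡ (+-cong (*-congˡ (colSum-cong w l λ S _ → trans (rowSum-suc false l true S H) (+-congˡ (*-identityˡ _))))
                  (colSum-cong w l λ S _ → trans (rowSum-suc false l false S H) (+-congˡ (*-identityˡ _)))) ⟩
      (qz - w) * (w * colSum w l (λ S → q * rowSum true l S H₁ + rowSum false l S H₁) + colSum w l (λ S → q * rowSum true l S H₁ + rowSum false l S H₀))
        ≈⟨ *-congˡ (+-cong (*-congˡ (trans (colSum-+ w l _ _) (+-congʳ (colSum-*ˡ w l q _)))) (trans (colSum-+ w l _ _) (+-congʳ (colSum-*ˡ w l q _)))) ⟩
      (qz - w) * (w * (q * t + colSum w l (λ S → rowSum false l S H₁)) + (q * t + colSum w l (λ S → rowSum false l S H₀)))
        ≈⟨ solve 5 (λ w q t a b → (q :* (con (+ 1) :+ w) :- w) :* (w :* (q :* t :+ a) :+ (q :* t :+ b))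
             := (q :* (con (+ 1) :+ w) :- w) :* (q :* (con (+ 1) :+ w) :* t) :+ w :* ((q :* (con (+ 1) :+ w) :- w) :* a) :+ (q :* (con (+ 1) :+ w) :- w) :* b) refl _ _ _ _ _ ⟩
      (qz - w) * (qz * t) + w * ((qz - w) * colSum w l (λ S → rowSum false l S H₁)) + (qz - w) * colSum w l (λ S → rowSum false l S H₀)
        ≈⟨ +-cong (+-cong (*-congˡ (*-congˡ (colSum-rowSum-true l H₁))) (*-congˡ (colSum-rowSum-false l H₁))) (colSum-rowSum-false l H₀) ⟩
      (qz - w) * (qz * colSum qz l H₁) + w * (qz * colSum qz l H₁ - w * colSum w l H₁) + (qz * colSum qz l H₀ - w * colSum w l H₀)
        ≈⟨ solve 6 (λ z w a b c d → (z :- w) :* (z :* a) :+ w :* (z :* a :- w :* b) :+ (z :* c :- w :* d) := z :* (z :* a :+ c) :- w :* (w :* b :+ d)) refl _ _ _ _ _ _ ⟩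
      qz * (qz * colSum qz l H₁ + colSum qz l H₀) - w * (w * colSum w l H₁ + colSum w l H₀)
        ≈⟨ +-cong (*-congˡ (colSum-head qz l H)) (-‿cong (*-congˡ (colSum-head w l H))) ⟨
      qz * colSum qz (suc l) H - w * colSum w (suc l) H ∎
      where
      H₁ H₀ : List Bool → Carrier
      H₁ = H ∘ (true ∷_)
      H₀ = H ∘ (false ∷_)
      t : Carrier
      t = colSum w l (λ S → rowSum true l S H₁)

  -- Each part bounds the range of the next, so only partitions occur and the test `nonincr`
  -- disappears.
  psum : ℕ → ℕ → (List ℕ → Carrier) → Carrier
  psum zero    m F = F []
  psum (suc k) m F = ∑ (suc m) (λ a → psum k a (F ∘ (a ∷_)))

  psum-cong : ∀ k m {F G} → (∀ ls → All (ℕ._≤ m) ls → F ls ≈ G ls) → psum k m F ≈ psum k m G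
  psum-cong zero    m F≈G = F≈G [] []
  psum-cong (suc k) m F≈G = ∑-cong< (suc m) λ { a (ℕ.s≤s a≤m) → psum-cong k a λ ls ls≤a →
    F≈G (a ∷ ls) (a≤m ∷ All.map (λ l≤a → ℕP.≤-trans l≤a a≤m) ls≤a) }

  psum-+ : ∀ k m F G → psum k m (λ ls → F ls + G ls) ≈ psum k m F + psum k m G
  psum-+ zero    m F G = refl
  psum-+ (suc k) m F G = trans (∑-cong (suc m) λ a → psum-+ k a _ _) (∑-+ (suc m) _ _)

  psum-*ˡ : ∀ k m x F → psum k m (λ ls → x * F ls) ≈ x * psum k m F
  psum-*ˡ zero    m x F = refl
  psum-*ˡ (suc k) m x F = trans (∑-cong (suc m) λ a → psum-*ˡ k a x _) (∑-*ˡ (suc m) x _)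

  ∑-restrict : ∀ t a g → ∑ (suc (t ℕ.+ a)) (λ b → χ (b ℕ.≤ᵇ a) * g b) ≈ ∑ (suc a) g
  ∑-restrict zero    a g = ∑-cong< (suc a) λ { b (ℕ.s≤s b≤a) →
    trans (*-congʳ (reflexive (≡.cong χ (≤ᵇ-true b≤a)))) (*-identityˡ _) }
    where
    ≤ᵇ-true : ∀ {b} → b ℕ.≤ a → (b ℕ.≤ᵇ a) ≡ true
    ≤ᵇ-true {b} b≤a with b ℕ.≤ᵇ a | ℕP.≤⇒≤ᵇ b≤a
    ... | true | _ = ≡.refl
  ∑-restrict (suc t) a g = begin
    ∑ (suc (t ℕ.+ a)) (λ b → χ (b ℕ.≤ᵇ a) * g b) + χ (suc (t ℕ.+ a) ℕ.≤ᵇ a) * g (suc (t ℕ.+ a))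
      ≈⟨ +-congˡ (trans (*-congʳ (reflexive (≡.cong χ ≤ᵇ-false))) (zeroˡ _)) ⟩
    ∑ (suc (t ℕ.+ a)) (λ b → χ (b ℕ.≤ᵇ a) * g b) + 0#
      ≈⟨ +-identityʳ _ ⟩
    ∑ (suc (t ℕ.+ a)) (λ b → χ (b ℕ.≤ᵇ a) * g b)
      ≈⟨ ∑-restrict t a g ⟩
    ∑ (suc a) g ∎
    where
    ≤ᵇ-false : (suc (t ℕ.+ a) ℕ.≤ᵇ a) ≡ false
    ≤ᵇ-false with suc (t ℕ.+ a) ℕ.≤ᵇ a | ℕP.≤ᵇ⇒≤ (suc (t ℕ.+ a)) a
    ... | false | _ = ≡.refl
    ... | true  | f with () ← ℕP.<-irrefl ≡.refl (ℕP.≤-trans (ℕ.s≤s (ℕP.m≤n+m a t)) (f _))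

  ∑ₗ-allLists : ∀ k m F → ∑ₗ (allLists (suc k) m) F ≈ ∑ (suc m) (λ a → ∑ₗ (allLists k m) (F ∘ (a ∷_)))
  ∑ₗ-allLists k m F = trans (∑ₗ-concatMap (λ a → map (a ∷_) (allLists k m)) (upTo (suc m)) F)
    (trans (∑ₗ-applyUpTo id (suc m) (λ a → ∑ₗ (map (a ∷_) (allLists k m)) F)) (∑-cong (suc m) λ a → ∑ₗ-map (a ∷_) (allLists k m) F))

  -- `nonincr` always looks at two consecutive parts, so the induction needs a companion in which
  -- the preceding part `a` is fixed while the list still ranges up to `m`.
  nonincr-sum : ∀ k m F → ∑ₗ (allLists k m) (λ ls → χ (nonincr ls) * F ls) ≈ psum k m F
  nonincr-below : ∀ k {m a} F → a ℕ.≤ m → ∑ₗ (allLists k m) (λ ls → χ (nonincr (a ∷ ls)) * F ls) ≈ psum k a F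

  nonincr-sum zero    m F = trans (+-identityʳ _) (*-identityˡ _)
  nonincr-sum (suc k) m F = trans (∑ₗ-allLists k m _)
    (∑-cong< (suc m) λ { a (ℕ.s≤s a≤m) → nonincr-below k (F ∘ (a ∷_)) a≤m })

  nonincr-below zero    F a≤m = trans (+-identityʳ _) (*-identityˡ _)
  nonincr-below (suc k) {m} {a} F a≤m = begin
    ∑ₗ (allLists (suc k) m) (λ ls → χ (nonincr (a ∷ ls)) * F ls)
      ≈⟨ ∑ₗ-allLists k m _ ⟩
    ∑ (suc m) (λ b → ∑ₗ (allLists k m) (λ ls → χ ((b ℕ.≤ᵇ a) ∧ nonincr (b ∷ ls)) * F (b ∷ ls)))
      ≈⟨ ∑-cong (suc m) (λ b → trans (∑ₗ-cong (allLists k m) λ ls → trans (*-congʳ (χ-∧ (b ℕ.≤ᵇ a) _)) (*-assoc _ _ _)) (∑ₗ-*ˡ (allLists k m) _ _)) ⟩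
    ∑ (suc m) (λ b → χ (b ℕ.≤ᵇ a) * ∑ₗ (allLists k m) (λ ls → χ (nonincr (b ∷ ls)) * F (b ∷ ls)))
      ≈⟨ ∑-cong< (suc m) (λ { b (ℕ.s≤s b≤m) → *-congˡ (nonincr-below k (F ∘ (b ∷_)) b≤m) }) ⟩
    ∑ (suc m) g
      ≡⟨ ≡.cong (λ n → ∑ (suc n) g) (≡.sym (ℕP.m∸n+n≡m a≤m)) ⟩
    ∑ (suc (m ℕ.∸ a ℕ.+ a)) g
      ≈⟨ ∑-restrict (m ℕ.∸ a) a _ ⟩
    psum (suc k) a F ∎
    where
    g : ℕ → Carrier
    g b = χ (b ℕ.≤ᵇ a) * psum k b (F ∘ (b ∷_))

  LeDiagrams-sum : ∀ k n → ∑ₗ (LeDiagrams k n) (λ d → q ^ rank (proj₂ d))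
    ≈ psum k (n ℕ.∸ k) (λ ls → weight (replicate (n ℕ.∸ k) false) ls)
  LeDiagrams-sum k n = begin
    ∑ₗ (LeDiagrams k n) (λ d → q ^ rank (proj₂ d))
      ≈⟨ ∑ₗ-concatMap (λ ls → map (ls ,_) (filterᵇ leOK (fillings ls))) (partitions k m) _ ⟩
    ∑ₗ (partitions k m) (λ ls → ∑ₗ (map (ls ,_) (filterᵇ leOK (fillings ls))) (λ d → q ^ rank (proj₂ d)))
      ≈⟨ ∑ₗ-cong (partitions k m) onShape ⟩
    ∑ₗ (partitions k m) (λ ls → weight (replicate m false) ls)
      ≈⟨ ∑ₗ-filterᵇ nonincr (allLists k m) _ ⟩
    ∑ₗ (allLists k m) (λ ls → χ (nonincr ls) * weight (replicate m false) ls)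
      ≈⟨ nonincr-sum k m _ ⟩
    psum k m (λ ls → weight (replicate m false) ls) ∎
    where
    m : ℕ
    m = n ℕ.∸ k
    onShape : ∀ ls → ∑ₗ (map (ls ,_) (filterᵇ leOK (fillings ls))) (λ d → q ^ rank (proj₂ d)) ≈ weight (replicate m false) ls
    onShape ls = begin
      ∑ₗ (map (ls ,_) (filterᵇ leOK (fillings ls))) (λ d → q ^ rank (proj₂ d))
        ≈⟨ ∑ₗ-map (ls ,_) (filterᵇ leOK (fillings ls)) _ ⟩
      ∑ₗ (filterᵇ leOK (fillings ls)) (λ D → q ^ rank D)
        ≈⟨ ∑ₗ-filterᵇ leOK (fillings ls) _ ⟩
      ∑ₗ (fillings ls) (λ D → χ (leOK D) * q ^ rank D)
        ≈⟨ ∑ₗ-cong (fillings ls) (λ D → *-congʳ (reflexive (≡.cong χ (leOK-diagOK m D)))) ⟩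
      ∑ₗ (fillings ls) (λ D → χ (diagOK (replicate m false) D) * q ^ rank D)
        ≈⟨ ∑ₗ-fillings (replicate m false) ls ⟩
      weight (replicate m false) ls ∎

-- The recurrence for the sum over all shapes.

module Recurrence {c ℓ} (R : CommutativeRing c ℓ) (q p : CommutativeRing.Carrier R)
  (pq≈1 : CommutativeRing._≈_ R (CommutativeRing._*_ R p q) (CommutativeRing.1# R)) where
  open CommutativeRing R
  open IntegerSolver R
  open RangeSum R
  open QNumbers R q
  open InversePowers R q p pq≈1
  open Tableaux R q
  open import Algebra.Properties.CommutativeSemiring.Exp commutativeSemiring
  open import Relation.Binary.Reasoning.Setoid setoid

  B : ℕ → ℕ → List ℕ → Carrier
  B s m ls = colSum (q * [ s ]) m (λ S → weight S ls)

  B-col : ∀ s m ls → All (ℕ._≤ m) ls → B s (suc m) ls ≈ [ suc s ] * B s m ls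
  B-col s m ls ls≤m = colSum-snoc (q * [ s ]) m λ { S b ≡.refl → weight-snoc S b ls ls≤m }

  -- For w = q [s] the shifted weight q (1 + w) is definitionally q [s+1], and the factor q [s+1] -
  -- q [s] of `colSum-rowSum-false` is q^{s+1}, removed by multiplying with p^{s+1}.
  B-row : ∀ s l ls → B s l (l ∷ ls) ≈ p ^ s * [ suc s ] * B (suc s) l ls + - (p ^ s * [ s ]) * B s l ls
  B-row s l ls = begin
    b
      ≈⟨ trans (*-congʳ (p^*q^ (suc s))) (*-identityˡ b) ⟨
    p ^ suc s * q ^ suc s * b
      ≈⟨ *-assoc _ _ _ ⟩
    p ^ suc s * (q ^ suc s * b)
      ≈⟨ *-congˡ (*-congʳ diff) ⟨
    p ^ suc s * ((q * [ suc s ] - q * [ s ]) * b)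
      ≈⟨ *-congˡ (colSum-rowSum-false (q * [ s ]) l (λ S → weight S ls)) ⟩
    p * p ^ s * (q * [ suc s ] * B (suc s) l ls - q * [ s ] * B s l ls)
      ≈⟨ solve 7 (λ p u q x y a b → p :* u :* (q :* x :* a :- q :* y :* b) := p :* q :* (u :* x :* a :+ (:- (u :* y)) :* b)) refl _ _ _ _ _ _ _ ⟩
    p * q * (p ^ s * [ suc s ] * B (suc s) l ls + - (p ^ s * [ s ]) * B s l ls)
      ≈⟨ trans (*-congʳ pq≈1) (*-identityˡ _) ⟩
    p ^ s * [ suc s ] * B (suc s) l ls + - (p ^ s * [ s ]) * B s l ls ∎
    where
    b : Carrier
    b = B s l (l ∷ ls)
    diff : q * [ suc s ] - q * [ s ] ≈ q ^ suc s
    diff = trans (+-congʳ (*-congˡ ([suc] s))) (solve 3 (λ q x y → q :* (x :+ y) :- q :* x := q :* y) refl _ _ _)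

  shapes : ℕ → ℕ → ℕ → Carrier
  shapes s k m = psum k m (B s m)

  shapes-00 : ∀ s → shapes s 0 0 ≈ 1#
  shapes-00 s = *-identityʳ 1#

  shapes-0suc : ∀ s m → shapes s 0 (suc m) ≈ [ suc s ] * shapes s 0 m
  shapes-0suc s m = B-col s m [] []

  shapes-row : ∀ s k m → psum k m (λ ls → B s m (m ∷ ls)) ≈ p ^ s * [ suc s ] * shapes (suc s) k m + - (p ^ s * [ s ]) * shapes s k m
  shapes-row s k m = begin
    psum k m (λ ls → B s m (m ∷ ls))
      ≈⟨ psum-cong k m (λ ls _ → B-row s m ls) ⟩
    psum k m (λ ls → p ^ s * [ suc s ] * B (suc s) m ls + - (p ^ s * [ s ]) * B s m ls)
      ≈⟨ psum-+ k m _ _ ⟩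
    psum k m (λ ls → p ^ s * [ suc s ] * B (suc s) m ls) + psum k m (λ ls → - (p ^ s * [ s ]) * B s m ls)
      ≈⟨ +-cong (psum-*ˡ k m _ _) (psum-*ˡ k m _ _) ⟩
    p ^ s * [ suc s ] * shapes (suc s) k m + - (p ^ s * [ s ]) * shapes s k m ∎

  shapes-suc0 : ∀ s k → shapes s (suc k) 0 ≈ p ^ s * [ suc s ] * shapes (suc s) k 0 + - (p ^ s * [ s ]) * shapes s k 0
  shapes-suc0 s k = trans (+-identityˡ _) (shapes-row s k 0)

  -- By the largest part: either it is at most `m` and the last column is empty, or it is `suc m`
  -- and the top row is full. Both cases lower the semiperimeter by one.
  shapes-sucsuc : ∀ s k m → shapes s (suc k) (suc m)
    ≈ [ suc s ] * shapes s (suc k) m + (p ^ s * [ suc s ] * shapes (suc s) k (suc m) + - (p ^ s * [ s ]) * shapes s k (suc m))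
  shapes-sucsuc s k m = +-cong
    (trans (psum-cong (suc k) m (B-col s m)) (psum-*ˡ (suc k) m _ (B s m)))
    (shapes-row s k (suc m))

  -- g n s k is the coefficient of y^k in G_n(s).
  g : ℕ → ℕ → ℕ → Carrier
  g zero    s zero    = 1#
  g zero    s (suc k) = 0#
  g (suc n) s zero    = [ suc s ] * g n s 0
  g (suc n) s (suc k) = [ suc s ] * g n s (suc k) + (p ^ s * [ suc s ] * g n (suc s) k + - (p ^ s * [ s ]) * g n s k)

  g-< : ∀ {n k} s → n ℕ.< k → g n s k ≈ 0#
  g-< {zero}  {suc k} s _           = refl
  g-< {suc n} {suc k} s (ℕ.s≤s n<k) = begin
    [ suc s ] * g n s (suc k) + (p ^ s * [ suc s ] * g n (suc s) k + - (p ^ s * [ s ]) * g n s k)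
      ≈⟨ +-cong (*-congˡ (g-< s (ℕP.m≤n⇒m≤1+n n<k))) (+-cong (*-congˡ (g-< (suc s) n<k)) (*-congˡ (g-< s n<k))) ⟩
    [ suc s ] * 0# + (p ^ s * [ suc s ] * 0# + - (p ^ s * [ s ]) * 0#)
      ≈⟨ solve 3 (λ x y z → x :* con (+ 0) :+ (y :* con (+ 0) :+ z :* con (+ 0)) := con (+ 0)) refl _ _ _ ⟩
    0# ∎

  g≈shapes : ∀ k m s → g (k ℕ.+ m) s k ≈ shapes s k m
  g≈shapes zero    zero    s = sym (shapes-00 s)
  g≈shapes zero    (suc m) s = trans (*-congˡ (g≈shapes 0 m s)) (sym (shapes-0suc s m))
  g≈shapes (suc k) zero    s = begin
    [ suc s ] * g (k ℕ.+ 0) s (suc k) + (p ^ s * [ suc s ] * g (k ℕ.+ 0) (suc s) k + - (p ^ s * [ s ]) * g (k ℕ.+ 0) s k)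
      -- With no columns there is none to remove; the corresponding term of `g` asks for more rows
      -- than the semiperimeter and is zero.
      ≈⟨ +-cong (trans (*-congˡ (g-< s (ℕ.s≤s (ℕP.≤-reflexive (ℕP.+-identityʳ k))))) (zeroʳ _)) (+-cong (*-congˡ (g≈shapes k 0 (suc s))) (*-congˡ (g≈shapes k 0 s))) ⟩
    0# + (p ^ s * [ suc s ] * shapes (suc s) k 0 + - (p ^ s * [ s ]) * shapes s k 0)
      ≈⟨ trans (+-identityˡ _) (sym (shapes-suc0 s k)) ⟩
    shapes s (suc k) 0 ∎
  g≈shapes (suc k) (suc m) s = begin
    [ suc s ] * g (k ℕ.+ suc m) s (suc k) + (p ^ s * [ suc s ] * g (k ℕ.+ suc m) (suc s) k + - (p ^ s * [ s ]) * g (k ℕ.+ suc m) s k)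
      ≈⟨ +-cong (*-congˡ (trans (reflexive (≡.cong (λ n → g n s (suc k)) (ℕP.+-suc k m))) (g≈shapes (suc k) m s)))
                (+-cong (*-congˡ (g≈shapes k (suc m) (suc s))) (*-congˡ (g≈shapes k (suc m) s))) ⟩
    [ suc s ] * shapes s (suc k) m + (p ^ s * [ suc s ] * shapes (suc s) k (suc m) + - (p ^ s * [ s ]) * shapes s k (suc m))
      ≈⟨ shapes-sucsuc s k m ⟨
    shapes s (suc k) (suc m) ∎

  LeDiagrams-g : ∀ k m → ∑ₗ (LeDiagrams k (k ℕ.+ m)) (λ d → q ^ rank (proj₂ d)) ≈ g (k ℕ.+ m) 0 k
  LeDiagrams-g k m = begin
    ∑ₗ (LeDiagrams k (k ℕ.+ m)) (λ d → q ^ rank (proj₂ d))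
      ≈⟨ LeDiagrams-sum k (k ℕ.+ m) ⟩
    psum k (k ℕ.+ m ℕ.∸ k) (λ ls → weight (replicate (k ℕ.+ m ℕ.∸ k) false) ls)
      ≡⟨ ≡.cong (λ n → psum k n (λ ls → weight (replicate n false) ls)) (ℕP.m+n∸m≡n k m) ⟩
    psum k m (λ ls → weight (replicate m false) ls)
      ≈⟨ psum-cong k m (λ ls _ → trans (bsum-cong m λ S _ → *-congʳ (^-congˡ (countTrue S) (zeroʳ q))) (colSum-zero m _)) ⟨
    shapes 0 k m
      ≈⟨ g≈shapes k m 0 ⟨
    g (k ℕ.+ m) 0 k ∎

-- Powers of linear polynomials and the binomial theorem.

module LinearPowers {c ℓ} (R : CommutativeRing c ℓ) where
  open CommutativeRing R
  open IntegerSolver R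
  open Series R
  open import Algebra.Properties.CommutativeSemiring.Exp commutativeSemiring
  open import Algebra.Properties.Semiring.Mult semiring using (×-homo-+) renaming (_×_ to _·_)
  open import Relation.Binary.Reasoning.Setoid setoid
  private module S = CommutativeRing seriesRing
  open import Algebra.Properties.CommutativeSemiring.Exp S.commutativeSemiring using () renaming (_^_ to _^ˢ_)

  const-cong : ∀ {a b} → a ≈ b → const a ≋ const b
  const-cong eq zero    = eq
  const-cong eq (suc n) = refl

  const-0 : const 0# ≋ S.0#
  const-0 zero    = refl
  const-0 (suc n) = refl

  const-+ : ∀ a b → const (a + b) ≋ const a S.+ const b
  const-+ a b zero    = refl
  const-+ a b (suc n) = sym (+-identityʳ _)

  const-* : ∀ a b → const (a * b) ≋ const a ⊛ const b
  const-* a b zero    = refl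
  const-* a b (suc n) = sym (trans (const-⊛ a (const b) (suc n)) (zeroʳ a))

  const-neg : ∀ a → const (- a) ≋ S.- const a
  const-neg a zero    = refl
  const-neg a (suc n) = solve 0 (con (+ 0) := :- con (+ 0)) refl

  const-^ : ∀ a n → const (a ^ n) ≋ const a ^ˢ n
  const-^ a zero    = S.refl
  const-^ a (suc n) = S.trans (const-* a (a ^ n)) (S.*-congˡ {x = const a} (const-^ a n))

  lin : Carrier → Carrier → Ser
  lin a b = const a S.+ var ⊛ const b

  lin-⊛-zero : ∀ a b F → (lin a b ⊛ F) 0 ≈ a * F 0
  lin-⊛-zero a b F = solve 3 (λ a b f → (a :+ con (+ 0) :* b) :* f := a :* f) refl _ _ _

  lin-⊛-suc : ∀ a b F n → (lin a b ⊛ F) (suc n) ≈ a * F (suc n) + b * F n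
  lin-⊛-suc a b F n = begin
    (lin a b ⊛ F) (suc n)                                     ≈⟨ ⊛-distribʳ F (const a) (var ⊛ const b) (suc n) ⟩
    (const a ⊛ F) (suc n) + (var ⊛ const b ⊛ F) (suc n)       ≈⟨ +-cong (const-⊛ a F (suc n)) (⊛-assoc var (const b) F (suc n)) ⟩
    a * F (suc n) + (var ⊛ (const b ⊛ F)) (suc n)             ≈⟨ +-congˡ (trans (var-⊛-suc (const b ⊛ F) n) (const-⊛ b F n)) ⟩
    a * F (suc n) + b * F n                                   ∎

  bin : ℕ → ℕ → Carrier
  bin n r = (n C r) · 1#

  binomialTerm : Carrier → Carrier → ℕ → ℕ → Carrier
  binomialTerm a b n r = bin n r * (a ^ (n ℕ.∸ r) * b ^ r)

  binomialTerm-> : ∀ a b {n r} → n ℕ.< r → binomialTerm a b n r ≈ 0#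
  binomialTerm-> a b n<r = trans (*-congʳ (reflexive (≡.cong (_· 1#) (k>n⇒nCk≡0 n<r)))) (zeroˡ _)

  bin-pascal : ∀ n r → bin (suc n) (suc r) ≈ bin n r + bin n (suc r)
  bin-pascal n r = trans (reflexive (≡.cong (_· 1#) (≡.sym (nCk+nC[k+1]≡[n+1]C[k+1] n r)))) (×-homo-+ 1# (n C r) (n C suc r))

  binomialTerm-suc : ∀ a b n r → binomialTerm a b (suc n) (suc r) ≈ a * binomialTerm a b n (suc r) + b * binomialTerm a b n r
  binomialTerm-suc a b n r = begin
    bin (suc n) (suc r) * (a ^ (n ℕ.∸ r) * (b * b ^ r))
      ≈⟨ *-congʳ (bin-pascal n r) ⟩
    (bin n r + bin n (suc r)) * (a ^ (n ℕ.∸ r) * (b * b ^ r))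
      ≈⟨ solve 5 (λ x y u b v → (x :+ y) :* (u :* (b :* v)) := y :* (u :* (b :* v)) :+ b :* (x :* (u :* v))) refl _ _ _ _ _ ⟩
    bin n (suc r) * (a ^ (n ℕ.∸ r) * (b * b ^ r)) + b * binomialTerm a b n r
      ≈⟨ +-congʳ lower ⟩
    a * binomialTerm a b n (suc r) + b * binomialTerm a b n r ∎
    where
    lower : bin n (suc r) * (a ^ (n ℕ.∸ r) * (b * b ^ r)) ≈ a * binomialTerm a b n (suc r)
    -- Truncated subtraction gives `n ∸ r = suc (n ∸ suc r)` only for `r < n`; in the other case the
    -- binomial coefficient of n over r + 1 is zero on both sides.
    lower with ℕP.<-≤-connex r n
    ... | inj₁ r<n = begin
      bin n (suc r) * (a ^ (n ℕ.∸ r) * (b * b ^ r))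
        ≡⟨ ≡.cong (λ m → bin n (suc r) * (a ^ m * (b * b ^ r))) (ℕP.+-∸-assoc 1 r<n) ⟩
      bin n (suc r) * (a * a ^ (n ℕ.∸ suc r) * (b * b ^ r))
        ≈⟨ solve 4 (λ x a u v → x :* (a :* u :* v) := a :* (x :* (u :* v))) refl _ _ _ _ ⟩
      a * binomialTerm a b n (suc r) ∎
    ... | inj₂ n≤r = begin
      bin n (suc r) * (a ^ (n ℕ.∸ r) * (b * b ^ r))
        ≈⟨ *-congʳ (reflexive (≡.cong (_· 1#) (k>n⇒nCk≡0 (ℕ.s≤s n≤r)))) ⟩
      0# * (a ^ (n ℕ.∸ r) * (b * b ^ r))
        ≈⟨ solve 2 (λ x a → con (+ 0) :* x := a :* con (+ 0)) refl _ _ ⟩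
      a * 0#
        ≈⟨ *-congˡ (binomialTerm-> a b (ℕ.s≤s n≤r)) ⟨
      a * binomialTerm a b n (suc r) ∎

  binomialTerm-0 : ∀ a b n → binomialTerm a b n 0 ≈ a ^ n
  binomialTerm-0 a b n = trans (*-congʳ (trans (reflexive (≡.cong (_· 1#) nC0)) (+-identityʳ 1#)))
    (solve 1 (λ x → con (+ 1) :* (x :* con (+ 1)) := x) refl _)
    where
    nC0 : n C 0 ≡ 1
    nC0 = ≡.trans (nCk≡nC[n∸k] {0} {n} ℕ.z≤n) (nCn≡1 n)

  lin-^ : ∀ a b n r → (lin a b ^ˢ n) r ≈ binomialTerm a b n r
  lin-^ a b zero    zero    = sym (binomialTerm-0 a b 0)
  lin-^ a b zero    (suc r) = sym (binomialTerm-> a b {0} {suc r} (ℕ.s≤s ℕ.z≤n))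
  lin-^ a b (suc n) zero    = begin
    (lin a b ⊛ lin a b ^ˢ n) 0     ≈⟨ lin-⊛-zero a b (lin a b ^ˢ n) ⟩
    a * (lin a b ^ˢ n) 0           ≈⟨ *-congˡ (trans (lin-^ a b n 0) (binomialTerm-0 a b n)) ⟩
    a * a ^ n                      ≈⟨ binomialTerm-0 a b (suc n) ⟨
    binomialTerm a b (suc n) 0     ∎
  lin-^ a b (suc n) (suc r) = begin
    (lin a b ⊛ lin a b ^ˢ n) (suc r)                          ≈⟨ lin-⊛-suc a b (lin a b ^ˢ n) r ⟩
    a * (lin a b ^ˢ n) (suc r) + b * (lin a b ^ˢ n) r         ≈⟨ +-cong (*-congˡ (lin-^ a b n (suc r))) (*-congˡ (lin-^ a b n r)) ⟩
    a * binomialTerm a b n (suc r) + b * binomialTerm a b n r ≈⟨ binomialTerm-suc a b n r ⟨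
    binomialTerm a b (suc n) (suc r)                          ∎

-- Coefficients of the closed form in powers of y.

module Coefficients {c ℓ} (R : CommutativeRing c ℓ) (q p : CommutativeRing.Carrier R)
  (pq≈1 : CommutativeRing._≈_ R (CommutativeRing._*_ R p q) (CommutativeRing.1# R)) where
  open CommutativeRing R
  open IntegerSolver R
  open RangeSum R
  open QNumbers R q
  open Series R
  open LinearPowers R
  open Recurrence R q p pq≈1
  open import Algebra.Properties.CommutativeSemiring.Exp commutativeSemiring
  open import Relation.Binary.Reasoning.Setoid setoid
  private
    module S where
      open CommutativeRing seriesRing public
      open import Algebra.Properties.CommutativeSemiring.Exp (CommutativeRing.commutativeSemiring seriesRing) public
    module Q = QNumbers seriesRing (const q)
    module F = ClosedForm seriesRing (const q) (const p) var
      (S.trans (S.sym (const-* p q)) (const-cong pq≈1))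

  const-[] : ∀ n → const [ n ] ≋ Q.[ n ]
  const-[] zero    zero    = refl
  const-[] zero    (suc i) = refl
  const-[] (suc n) = S.trans (const-+ 1# (q * [ n ]))
    (S.+-congˡ {x = const 1#} (S.trans (const-* q [ n ]) (S.*-congˡ {x = const q} (const-[] n))))

  const-p^[] : ∀ s n → const (p ^ s * [ n ]) ≋ const p S.^ s ⊛ Q.[ n ]
  const-p^[] s n = S.trans (const-* (p ^ s) [ n ]) (S.*-cong (const-^ p s) (const-[] n))

  -- `F.d s` brought to the form a + b y with a and b in `R`, so that its powers expand by the
  -- binomial theorem.
  dlin : ℕ → Ser
  dlin s = lin [ suc s ] (- (p ^ s * [ s ]))

  dlin≋d : ∀ s → dlin s ≋ F.d s
  dlin≋d s = S.+-cong (const-[] (suc s)) (S.trans (S.*-congˡ {x = var} (const-neg (p ^ s * [ s ])))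
    (S.trans (S.sym (-‿distribʳ-* var (const (p ^ s * [ s ])))) (S.-‿cong (S.*-congˡ {x = var} (const-p^[] s s)))))
    where open import Algebra.Properties.Ring S.ring using (-‿distribʳ-*)

  g-zero : ∀ s → g 0 s ≋ const 1#
  g-zero s zero    = refl
  g-zero s (suc k) = refl

  g-suc : ∀ n s → g (suc n) s ≋ F.d s ⊛ g n s S.+ var ⊛ (const p S.^ s ⊛ Q.[ suc s ]) ⊛ g n (suc s)
  g-suc n s = S.trans coefficients (S.+-cong (S.*-congʳ (dlin≋d s)) (S.*-congʳ (S.*-congˡ {x = var} (const-p^[] s (suc s)))))
    where
    b : Carrier
    b = p ^ s * [ suc s ]
    coefficients : g (suc n) s ≋ dlin s ⊛ g n s S.+ var ⊛ const b ⊛ g n (suc s)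
    coefficients zero = sym (trans (+-cong (lin-⊛-zero _ _ (g n s)) (solve 2 (λ b x → con (+ 0) :* b :* x := con (+ 0)) refl _ _)) (+-identityʳ _))
    coefficients (suc k) = begin
      [ suc s ] * g n s (suc k) + (b * g n (suc s) k + - (p ^ s * [ s ]) * g n s k)
        ≈⟨ solve 3 (λ x y z → x :+ (y :+ z) := (x :+ z) :+ y) refl _ _ _ ⟩
      [ suc s ] * g n s (suc k) + - (p ^ s * [ s ]) * g n s k + b * g n (suc s) k
        ≈⟨ +-cong (lin-⊛-suc _ _ (g n s) k) (trans (⊛-assoc var (const b) (g n (suc s)) (suc k)) (trans (var-⊛-suc (const b ⊛ g n (suc s)) k) (const-⊛ b (g n (suc s)) k))) ⟨
      (dlin s ⊛ g n s) (suc k) + (var ⊛ const b ⊛ g n (suc s)) (suc k) ∎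

  open F.Solution g g-zero g-suc

  term : ℕ → ℕ → ℕ → Carrier
  term n e r = binomialTerm [ suc e ] (- (p ^ e * [ e ])) n r

  private
    alin : ℕ → Ser
    alin e = lin (p ^ (e ℕ.* e)) (- p ^ (suc e ℕ.* suc e))

    -- The second coefficient arises as p^{e²} p^{2e+1} = p^{(e+1)²}; separating y^e leaves a linear
    -- polynomial whose product with a power of `dlin e` has two terms per coefficient.
    a≋ : ∀ e → F.a 0 e ≋ var S.^ e ⊛ alin e
    a≋ e = S.trans
      (SS.solve 4 (λ Y h y P → SS.con (+ 1) SS.:* Y SS.:* h SS.:* (SS.con (+ 1) SS.:- y SS.:* P) SS.:* SS.con (+ 1) SS.:= Y SS.:* (h SS.:+ y SS.:* (SS.:- (h SS.:* P)))) S.refl _ _ _ _)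
      (S.*-congˡ {x = var S.^ e} (S.sym (S.+-cong (const-^ p (e ℕ.* e)) (S.*-congˡ {x = var} (S.trans (const-neg (p ^ (suc e ℕ.* suc e)))
        (S.-‿cong (S.trans (const-^ p (suc e ℕ.* suc e)) (F.h-sucʳ 0 e))))))))
      where module SS = IntegerSolver seriesRing

    a⊛ : ∀ n e t → (F.a 0 e ⊛ F.d e S.^ n) (e ℕ.+ t) ≈ (alin e ⊛ dlin e S.^ n) t
    a⊛ n e t = begin
      (F.a 0 e ⊛ F.d e S.^ n) (e ℕ.+ t)                ≈⟨ ⊛-cong (a≋ e) (S.^-congˡ n (S.sym (dlin≋d e))) (e ℕ.+ t) ⟩
      (var S.^ e ⊛ alin e ⊛ dlin e S.^ n) (e ℕ.+ t)    ≈⟨ ⊛-assoc (var S.^ e) (alin e) (dlin e S.^ n) (e ℕ.+ t) ⟩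
      (var S.^ e ⊛ (alin e ⊛ dlin e S.^ n)) (e ℕ.+ t)  ≈⟨ var^-⊛-+ e (alin e ⊛ dlin e S.^ n) t ⟩
      (alin e ⊛ dlin e S.^ n) t                        ∎

  g-formula : ∀ n k → g n 0 k ≈ ∑ (suc k) (λ e → p ^ (e ℕ.* e) * term n e (k ℕ.∸ e))
                              + ∑ k (λ e → - p ^ (suc e ℕ.* suc e) * term n e (k ℕ.∸ suc e))
  g-formula n k with solution n 0 (suc k)
  ... | r , g≋ = begin
    g n 0 k
      ≈⟨ g≋ k ⟩
    RangeSum.∑ seriesRing (suc k) (λ e → F.a 0 e ⊛ F.d e S.^ n) k + (var S.^ suc k ⊛ r) k
      -- Truncation after `suc k` terms is exact for this coefficient, as the remainder is divisible
      -- by y^{k+1}.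
      ≈⟨ trans (+-cong (∑-coeff (suc k) _ k) (var^-⊛-< (suc k) r ℕP.≤-refl)) (+-identityʳ _) ⟩
    ∑ (suc k) (λ e → (F.a 0 e ⊛ F.d e S.^ n) k)
      -- For `e = k` the factor y^k leaves only the constant coefficient of the linear polynomial;
      -- hence the negative terms number one fewer.
      ≈⟨ +-cong (trans (∑-cong< k below) (∑-+ k _ _)) top ⟩
    ∑ k P + ∑ k N + P k
      ≈⟨ solve 3 (λ x y z → x :+ y :+ z := x :+ z :+ y) refl _ _ _ ⟩
    ∑ (suc k) P + ∑ k N ∎
    where
    P N : ℕ → Carrier
    P e = p ^ (e ℕ.* e) * term n e (k ℕ.∸ e)
    N e = - p ^ (suc e ℕ.* suc e) * term n e (k ℕ.∸ suc e)
    below : ∀ e → e ℕ.< k → (F.a 0 e ⊛ F.d e S.^ n) k ≈ P e + N e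
    below e e<k = begin
      (F.a 0 e ⊛ F.d e S.^ n) k
        ≡⟨ ≡.cong (F.a 0 e ⊛ F.d e S.^ n) (≡.sym (ℕP.m+[n∸m]≡n (ℕP.<⇒≤ e<k))) ⟩
      (F.a 0 e ⊛ F.d e S.^ n) (e ℕ.+ (k ℕ.∸ e))
        ≈⟨ a⊛ n e (k ℕ.∸ e) ⟩
      (alin e ⊛ dlin e S.^ n) (k ℕ.∸ e)
        ≡⟨ ≡.cong (alin e ⊛ dlin e S.^ n) k∸e ⟩
      (alin e ⊛ dlin e S.^ n) (suc (k ℕ.∸ suc e))
        ≈⟨ lin-⊛-suc _ _ (dlin e S.^ n) (k ℕ.∸ suc e) ⟩
      p ^ (e ℕ.* e) * (dlin e S.^ n) (suc (k ℕ.∸ suc e)) + - p ^ (suc e ℕ.* suc e) * (dlin e S.^ n) (k ℕ.∸ suc e)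
        ≈⟨ +-cong (*-congˡ (trans (lin-^ _ _ n _) (reflexive (≡.cong (term n e) (≡.sym k∸e))))) (*-congˡ (lin-^ _ _ n _)) ⟩
      P e + N e ∎
      where
      k∸e : k ℕ.∸ e ≡ suc (k ℕ.∸ suc e)
      k∸e = ℕP.+-∸-assoc 1 e<k
    top : (F.a 0 k ⊛ F.d k S.^ n) k ≈ P k
    top = begin
      (F.a 0 k ⊛ F.d k S.^ n) k             ≡⟨ ≡.cong (F.a 0 k ⊛ F.d k S.^ n) (≡.sym (ℕP.+-identityʳ k)) ⟩
      (F.a 0 k ⊛ F.d k S.^ n) (k ℕ.+ 0)     ≈⟨ a⊛ n k 0 ⟩
      (alin k ⊛ dlin k S.^ n) 0             ≈⟨ lin-⊛-zero _ _ (dlin k S.^ n) ⟩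
      p ^ (k ℕ.* k) * (dlin k S.^ n) 0      ≈⟨ *-congˡ (lin-^ _ _ n 0) ⟩
      p ^ (k ℕ.* k) * term n k 0            ≡⟨ ≡.cong (λ i → p ^ (k ℕ.* k) * term n k i) (≡.sym (ℕP.n∸n≡0 k)) ⟩
      P k                                   ∎

-- Finite geometric sums and uniqueness of inverses.

module Geometric {c ℓ} (K : CommutativeRing c ℓ) where
  open CommutativeRing K
  open IntegerSolver K
  open RangeSum K
  open import Algebra.Properties.CommutativeSemiring.Exp commutativeSemiring
  open import Relation.Binary.Reasoning.Setoid setoid

  geometric : ∀ E n → ∑ n (E ^_) * (1# - E) ≈ 1# - E ^ n
  geometric E zero    = solve 1 (λ e → con (+ 0) :* (con (+ 1) :- e) := con (+ 1) :- con (+ 1)) refl _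
  geometric E (suc n) = begin
    (∑ n (E ^_) + E ^ n) * (1# - E)              ≈⟨ distribʳ _ _ _ ⟩
    ∑ n (E ^_) * (1# - E) + E ^ n * (1# - E)     ≈⟨ +-congʳ (geometric E n) ⟩
    1# - E ^ n + E ^ n * (1# - E)                ≈⟨ solve 2 (λ x e → con (+ 1) :- x :+ x :* (con (+ 1) :- e) := con (+ 1) :- e :* x) refl _ _ ⟩
    1# - E * E ^ n                               ∎

  inverse-unique : ∀ {J D F} → J * D ≈ 1# → D * F ≈ 1# → J ≈ F
  inverse-unique {J} {D} {F} JD DF = begin
    J            ≈⟨ *-identityʳ J ⟨
    J * 1#       ≈⟨ *-congˡ DF ⟨
    J * (D * F)  ≈⟨ *-assoc J D F ⟨
    J * D * F    ≈⟨ *-congʳ JD ⟩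
    1# * F       ≈⟨ *-identityˡ F ⟩
    F            ∎

-- Power series in x over power series in y, and their reciprocals.

module Bivariate {c ℓ} (R : CommutativeRing c ℓ) where
  open CommutativeRing R
  open IntegerSolver R
  open RangeSum R
  open import Relation.Binary.Reasoning.Setoid setoid
  open Series R using (const; var; seriesRing; const-⊛; ⊛-∑; ∑-coeff) renaming (_⊛_ to _⊛ʸ_)
  open LinearPowers R

  Rʸ : CommutativeRing c ℓ
  Rʸ = seriesRing
  private
    module Y where
      open CommutativeRing Rʸ public
      open import Algebra.Properties.CommutativeSemiring.Exp (CommutativeRing.commutativeSemiring Rʸ) public using (_^_)
    module X = Series Rʸ

  Rˣʸ : CommutativeRing c ℓ
  Rˣʸ = X.seriesRing

  module S where
    open CommutativeRing Rˣʸ public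
    open import Algebra.Properties.CommutativeSemiring.Exp (CommutativeRing.commutativeSemiring Rˣʸ) public
  private
    module ∑S = RangeSum Rˣʸ
    module SS = IntegerSolver Rˣʸ

  Ser² : Set c
  Ser² = ℕ → ℕ → Carrier

  x y : Ser²
  x = X.var
  y = X.const var

  κ : Carrier → Ser²
  κ c = X.const (const c)

  scale : Carrier → Ser² → Ser²
  scale c F n k = c * F n k

  κ-* : ∀ c F → κ c S.* F S.≈ scale c F
  κ-* c F n k = trans (X.const-⊛ (const c) F n k) (const-⊛ c (F n) k)

  κ-cong : ∀ {a b} → a ≈ b → κ a S.≈ κ b
  κ-cong eq = LinearPowers.const-cong Rʸ (const-cong eq)

  κ-homo-* : ∀ a b → κ (a * b) S.≈ κ a S.* κ b
  κ-homo-* a b = S.trans (LinearPowers.const-cong Rʸ (const-* a b)) (LinearPowers.const-* Rʸ (const a) (const b))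

  κ-inverse : ∀ {a b} → a * b ≈ 1# → κ a S.* κ b S.≈ S.1#
  κ-inverse {a} {b} ab = S.trans (S.sym (κ-homo-* a b)) (κ-cong ab)

  *-∑∑ : ∀ F G n k → (F S.* G) n k ≈ ∑ (suc n) (λ a → ∑ (suc k) (λ b → F a b * G (n ℕ.∸ a) (k ℕ.∸ b)))
  *-∑∑ F G n k = begin
    (F S.* G) n k
      ≈⟨ X.⊛-∑ F G n k ⟩
    RangeSum.∑ Rʸ (suc n) (λ a → F a ⊛ʸ G (n ℕ.∸ a)) k
      ≈⟨ ∑-coeff (suc n) (λ a → F a ⊛ʸ G (n ℕ.∸ a)) k ⟩
    ∑ (suc n) (λ a → (F a ⊛ʸ G (n ℕ.∸ a)) k)
      ≈⟨ ∑-cong (suc n) (λ a → ⊛-∑ (F a) (G (n ℕ.∸ a)) k) ⟩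
    ∑ (suc n) (λ a → ∑ (suc k) (λ b → F a b * G (n ℕ.∸ a) (k ℕ.∸ b))) ∎

  -- A coefficient of a product involves only coefficients of bounded degree. The hypothesis
  -- compares products, so that a term may agree because either factor vanishes.
  *-cong≤ : ∀ {F F′ G G′} n k → (∀ a b → a ℕ.≤ n → b ℕ.≤ k → F a b * G (n ℕ.∸ a) (k ℕ.∸ b) ≈ F′ a b * G′ (n ℕ.∸ a) (k ℕ.∸ b)) →
    (F S.* G) n k ≈ (F′ S.* G′) n k
  *-cong≤ {F} {F′} {G} {G′} n k eq = begin
    (F S.* G) n k
      ≈⟨ *-∑∑ F G n k ⟩
    ∑ (suc n) (λ a → ∑ (suc k) (λ b → F a b * G (n ℕ.∸ a) (k ℕ.∸ b)))
      ≈⟨ ∑-cong< (suc n) (λ { a (ℕ.s≤s a≤n) → ∑-cong< (suc k) λ { b (ℕ.s≤s b≤k) → eq a b a≤n b≤k } }) ⟩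
    ∑ (suc n) (λ a → ∑ (suc k) (λ b → F′ a b * G′ (n ℕ.∸ a) (k ℕ.∸ b)))
      ≈⟨ *-∑∑ F′ G′ n k ⟨
    (F′ S.* G′) n k ∎

  ∑-extend : ∀ t m f → (∀ i → m ℕ.≤ i → f i ≈ 0#) → ∑ (t ℕ.+ m) f ≈ ∑ m f
  ∑-extend zero    m f f≈0 = refl
  ∑-extend (suc t) m f f≈0 = trans (+-congˡ (f≈0 (t ℕ.+ m) (ℕP.m≤n+m m t))) (trans (+-identityʳ _) (∑-extend t m f f≈0))

  -- Without a constant term, each factor raises the total degree by at least one.
  ^-vanish : ∀ {E} → E 0 0 ≈ 0# → ∀ m n k → n ℕ.+ k ℕ.< m → (E S.^ m) n k ≈ 0#
  ^-vanish {E} E≈0 (suc m) n k (ℕ.s≤s n+k≤m) = begin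
    (E S.* E S.^ m) n k   ≈⟨ *-cong≤ {E} {λ _ _ → 0#} {E S.^ m} {E S.^ m} n k zeros ⟩
    (S.0# S.* E S.^ m) n k ≈⟨ S.zeroˡ (E S.^ m) n k ⟩
    0#                    ∎
    where
    zeros : ∀ a b → a ℕ.≤ n → b ℕ.≤ k → E a b * (E S.^ m) (n ℕ.∸ a) (k ℕ.∸ b) ≈ 0# * (E S.^ m) (n ℕ.∸ a) (k ℕ.∸ b)
    zeros zero    zero    _   _   = *-congʳ E≈0
    zeros zero    (suc b) _   b≤k = trans (*-congˡ (^-vanish E≈0 m n (k ℕ.∸ suc b)
      (ℕP.<-≤-trans (ℕP.+-monoʳ-< n (ℕP.∸-monoʳ-< {k} {suc b} {0} (ℕ.s≤s ℕ.z≤n) b≤k)) n+k≤m)))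
      (trans (zeroʳ _) (sym (zeroˡ _)))
    zeros (suc a) b       a≤n _   = trans (*-congˡ (^-vanish E≈0 m (n ℕ.∸ suc a) (k ℕ.∸ b)
      (ℕP.<-≤-trans (ℕP.+-mono-<-≤ (ℕP.∸-monoʳ-< {n} {suc a} {0} (ℕ.s≤s ℕ.z≤n) a≤n) (ℕP.m∸n≤m k b)) n+k≤m)))
      (trans (zeroʳ _) (sym (zeroˡ _)))

  -- The counterpart of `inv`. The number of terms varies with the coefficient, so this is not one
  -- partial sum of the geometric series.
  geo : Carrier → Ser² → Ser²
  geo u D n k = u * ∑ (suc (n ℕ.+ k)) (λ m → ((S.1# S.- scale u D) S.^ m) n k)

  -- For a given coefficient (n, k) all truncations that enter may be lengthened to n + k + 1 terms,
  -- since higher powers of E = 1 - u D do not contribute. The finite geometric sum then leaves the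
  -- error E^{n+k+1}, which is invisible in that degree.
  geo-inverse : ∀ u D → u * D 0 0 ≈ 1# → geo u D S.* D S.≈ S.1#
  geo-inverse u D uD≈1 n k = begin
    (geo u D S.* D) n k
      ≈⟨ *-cong≤ {geo u D} {scale u (∑S.∑ N (E S.^_))} {D} {D} n k (λ a b a≤n b≤k → *-congʳ (*-congˡ (truncate a b a≤n b≤k))) ⟩
    (scale u (∑S.∑ N (E S.^_)) S.* D) n k
      ≈⟨ S.*-congʳ {x = D} (S.sym (κ-* u (∑S.∑ N (E S.^_)))) n k ⟩
    (κ u S.* ∑S.∑ N (E S.^_) S.* D) n k
      ≈⟨ SS.solve 3 (λ u s d → u SS.:* s SS.:* d SS.:= s SS.:* (SS.con (+ 1) SS.:- (SS.con (+ 1) SS.:- u SS.:* d))) S.refl (κ u) (∑S.∑ N (E S.^_)) D n k ⟩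
    (∑S.∑ N (E S.^_) S.* (S.1# S.- (S.1# S.- κ u S.* D))) n k
      ≈⟨ S.*-congˡ {x = ∑S.∑ N (E S.^_)} (S.+-congˡ {x = S.1#} (S.-‿cong (S.+-congˡ {x = S.1#} (S.-‿cong (κ-* u D))))) n k ⟩
    (∑S.∑ N (E S.^_) S.* (S.1# S.- E)) n k
      ≈⟨ Geometric.geometric Rˣʸ E N n k ⟩
    S.1# n k - (E S.^ N) n k
      ≈⟨ +-congˡ (-‿cong (^-vanish E≈0 N n k ℕP.≤-refl)) ⟩
    S.1# n k - 0#
      ≈⟨ solve 1 (λ a → a :- con (+ 0) := a) refl _ ⟩
    S.1# n k ∎
    where
    N : ℕ
    N = suc (n ℕ.+ k)
    E : Ser²
    E = S.1# S.- scale u D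
    E≈0 : E 0 0 ≈ 0#
    E≈0 = trans (+-congˡ (-‿cong uD≈1)) (-‿inverseʳ 1#)
    truncate : ∀ a b → a ℕ.≤ n → b ℕ.≤ k → ∑ (suc (a ℕ.+ b)) (λ m → (E S.^ m) a b) ≈ ∑S.∑ N (E S.^_) a b
    truncate a b a≤n b≤k = begin
      ∑ (suc (a ℕ.+ b)) (λ m → (E S.^ m) a b)
        ≈⟨ ∑-extend (N ℕ.∸ suc (a ℕ.+ b)) (suc (a ℕ.+ b)) _ (λ m → ^-vanish E≈0 m a b) ⟨
      ∑ (N ℕ.∸ suc (a ℕ.+ b) ℕ.+ suc (a ℕ.+ b)) (λ m → (E S.^ m) a b)
        ≡⟨ ≡.cong (λ j → ∑ j (λ m → (E S.^ m) a b)) (ℕP.m∸n+n≡m (ℕ.s≤s (ℕP.+-mono-≤ a≤n b≤k))) ⟩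
      ∑ N (λ m → (E S.^ m) a b)
        ≈⟨ trans (X.∑-coeff N (E S.^_) a b) (∑-coeff N (λ m → (E S.^ m) a) b) ⟨
      ∑S.∑ N (E S.^_) a b ∎

  geo-≈ : ∀ u D F → u * D 0 0 ≈ 1# → D S.* F S.≈ S.1# → geo u D S.≈ F
  geo-≈ u D F uD DF = Geometric.inverse-unique Rˣʸ (geo-inverse u D uD) DF

  -- The series 1 / (1 - e x), for e a series in y.
  powers : (ℕ → Carrier) → Ser²
  powers e n = e Y.^ n

  1-ex*powers : ∀ e → (S.1# S.- x S.* X.const e) S.* powers e S.≈ S.1#
  1-ex*powers e zero = Y.trans (Y.*-congʳ (Y.+-congˡ {x = Y.1#} (Y.-‿cong (Y.zeroˡ e)))) (YS.solve 0 ((YS.con (+ 1) YS.:- YS.con (+ 0)) YS.:* YS.con (+ 1) YS.:= YS.con (+ 1)) Y.refl)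
    where module YS = IntegerSolver Rʸ
  1-ex*powers e (suc n) = Y.trans (S.distribʳ (powers e) S.1# (S.- (x S.* X.const e)) (suc n))
    (Y.trans (Y.+-cong (S.*-identityˡ (powers e) (suc n))
      (Y.trans (SS.solve 3 (λ a b c → (SS.:- (a SS.:* b)) SS.:* c SS.:= SS.:- (a SS.:* (b SS.:* c))) S.refl x (X.const e) (powers e) (suc n))
        (Y.-‿cong (Y.trans (X.var-⊛-suc (X.const e S.* powers e) n) (X.const-⊛ e (powers e) n)))))
      (Y.-‿inverseʳ (powers e (suc n))))

  -- The expansion of x^r / (1 - a x)^{r+1}.
  negBinomial : Carrier → ℕ → Ser²
  negBinomial a r n = const (binomialTerm a 1# n r)

  [1-ax]*-suc : ∀ a F n k → ((S.1# S.- scale a x) S.* F) (suc n) k ≈ F (suc n) k - a * F n k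
  [1-ax]*-suc a F n k = begin
    ((S.1# S.- scale a x) S.* F) (suc n) k
      ≈⟨ S.*-congʳ {x = F} (S.+-congˡ {x = S.1#} (S.-‿cong (κ-* a x))) (suc n) k ⟨
    ((S.1# S.- κ a S.* x) S.* F) (suc n) k
      ≈⟨ SS.solve 3 (λ a x f → (SS.con (+ 1) SS.:- a SS.:* x) SS.:* f SS.:= f SS.:- x SS.:* (a SS.:* f)) S.refl (κ a) x F (suc n) k ⟩
    F (suc n) k - (x S.* (κ a S.* F)) (suc n) k
      ≈⟨ +-congˡ (-‿cong (trans (X.var-⊛-suc (κ a S.* F) n k) (κ-* a F n k))) ⟩
    F (suc n) k - a * F n k ∎

  [1-ax]*-zero : ∀ a F k → ((S.1# S.- scale a x) S.* F) 0 k ≈ F 0 k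
  [1-ax]*-zero a F k = begin
    ((S.1# S.- scale a x) S.* F) 0 k
      ≈⟨ S.*-congʳ {x = F} (S.+-congˡ {x = S.1#} (S.-‿cong (κ-* a x))) 0 k ⟨
    ((S.1# S.- κ a S.* x) S.* F) 0 k
      ≈⟨ SS.solve 3 (λ a x f → (SS.con (+ 1) SS.:- a SS.:* x) SS.:* f SS.:= f SS.:- x SS.:* (a SS.:* f)) S.refl (κ a) x F 0 k ⟩
    F 0 k - (x S.* (κ a S.* F)) 0 k
      ≈⟨ +-congˡ (-‿cong (Y.zeroˡ ((κ a S.* F) 0) k)) ⟩
    F 0 k - 0#
      ≈⟨ solve 1 (λ a → a :- con (+ 0) := a) refl _ ⟩
    F 0 k ∎

  [1-ax]*negBinomial-0 : ∀ a → (S.1# S.- scale a x) S.* negBinomial a 0 S.≈ S.1#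
  [1-ax]*negBinomial-0 a zero    k       = trans ([1-ax]*-zero a (negBinomial a 0) k) (const-cong (binomialTerm-0 a 1# 0) k)
  [1-ax]*negBinomial-0 a (suc n) zero    = trans ([1-ax]*-suc a (negBinomial a 0) n 0)
    (trans (+-cong (binomialTerm-0 a 1# (suc n)) (-‿cong (*-congˡ (binomialTerm-0 a 1# n)))) (-‿inverseʳ _))
  [1-ax]*negBinomial-0 a (suc n) (suc k) = trans ([1-ax]*-suc a (negBinomial a 0) n (suc k))
    (solve 1 (λ a → con (+ 0) :- a :* con (+ 0) := con (+ 0)) refl _)

  [1-ax]*negBinomial-suc : ∀ a r → (S.1# S.- scale a x) S.* negBinomial a (suc r) S.≈ x S.* negBinomial a r
  [1-ax]*negBinomial-suc a r zero k = begin
    ((S.1# S.- scale a x) S.* negBinomial a (suc r)) 0 k   ≈⟨ [1-ax]*-zero a (negBinomial a (suc r)) k ⟩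
    const (binomialTerm a 1# 0 (suc r)) k                  ≈⟨ const-cong (binomialTerm-> a 1# {0} {suc r} (ℕ.s≤s ℕ.z≤n)) k ⟩
    const 0# k                                             ≈⟨ const-0 k ⟩
    0#                                                     ≈⟨ Y.zeroˡ (negBinomial a r 0) k ⟨
    (x S.* negBinomial a r) 0 k                            ∎
  [1-ax]*negBinomial-suc a r (suc n) k = begin
    ((S.1# S.- scale a x) S.* negBinomial a (suc r)) (suc n) k
      ≈⟨ [1-ax]*-suc a (negBinomial a (suc r)) n k ⟩
    const (binomialTerm a 1# (suc n) (suc r)) k - a * const (binomialTerm a 1# n (suc r)) k
      ≈⟨ coefficient k ⟩
    const (binomialTerm a 1# n r) k
      ≈⟨ X.var-⊛-suc (negBinomial a r) n k ⟨
    (x S.* negBinomial a r) (suc n) k ∎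
    where
    coefficient : ∀ k → const (binomialTerm a 1# (suc n) (suc r)) k - a * const (binomialTerm a 1# n (suc r)) k ≈ const (binomialTerm a 1# n r) k
    coefficient zero    = trans (+-congʳ (binomialTerm-suc a 1# n r)) (solve 2 (λ u v → u :+ con (+ 1) :* v :- u := v) refl _ _)
    coefficient (suc k) = solve 1 (λ a → con (+ 0) :- a :* con (+ 0) := con (+ 0)) refl _

  [1-ax]^*negBinomial : ∀ a r → (S.1# S.- scale a x) S.^ suc r S.* negBinomial a r S.≈ x S.^ r
  [1-ax]^*negBinomial a zero    = S.trans (S.*-congʳ {x = negBinomial a 0} (S.*-identityʳ (S.1# S.- scale a x))) ([1-ax]*negBinomial-0 a)
  [1-ax]^*negBinomial a (suc r) = S.trans
    (SS.solve 3 (λ z w h → z SS.:* w SS.:* h SS.:= w SS.:* (z SS.:* h)) S.refl z (z S.^ suc r) (negBinomial a (suc r)))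
    (S.trans (S.*-congˡ {x = z S.^ suc r} ([1-ax]*negBinomial-suc a r))
    (S.trans (SS.solve 3 (λ w x h → w SS.:* (x SS.:* h) SS.:= x SS.:* (w SS.:* h)) S.refl (z S.^ suc r) x (negBinomial a r))
      (S.*-congˡ {x = x} ([1-ax]^*negBinomial a r))))
    where
    z : Ser²
    z = S.1# S.- scale a x

  -- Rewriting x^r as (1 - a x)^{r+1} times `negBinomial a r` lets the reciprocal cancel the whole
  -- power at once.
  negBinomial-quotient : ∀ σ b u c a r → u * c ≈ 1# →
    scale σ (x S.^ r S.* κ b) S.* geo u (κ c S.* (S.1# S.- scale a x) S.^ suc r) S.≈ scale (σ * b * u) (negBinomial a r)
  negBinomial-quotient σ b u c a r uc≈1 = S.trans (S.*-congʳ {x = J} (S.sym (κ-* σ (x S.^ r S.* κ b))))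
    (S.trans (S.*-congʳ {x = J} (S.*-congˡ {x = κ σ} (S.*-congʳ {x = κ b} (S.sym ([1-ax]^*negBinomial a r)))))
    (S.trans (SS.solve 5 (λ σ z h b j → σ SS.:* (z SS.:* h SS.:* b) SS.:* j SS.:= σ SS.:* b SS.:* (j SS.:* z) SS.:* h) S.refl (κ σ) Z H (κ b) J)
    (S.trans (S.*-congʳ {x = H} (S.*-congˡ {x = κ σ S.* κ b} JZ))
    (S.trans (S.*-congʳ {x = H} (S.sym (S.trans (κ-homo-* (σ * b) u) (S.*-congʳ {x = κ u} (κ-homo-* σ b)))))
      (κ-* (σ * b * u) H)))))
    where
    Z H J : Ser²
    Z = (S.1# S.- scale a x) S.^ suc r
    H = negBinomial a r
    J = geo u (κ c S.* Z)
    constantTerm : ∀ m → ((S.1# S.- scale a x) S.^ m) 0 0 ≈ 1#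
    constantTerm zero    = refl
    constantTerm (suc m) = trans ([1-ax]*-zero a ((S.1# S.- scale a x) S.^ m) 0) (constantTerm m)
    JZ : J S.* Z S.≈ κ u
    JZ = S.trans (SS.solve 2 (λ j z → j SS.:* z SS.:= SS.con (+ 1) SS.:* (j SS.:* z)) S.refl J Z)
      (S.trans (S.*-congʳ {x = J S.* Z} (S.sym (κ-inverse uc≈1)))
      (S.trans (SS.solve 4 (λ u c j z → u SS.:* c SS.:* (j SS.:* z) SS.:= u SS.:* (j SS.:* (c SS.:* z))) S.refl (κ u) (κ c) J Z)
      (S.trans (S.*-congˡ {x = κ u} (geo-inverse u (κ c S.* Z) (trans (*-congˡ (trans (κ-* c Z 0 0) (trans (*-congˡ (constantTerm (suc r))) (*-identityʳ c)))) uc≈1)))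
        (S.*-identityʳ (κ u)))))

-- The three formulas over a ring with an invertible q.

module Formulas {c ℓ} (R : CommutativeRing c ℓ) (q p : CommutativeRing.Carrier R)
  (pq≈1 : CommutativeRing._≈_ R (CommutativeRing._*_ R p q) (CommutativeRing.1# R)) where
  open CommutativeRing R
  open IntegerSolver R
  open RangeSum R
  open QNumbers R q
  open InversePowers R q p pq≈1
  open Series R using (const; var) renaming (_⊛_ to _⊛ʸ_)
  open LinearPowers R
  open Bivariate R
  open Recurrence R q p pq≈1 using (g)
  open Coefficients R q p pq≈1
  open import Algebra.Properties.CommutativeSemiring.Exp commutativeSemiring
  open import Relation.Binary.Reasoning.Setoid setoid
  open +-*-Solver using () renaming (solve to solveℕ; _:=_ to _:=ℕ_; _:+_ to _:+ℕ_; _:*_ to _:*ℕ_; con to conℕ)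
  private
    module Y where
      open CommutativeRing Rʸ public
      open import Algebra.Properties.CommutativeSemiring.Exp (CommutativeRing.commutativeSemiring Rʸ) public using (_^_)
    module X = Series Rʸ
    module SS = IntegerSolver Rˣʸ
    module LY = LinearPowers Rʸ

  private
    X-lin : ∀ a b → X.const (lin a b) S.≈ κ a S.+ y S.* κ b
    X-lin a b = S.trans (LY.const-+ (const a) (var ⊛ʸ const b)) (S.+-congˡ {x = κ a} (LY.const-* var (const b)))

    κ-neg : ∀ a → κ (- a) S.≈ S.- κ a
    κ-neg a = S.trans (LY.const-cong (const-neg a)) (LY.const-neg (const a))

    X-lin-* : ∀ a b e n k → (X.const (lin a b) S.* powers e) n (suc k) ≈ a * (e Y.^ n) (suc k) + b * (e Y.^ n) k
    X-lin-* a b e n k = trans (X.const-⊛ (lin a b) (powers e) n (suc k)) (lin-⊛-suc a b (e Y.^ n) k)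

    X-lin-*0 : ∀ a b e n → (X.const (lin a b) S.* powers e) n 0 ≈ a * (e Y.^ n) 0
    X-lin-*0 a b e n = trans (X.const-⊛ (lin a b) (powers e) n 0) (lin-⊛-zero a b (e Y.^ n))

  term-0 : ∀ n r → term n 0 (suc r) ≈ 0#
  term-0 n r = trans (*-congˡ (*-congˡ (*-congʳ (solve 1 (λ u → :- (u :* con (+ 0)) := con (+ 0)) refl _))))
    (solve 3 (λ b a z → b :* (a :* (con (+ 0) :* z)) := con (+ 0)) refl _ _ _)

  -- The i-th summand of the generating function of Theorem 4.1 without its factor y^i.
  summand : ℕ → Ser²
  summand i = (κ (q ^ (2 ℕ.* i ℕ.+ 1)) S.- y) S.* geo (p ^ (i ℕ.* i ℕ.+ i ℕ.+ 1 ℕ.+ i))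
    (κ (q ^ (i ℕ.* i ℕ.+ i ℕ.+ 1)) S.* (κ (q ^ i) S.- scale (q ^ i * [ suc i ]) x S.+ scale [ i ] (x S.* y)))

  -- Because [i] = q^i p^i [i], the denominator is q^{(i+1)²} (1 - x d_i). Dividing the numerator by
  -- that power of q turns q^{2i+1} - y into p^{i²} - y p^{(i+1)²}.
  summand-≈ : ∀ i → summand i S.≈ X.const (lin (p ^ (i ℕ.* i)) (- p ^ (suc i ℕ.* suc i))) S.* powers (dlin i)
  summand-≈ i = S.trans (S.*-congˡ {x = κ (q ^ (2 ℕ.* i ℕ.+ 1)) S.- y} (geo-≈ u D (κ u S.* F) uD D*F))
    (S.trans (SS.solve 4 (λ a y u f → (a SS.:- y) SS.:* (u SS.:* f) SS.:= (a SS.:* u SS.:+ y SS.:* (SS.:- u)) SS.:* f) S.refl (κ (q ^ (2 ℕ.* i ℕ.+ 1))) y (κ u) F)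
    (S.*-congʳ {x = F} (S.trans (S.+-cong first (S.*-congˡ {x = y} (S.trans (S.sym (κ-neg u)) (κ-cong (-‿cong (^-congʳ p (expo₁ i)))))))
      (S.sym (X-lin (p ^ (i ℕ.* i)) (- p ^ (suc i ℕ.* suc i)))))))
    where
    N : ℕ
    N = i ℕ.* i ℕ.+ i ℕ.+ 1
    u r e : Carrier
    u = p ^ (N ℕ.+ i)
    r = q ^ i
    e = p ^ i * [ i ]
    F D : Ser²
    F = powers (dlin i)
    D = κ (q ^ N) S.* (κ r S.- scale (r * [ suc i ]) x S.+ scale [ i ] (x S.* y))
    expo₁ : ∀ i → i ℕ.* i ℕ.+ i ℕ.+ 1 ℕ.+ i ≡ suc i ℕ.* suc i
    expo₁ = solveℕ 1 (λ i → i :*ℕ i :+ℕ i :+ℕ conℕ 1 :+ℕ i :=ℕ (conℕ 1 :+ℕ i) :*ℕ (conℕ 1 :+ℕ i)) ≡.refl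
    expo₂ : ∀ i → i ℕ.* i ℕ.+ i ℕ.+ 1 ℕ.+ i ≡ i ℕ.* i ℕ.+ (2 ℕ.* i ℕ.+ 1)
    expo₂ = solveℕ 1 (λ i → i :*ℕ i :+ℕ i :+ℕ conℕ 1 :+ℕ i :=ℕ i :*ℕ i :+ℕ (conℕ 2 :*ℕ i :+ℕ conℕ 1)) ≡.refl
    first : κ (q ^ (2 ℕ.* i ℕ.+ 1)) S.* κ u S.≈ κ (p ^ (i ℕ.* i))
    first = S.trans (S.sym (κ-homo-* (q ^ (2 ℕ.* i ℕ.+ 1)) u))
      (κ-cong (trans (*-comm _ _) (trans (*-congʳ (^-congʳ p (expo₂ i))) (p^+*q^ (i ℕ.* i) (2 ℕ.* i ℕ.+ 1)))))
    ucr : u * (q ^ N * r) ≈ 1#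
    ucr = trans (*-congˡ (sym (^-homo-* q N i))) (p^*q^ (N ℕ.+ i))
    D-linear : D S.≈ κ (q ^ N * r) S.* (S.1# S.- x S.* X.const (dlin i))
    D-linear = S.trans (S.*-congˡ {x = κ (q ^ N)} (S.trans
        (S.+-cong (S.+-congˡ {x = κ r} (S.-‿cong (S.trans (S.sym (κ-* (r * [ suc i ]) x)) (S.*-congʳ {x = x} (κ-homo-* r [ suc i ])))))
          (S.trans (S.sym (κ-* [ i ] (x S.* y))) (S.*-congʳ {x = x S.* y} (S.trans (κ-cong re) (κ-homo-* r e)))))
        (SS.solve 5 (λ r a x y e → r SS.:- r SS.:* a SS.:* x SS.:+ r SS.:* e SS.:* (x SS.:* y) SS.:= r SS.:* (SS.con (+ 1) SS.:- x SS.:* (a SS.:+ y SS.:* (SS.:- e)))) S.refl (κ r) (κ [ suc i ]) x y (κ e))))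
      (S.trans (S.sym (S.*-assoc (κ (q ^ N)) (κ r) _))
        (S.*-cong (S.sym (κ-homo-* (q ^ N) r)) (S.+-congˡ {x = S.1#} (S.-‿cong (S.*-congˡ {x = x}
          (S.trans (S.+-congˡ {x = κ [ suc i ]} (S.*-congˡ {x = y} (S.sym (κ-neg e)))) (S.sym (X-lin [ suc i ] (- e)))))))))
      where
      re : [ i ] ≈ r * e
      re = sym (trans (solve 3 (λ r u a → r :* (u :* a) := u :* r :* a) refl _ _ _) (trans (*-congʳ (p^*q^ i)) (*-identityˡ _)))
    D*F : D S.* (κ u S.* F) S.≈ S.1#
    D*F = S.trans (S.*-congʳ {x = κ u S.* F} D-linear)
      (S.trans (SS.solve 4 (λ c z u f → c SS.:* z SS.:* (u SS.:* f) SS.:= u SS.:* c SS.:* (z SS.:* f)) S.refl (κ (q ^ N * r)) (S.1# S.- x S.* X.const (dlin i)) (κ u) F)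
      (S.trans (S.*-cong (κ-inverse ucr) (1-ex*powers (dlin i))) (S.*-identityʳ S.1#)))
    uD : u * D 0 0 ≈ 1#
    uD = trans (*-congˡ (trans (D-linear 0 0) (trans (κ-* (q ^ N * r) (S.1# S.- x S.* X.const (dlin i)) 0 0)
      (trans (*-congˡ (solve 1 (λ a → con (+ 1) :- con (+ 0) :* a := con (+ 1)) refl _)) (*-identityʳ _))))) ucr

  summand-suc : ∀ i n k → summand i n (suc k) ≈ p ^ (i ℕ.* i) * term n i (suc k) + - p ^ (suc i ℕ.* suc i) * term n i k
  summand-suc i n k = trans (summand-≈ i n (suc k)) (trans (X-lin-* _ _ (dlin i) n k)
    (+-cong (*-congˡ (lin-^ _ _ n (suc k))) (*-congˡ (lin-^ _ _ n k))))

  summand-zero : ∀ i n → summand i n 0 ≈ p ^ (i ℕ.* i) * term n i 0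
  summand-zero i n = trans (summand-≈ i n 0) (trans (X-lin-*0 _ (- p ^ (suc i ℕ.* suc i)) (dlin i) n) (*-congˡ (lin-^ _ _ n 0)))

  -- The term for i = 0 would be (1 - y p) / (1 - x). Its part 1 / (1 - x) belongs to k = 0, which
  -- the generating function omits; this is the rest.
  summand₀ : Ser²
  summand₀ = S.- y S.* geo p (κ q S.* (S.1# S.- x))

  private
    summand₀-≈ : summand₀ S.≈ X.const (lin 0# (- p)) S.* powers (dlin 0)
    summand₀-≈ = S.trans (S.*-congˡ {x = S.- y} (geo-≈ p (κ q S.* (S.1# S.- x)) (κ p S.* F) uD D*F))
      (S.trans (SS.solve 3 (λ y u f → (SS.:- y) SS.:* (u SS.:* f) SS.:= (SS.con (+ 0) SS.:+ y SS.:* (SS.:- u)) SS.:* f) S.refl y (κ p) F)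
        (S.*-congʳ {x = F} (S.sym (S.trans (X-lin 0# (- p)) (S.+-cong κ-0 (S.*-congˡ {x = y} (κ-neg p)))))))
      where
      F : Ser²
      F = powers (dlin 0)
      κ-0 : κ 0# S.≈ S.0#
      κ-0 zero    zero    = refl
      κ-0 zero    (suc k) = refl
      κ-0 (suc n) k       = refl
      dlin-0 : dlin 0 Y.≈ Y.1#
      dlin-0 zero    = solve 2 (λ q u → con (+ 1) :+ q :* con (+ 0) :+ con (+ 0) :* u := con (+ 1)) refl _ _
      dlin-0 (suc k) = trans (+-identityˡ _) (trans (Series.var-⊛-suc R (const (- (p ^ 0 * [ 0 ]))) k)
        (trans (const-cong (solve 0 (:- (con (+ 1) :* con (+ 0)) := con (+ 0)) refl) k) (const-0 k)))
      D*F : κ q S.* (S.1# S.- x) S.* (κ p S.* F) S.≈ S.1#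
      D*F = S.trans (SS.solve 4 (λ c x u f → c SS.:* (SS.con (+ 1) SS.:- x) SS.:* (u SS.:* f) SS.:= u SS.:* c SS.:* ((SS.con (+ 1) SS.:- x SS.:* SS.con (+ 1)) SS.:* f)) S.refl (κ q) x (κ p) F)
        (S.trans (S.*-cong (κ-inverse pq≈1) (S.trans (S.*-congʳ {x = F} (S.+-congˡ {x = S.1#} (S.-‿cong (S.*-congˡ {x = x} (LY.const-cong (Y.sym dlin-0)))))) (1-ex*powers (dlin 0))))
          (S.*-identityʳ S.1#))
      uD : p * (κ q S.* (S.1# S.- x)) 0 0 ≈ 1#
      uD = trans (*-congˡ (trans (κ-* q (S.1# S.- x) 0 0) (solve 1 (λ q → q :* (con (+ 1) :- con (+ 0)) := q) refl _))) pq≈1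

  summand₀-suc : ∀ n k → summand₀ n (suc k) ≈ - p * term n 0 k
  summand₀-suc n k = trans (summand₀-≈ n (suc k)) (trans (X-lin-* 0# (- p) (dlin 0) n k)
    (trans (+-cong (zeroˡ _) (*-congˡ (lin-^ _ _ n k))) (+-identityˡ _)))

  summand₀-zero : ∀ n → summand₀ n 0 ≈ 0#
  summand₀-zero n = trans (summand₀-≈ n 0) (trans (X-lin-*0 0# (- p) (dlin 0) n) (zeroˡ _))

  g-generating : ∀ n k → g n 0 (suc k) ≈ summand₀ n (suc k) + ∑ (suc k) (λ j → summand (suc j) n (k ℕ.∸ j))
  g-generating n k = begin
    g n 0 (suc k)
      ≈⟨ g-formula n (suc k) ⟩
    ∑ (suc (suc k)) P + ∑ (suc k) N
      ≈⟨ +-cong (∑-head (suc k) P) (∑-head k N) ⟩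
    P 0 + ∑ (suc k) (P ∘ suc) + (N 0 + ∑ k (N ∘ suc))
      -- d_0 = 1 has no positive powers of y, so the positive part of the term for e = 0 drops out;
      -- its negative part becomes `summand₀`.
      ≈⟨ +-cong (+-congʳ (trans (*-congˡ (term-0 n k)) (zeroʳ _))) (+-congʳ (*-congʳ (-‿cong (*-identityʳ p)))) ⟩
    0# + (∑ k (P ∘ suc) + P (suc k)) + (- p * term n 0 k + ∑ k (N ∘ suc))
      ≈⟨ solve 4 (λ a b c d → con (+ 0) :+ (a :+ b) :+ (c :+ d) := c :+ (a :+ d :+ b)) refl _ _ _ _ ⟩
    - p * term n 0 k + (∑ k (P ∘ suc) + ∑ k (N ∘ suc) + P (suc k))
      ≈⟨ +-cong (summand₀-suc n k) (+-cong (trans (∑-cong< k below) (∑-+ k _ _)) top) ⟨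
    summand₀ n (suc k) + ∑ (suc k) (λ j → summand (suc j) n (k ℕ.∸ j)) ∎
    where
    P N : ℕ → Carrier
    P e = p ^ (e ℕ.* e) * term n e (suc k ℕ.∸ e)
    N e = - p ^ (suc e ℕ.* suc e) * term n e (suc k ℕ.∸ suc e)
    below : ∀ j → j ℕ.< k → summand (suc j) n (k ℕ.∸ j) ≈ P (suc j) + N (suc j)
    below j j<k rewrite ℕP.+-∸-assoc 1 j<k = summand-suc (suc j) n (k ℕ.∸ suc j)
    top : summand (suc k) n (k ℕ.∸ k) ≈ P (suc k)
    top rewrite ℕP.n∸n≡0 k = summand-zero (suc k) n

  private
    [-1]^*[-1]^ : ∀ i → (- 1#) ^ i * (- 1#) ^ i ≈ 1#
    [-1]^*[-1]^ zero    = *-identityʳ 1#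
    [-1]^*[-1]^ (suc i) = trans (solve 1 (λ x → (:- con (+ 1)) :* x :* ((:- con (+ 1)) :* x) := x :* x) refl _) ([-1]^*[-1]^ i)

    [-1]^-sum : ∀ i r → (- 1#) ^ (i ℕ.+ (i ℕ.+ r)) ≈ (- 1#) ^ r
    [-1]^-sum i r = trans (^-homo-* (- 1#) i (i ℕ.+ r)) (trans (*-congˡ (^-homo-* (- 1#) i r))
      (trans (sym (*-assoc _ _ _)) (trans (*-congʳ ([-1]^*[-1]^ i)) (*-identityˡ _))))

    neg-^ : ∀ u v r → (- (u * v)) ^ r ≈ (- 1#) ^ r * (u ^ r * v ^ r)
    neg-^ u v r = trans (^-congˡ r (solve 2 (λ u v → :- (u :* v) := (:- con (+ 1)) :* (u :* v)) refl _ _))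
      (trans (^-distrib-* (- 1#) (u * v) r) (*-congˡ (^-distrib-* u v r)))

    neg-p^-^ : ∀ e v r → (- (p ^ e * v)) ^ r ≈ (- 1#) ^ r * (p ^ (e ℕ.* r) * v ^ r)
    neg-p^-^ e v r = trans (neg-^ (p ^ e) v r) (*-congˡ (*-congʳ (^-assocʳ p e r)))

    1^ : ∀ r → 1# ^ r ≈ 1#
    1^ zero    = refl
    1^ (suc r) = trans (*-identityˡ _) (1^ r)

    binomialTerm-1 : ∀ a b n r → binomialTerm a b n r ≈ b ^ r * binomialTerm a 1# n r
    binomialTerm-1 a b n r = begin
      bin n r * (a ^ (n ℕ.∸ r) * b ^ r)              ≈⟨ solve 3 (λ x y z → x :* (y :* z) := z :* (x :* (y :* con (+ 1)))) refl _ _ _ ⟩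
      b ^ r * (bin n r * (a ^ (n ℕ.∸ r) * 1#))       ≈⟨ *-congˡ (*-congˡ (*-congˡ (1^ r))) ⟨
      b ^ r * (bin n r * (a ^ (n ℕ.∸ r) * 1# ^ r))   ∎

  columnA columnB : ℕ → ℕ → Ser²
  columnA k i = scale ((- 1#) ^ (i ℕ.+ k)) (x S.^ (k ℕ.∸ i ℕ.∸ 1) S.* κ ([ i ] ^ (k ℕ.∸ i ℕ.∸ 1)))
    S.* geo (p ^ (k ℕ.* i ℕ.+ i ℕ.+ 1)) (κ (q ^ (k ℕ.* i ℕ.+ i ℕ.+ 1)) S.* (S.1# S.- scale [ suc i ] x) S.^ (k ℕ.∸ i))
  columnB k i = scale ((- 1#) ^ (i ℕ.+ k)) (x S.^ (k ℕ.∸ i) S.* κ ([ i ] ^ (k ℕ.∸ i)))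
    S.* geo (p ^ (k ℕ.* i)) (κ (q ^ (k ℕ.* i)) S.* (S.1# S.- scale [ suc i ] x) S.^ (k ℕ.∸ i ℕ.+ 1))

  private
    columnA-≈ : ∀ k i → i ℕ.< k → columnA k i S.≈
      scale ((- 1#) ^ (i ℕ.+ k) * [ i ] ^ (k ℕ.∸ suc i) * p ^ (k ℕ.* i ℕ.+ i ℕ.+ 1)) (negBinomial [ suc i ] (k ℕ.∸ suc i))
    columnA-≈ k i i<k rewrite ℕP.+-∸-assoc 1 i<k =
      negBinomial-quotient _ _ (p ^ (k ℕ.* i ℕ.+ i ℕ.+ 1)) (q ^ (k ℕ.* i ℕ.+ i ℕ.+ 1)) [ suc i ] (k ℕ.∸ suc i) (p^*q^ (k ℕ.* i ℕ.+ i ℕ.+ 1))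

    columnB-≈ : ∀ k i → columnB k i S.≈
      scale ((- 1#) ^ (i ℕ.+ k) * [ i ] ^ (k ℕ.∸ i) * p ^ (k ℕ.* i)) (negBinomial [ suc i ] (k ℕ.∸ i))
    columnB-≈ k i rewrite ℕP.+-comm (k ℕ.∸ i) 1 =
      negBinomial-quotient _ _ (p ^ (k ℕ.* i)) (q ^ (k ℕ.* i)) [ suc i ] (k ℕ.∸ i) (p^*q^ (k ℕ.* i))

  -- With k = i + 1 + r the exponent k i + i + 1 is (i+1)² + i r and the sign is -(-1)^r, so that
  -- (-1)^r, p^{i r} and [i]^r combine to the r-th power of the y-coefficient of d_i.
  columnA-zero : ∀ n k i → i ℕ.< k → columnA k i n 0 ≈ - p ^ (suc i ℕ.* suc i) * term n i (k ℕ.∸ suc i)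
  columnA-zero n k i i<k = trans (columnA-≈ k i i<k n 0) (value (k ℕ.∸ suc i) (≡.sym (ℕP.m+[n∸m]≡n i<k)))
    where
    value : ∀ r → k ≡ suc i ℕ.+ r → (- 1#) ^ (i ℕ.+ k) * [ i ] ^ r * p ^ (k ℕ.* i ℕ.+ i ℕ.+ 1) * binomialTerm [ suc i ] 1# n r
      ≈ - p ^ (suc i ℕ.* suc i) * term n i r
    value r ≡.refl = begin
      (- 1#) ^ (i ℕ.+ suc (i ℕ.+ r)) * [ i ] ^ r * p ^ (suc (i ℕ.+ r) ℕ.* i ℕ.+ i ℕ.+ 1) * H
        ≈⟨ *-congʳ (*-cong (*-congʳ sign) (trans (^-congʳ p (expo i r)) (^-homo-* p (suc i ℕ.* suc i) (i ℕ.* r)))) ⟩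
      (- 1#) * (- 1#) ^ r * [ i ] ^ r * (p ^ (suc i ℕ.* suc i) * p ^ (i ℕ.* r)) * H
        ≈⟨ solve 5 (λ s v a b h → (:- con (+ 1)) :* s :* v :* (a :* b) :* h := (:- a) :* (s :* (b :* v) :* h)) refl _ _ _ _ _ ⟩
      - p ^ (suc i ℕ.* suc i) * ((- 1#) ^ r * (p ^ (i ℕ.* r) * [ i ] ^ r) * H)
        ≈⟨ *-congˡ (trans (binomialTerm-1 _ _ n r) (*-congʳ (neg-p^-^ i [ i ] r))) ⟨
      - p ^ (suc i ℕ.* suc i) * term n i r ∎
      where
      H : Carrier
      H = binomialTerm [ suc i ] 1# n r
      sign : (- 1#) ^ (i ℕ.+ suc (i ℕ.+ r)) ≈ (- 1#) * (- 1#) ^ r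
      sign = trans (reflexive (≡.cong ((- 1#) ^_) (≡.cong (i ℕ.+_) (≡.sym (ℕP.+-suc i r))))) ([-1]^-sum i (suc r))
      expo : ∀ i r → suc (i ℕ.+ r) ℕ.* i ℕ.+ i ℕ.+ 1 ≡ suc i ℕ.* suc i ℕ.+ i ℕ.* r
      expo = solveℕ 2 (λ i r → (conℕ 1 :+ℕ (i :+ℕ r)) :*ℕ i :+ℕ i :+ℕ conℕ 1 :=ℕ (conℕ 1 :+ℕ i) :*ℕ (conℕ 1 :+ℕ i) :+ℕ i :*ℕ r) ≡.refl

  columnB-zero : ∀ n k i → i ℕ.≤ k → columnB k i n 0 ≈ p ^ (i ℕ.* i) * term n i (k ℕ.∸ i)
  columnB-zero n k i i≤k = trans (columnB-≈ k i n 0) (value (k ℕ.∸ i) (≡.sym (ℕP.m+[n∸m]≡n i≤k)))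
    where
    value : ∀ r → k ≡ i ℕ.+ r → (- 1#) ^ (i ℕ.+ k) * [ i ] ^ r * p ^ (k ℕ.* i) * binomialTerm [ suc i ] 1# n r
      ≈ p ^ (i ℕ.* i) * term n i r
    value r ≡.refl = begin
      (- 1#) ^ (i ℕ.+ (i ℕ.+ r)) * [ i ] ^ r * p ^ ((i ℕ.+ r) ℕ.* i) * H
        ≈⟨ *-congʳ (*-cong (*-congʳ ([-1]^-sum i r)) (trans (^-congʳ p (expo i r)) (^-homo-* p (i ℕ.* i) (i ℕ.* r)))) ⟩
      (- 1#) ^ r * [ i ] ^ r * (p ^ (i ℕ.* i) * p ^ (i ℕ.* r)) * H
        ≈⟨ solve 5 (λ s v a b h → s :* v :* (a :* b) :* h := a :* (s :* (b :* v) :* h)) refl _ _ _ _ _ ⟩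
      p ^ (i ℕ.* i) * ((- 1#) ^ r * (p ^ (i ℕ.* r) * [ i ] ^ r) * H)
        ≈⟨ *-congˡ (trans (binomialTerm-1 _ _ n r) (*-congʳ (neg-p^-^ i [ i ] r))) ⟨
      p ^ (i ℕ.* i) * term n i r ∎
      where
      H : Carrier
      H = binomialTerm [ suc i ] 1# n r
      expo : ∀ i r → (i ℕ.+ r) ℕ.* i ≡ i ℕ.* i ℕ.+ i ℕ.* r
      expo = solveℕ 2 (λ i r → (i :+ℕ r) :*ℕ i :=ℕ i :*ℕ i :+ℕ i :*ℕ r) ≡.refl

  columnA-suc : ∀ n m k i → i ℕ.< k → columnA k i n (suc m) ≈ 0#
  columnA-suc n m k i i<k = trans (columnA-≈ k i i<k n (suc m)) (zeroʳ _)

  columnB-suc : ∀ n m k i → columnB k i n (suc m) ≈ 0#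
  columnB-suc n m k i = trans (columnB-≈ k i n (suc m)) (zeroʳ _)

  g-column : ∀ n k → g n 0 k ≈ ∑ k (λ i → columnA k i n 0) + ∑ (suc k) (λ i → columnB k i n 0)
  g-column n k = begin
    g n 0 k
      ≈⟨ g-formula n k ⟩
    ∑ (suc k) (λ e → p ^ (e ℕ.* e) * term n e (k ℕ.∸ e)) + ∑ k (λ e → - p ^ (suc e ℕ.* suc e) * term n e (k ℕ.∸ suc e))
      ≈⟨ +-comm _ _ ⟩
    ∑ k (λ e → - p ^ (suc e ℕ.* suc e) * term n e (k ℕ.∸ suc e)) + ∑ (suc k) (λ e → p ^ (e ℕ.* e) * term n e (k ℕ.∸ e))
      ≈⟨ +-cong (∑-cong< k (λ i → columnA-zero n k i)) (∑-cong< (suc k) (λ { i (ℕ.s≤s i≤k) → columnB-zero n k i i≤k })) ⟨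
    ∑ k (λ i → columnA k i n 0) + ∑ (suc k) (λ i → columnB k i n 0) ∎

  ∑-reverse : ∀ n f → ∑ n f ≈ ∑ n (λ i → f (n ℕ.∸ suc i))
  ∑-reverse zero    f = refl
  ∑-reverse (suc n) f = begin
    ∑ n f + f n                                ≈⟨ +-congʳ (∑-reverse n f) ⟩
    ∑ n (λ i → f (n ℕ.∸ suc i)) + f n          ≈⟨ +-comm _ _ ⟩
    f n + ∑ n (λ i → f (n ℕ.∸ suc i))          ≈⟨ ∑-head n (λ i → f (n ℕ.∸ i)) ⟨
    ∑ (suc n) (λ i → f (n ℕ.∸ i))              ∎

  -- The summands of the two explicit formulas, with e = k - i - 1.
  explicitA : ℕ → ℕ → ℕ → ℕ → Carrier
  explicitA k n i e = (- 1#) ^ i * bin n i *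
    (q ^ (k ℕ.* i) * [ suc e ] ^ i * [ suc (suc e) ] ^ (n ℕ.∸ i) - q ^ (suc k ℕ.* i) * [ e ] ^ i * [ suc e ] ^ (n ℕ.∸ i))

  explicitB : ℕ → ℕ → ℕ → Carrier
  explicitB n i e = bin n i * p ^ (suc e ℕ.* suc e) *
    ((- (p ^ suc e * [ suc e ])) ^ i * [ suc (suc e) ] ^ (n ℕ.∸ i) - (- (p ^ e * [ e ])) ^ i * [ suc e ] ^ (n ℕ.∸ i))

  explicitA≈B : ∀ n i e → p ^ ((suc e ℕ.+ i) ℕ.* (suc e ℕ.+ i)) * explicitA (suc e ℕ.+ i) n i e ≈ explicitB n i e
  explicitA≈B n i e = begin
    K * ((- 1#) ^ i * bin n i * (q ^ (k ℕ.* i) * A * A′ - q ^ (suc k ℕ.* i) * B * B′))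
      ≈⟨ solve 9 (λ K s c u A A′ v B B′ → K :* (s :* c :* (u :* A :* A′ :- v :* B :* B′)) := s :* c :* (K :* u :* A :* A′ :- K :* v :* B :* B′)) refl _ _ _ _ _ _ _ _ _ ⟩
    (- 1#) ^ i * bin n i * (K * q ^ (k ℕ.* i) * A * A′ - K * q ^ (suc k ℕ.* i) * B * B′)
      ≈⟨ *-congˡ (+-cong (*-congʳ (*-congʳ (move (suc e ℕ.* suc e) (suc e ℕ.* i) (k ℕ.* i) (expo₁ e i))))
           (-‿cong (*-congʳ (*-congʳ (move (suc e ℕ.* suc e) (e ℕ.* i) (suc k ℕ.* i) (expo₂ e i)))))) ⟩
    (- 1#) ^ i * bin n i * (p ^ (suc e ℕ.* suc e) * p ^ (suc e ℕ.* i) * A * A′ - p ^ (suc e ℕ.* suc e) * p ^ (e ℕ.* i) * B * B′)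
      ≈⟨ solve 9 (λ s c P u A A′ v B B′ → s :* c :* (P :* u :* A :* A′ :- P :* v :* B :* B′) := c :* P :* (s :* (u :* A) :* A′ :- s :* (v :* B) :* B′)) refl _ _ _ _ _ _ _ _ _ ⟩
    bin n i * p ^ (suc e ℕ.* suc e) * ((- 1#) ^ i * (p ^ (suc e ℕ.* i) * A) * A′ - (- 1#) ^ i * (p ^ (e ℕ.* i) * B) * B′)
      ≈⟨ *-congˡ (+-cong (*-congʳ (neg-p^-^ (suc e) [ suc e ] i)) (-‿cong (*-congʳ (neg-p^-^ e [ e ] i)))) ⟨
    explicitB n i e ∎
    where
    k : ℕ
    k = suc e ℕ.+ i
    K A A′ B B′ : Carrier
    K = p ^ (k ℕ.* k)
    A = [ suc e ] ^ i
    A′ = [ suc (suc e) ] ^ (n ℕ.∸ i)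
    B = [ e ] ^ i
    B′ = [ suc e ] ^ (n ℕ.∸ i)
    move : ∀ a b c → k ℕ.* k ≡ a ℕ.+ b ℕ.+ c → p ^ (k ℕ.* k) * q ^ c ≈ p ^ a * p ^ b
    move a b c eq = trans (*-congʳ (^-congʳ p eq)) (trans (p^+*q^ (a ℕ.+ b) c) (^-homo-* p a b))
    expo₁ : ∀ e i → (suc e ℕ.+ i) ℕ.* (suc e ℕ.+ i) ≡ suc e ℕ.* suc e ℕ.+ suc e ℕ.* i ℕ.+ (suc e ℕ.+ i) ℕ.* i
    expo₁ = solveℕ 2 (λ e i → (conℕ 1 :+ℕ e :+ℕ i) :*ℕ (conℕ 1 :+ℕ e :+ℕ i) :=ℕ (conℕ 1 :+ℕ e) :*ℕ (conℕ 1 :+ℕ e) :+ℕ (conℕ 1 :+ℕ e) :*ℕ i :+ℕ (conℕ 1 :+ℕ e :+ℕ i) :*ℕ i) ≡.refl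
    expo₂ : ∀ e i → (suc e ℕ.+ i) ℕ.* (suc e ℕ.+ i) ≡ suc e ℕ.* suc e ℕ.+ e ℕ.* i ℕ.+ suc (suc e ℕ.+ i) ℕ.* i
    expo₂ = solveℕ 2 (λ e i → (conℕ 1 :+ℕ e :+ℕ i) :*ℕ (conℕ 1 :+ℕ e :+ℕ i) :=ℕ (conℕ 1 :+ℕ e) :*ℕ (conℕ 1 :+ℕ e) :+ℕ e :*ℕ i :+ℕ (conℕ 1 :+ℕ (conℕ 1 :+ℕ e :+ℕ i)) :*ℕ i) ≡.refl

  -- The positive term at e + 1 and the negative term at e share both the power p^{(e+1)²} and the
  -- degree k - e in y, hence the same binomial coefficient. They are paired and the summation is
  -- reversed, i = k - e.
  g-explicitB : ∀ n k → g n 0 (suc k) ≈ ∑ (suc k) (λ i → explicitB n i (k ℕ.∸ i))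
  g-explicitB n k = begin
    g n 0 (suc k)
      ≈⟨ g-formula n (suc k) ⟩
    ∑ (suc (suc k)) P + ∑ (suc k) N
      ≈⟨ +-congʳ (trans (∑-head (suc k) P) (trans (+-congʳ (trans (*-congˡ (term-0 n k)) (zeroʳ _))) (+-identityˡ _))) ⟩
    ∑ (suc k) (P ∘ suc) + ∑ (suc k) N
      ≈⟨ ∑-+ (suc k) _ _ ⟨
    ∑ (suc k) (λ e → P (suc e) + N e)
      ≈⟨ ∑-reverse (suc k) _ ⟩
    ∑ (suc k) (λ i → P (suc (k ℕ.∸ i)) + N (k ℕ.∸ i))
      ≈⟨ ∑-cong< (suc k) (λ { i (ℕ.s≤s i≤k) → value i i≤k }) ⟩
    ∑ (suc k) (λ i → explicitB n i (k ℕ.∸ i)) ∎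
    where
    P N : ℕ → Carrier
    P e = p ^ (e ℕ.* e) * term n e (suc k ℕ.∸ e)
    N e = - p ^ (suc e ℕ.* suc e) * term n e (suc k ℕ.∸ suc e)
    value : ∀ i → i ℕ.≤ k → P (suc (k ℕ.∸ i)) + N (k ℕ.∸ i) ≈ explicitB n i (k ℕ.∸ i)
    value i i≤k rewrite ℕP.m∸[m∸n]≡n i≤k =
      solve 6 (λ P c a u b v → P :* (c :* (a :* u)) :+ (:- P) :* (c :* (b :* v)) := c :* P :* (u :* a :- v :* b)) refl _ _ _ _ _ _

  explicitA≈explicitB : ∀ n k → p ^ (suc k ℕ.* suc k) * ∑ (suc k) (λ i → explicitA (suc k) n i (k ℕ.∸ i)) ≈ ∑ (suc k) (λ i → explicitB n i (k ℕ.∸ i))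
  explicitA≈explicitB n k = trans (sym (∑-*ˡ (suc k) _ _)) (∑-cong< (suc k) λ { i (ℕ.s≤s i≤k) →
    trans (reflexive (≡.cong (λ m → p ^ (m ℕ.* m) * explicitA m n i (k ℕ.∸ i)) (≡.cong suc (≡.sym (ℕP.m∸n+n≡m i≤k)))))
      (explicitA≈B n i (k ℕ.∸ i)) })

-- Powers of q, q-integers and constants as concrete Laurent polynomials.

open import Defs
open Laurent

private
  module ℤS = Series ℤP.+-*-commutativeRing
  module LS where
    open CommutativeRing laurentRing public
    open import Algebra.Properties.CommutativeSemiring.Exp (CommutativeRing.commutativeSemiring laurentRing) public
    open import Algebra.Properties.Semiring.Mult (CommutativeRing.semiring laurentRing) public using () renaming (_×_ to _·_)

open import Relation.Binary.Reasoning.Setoid LS.setoid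

q p : L
q = zq 1
p = zqi 1

coeff-q* : ∀ r i → coeff (pmul (+ 0 ∷ + 1 ∷ []) r) i ≡ coeff (+ 0 ∷ r) i
coeff-q* r i = ≡.trans (coeff-pmul (+ 0 ∷ + 1 ∷ []) r i) (go i)
  where
  go : ∀ i → (coeff (+ 0 ∷ + 1 ∷ []) ℤS.⊛ coeff r) i ≡ coeff (+ 0 ∷ r) i
  go zero    = ℤP.*-zeroˡ (coeff r 0)
  go (suc i) = ≡.trans (≡.cong₂ ℤ._+_ (ℤP.*-zeroˡ (coeff r (suc i)))
      (≡.trans (ℤS.⊛-cong coeff-1 (λ _ → ≡.refl) i) (CommutativeRing.*-identityˡ ℤS.seriesRing (coeff r) i)))
    (ℤP.+-identityˡ (coeff r i))

coeff-1* : ∀ r i → coeff (pmul (+ 1 ∷ []) r) i ≡ coeff r i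
coeff-1* r i = ≡.trans (coeff-pmul (+ 1 ∷ []) r i)
  (≡.trans (ℤS.⊛-cong coeff-1 (λ _ → ≡.refl) i) (CommutativeRing.*-identityˡ ℤS.seriesRing (coeff r) i))

pq≈1 : p *L q ≈L 1L
pq≈1 i = coeff-1* (+ 0 ∷ + 1 ∷ []) i

zq≈ : ∀ e → zq e ≈L q LS.^ e
zq≈ zero    = LS.refl {1L}
zq≈ (suc e) = begin
  0 ⋆ (+ 0 ∷ pshift e (+ 1 ∷ []))   ≈⟨ coeff-q* (pshift e (+ 1 ∷ [])) ⟨
  q *L zq e                         ≈⟨ LS.*-congˡ {q} {zq e} {q LS.^ e} (zq≈ e) ⟩
  q *L q LS.^ e                     ∎

zqi≡ : ∀ e → zqi e ≡ p LS.^ e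
zqi≡ zero          = ≡.refl
zqi≡ (suc zero)    = ≡.refl
zqi≡ (suc (suc e)) = ≡.cong (p *L_) (zqi≡ (suc e))

zqi≈ : ∀ e → zqi e ≈L p LS.^ e
zqi≈ e = LS.reflexive (zqi≡ e)

open QNumbers laurentRing q using ([_])

br⁺≈ : ∀ j → br (+ j) ≈L [ j ]
br⁺≈ zero    = LS.refl {0L}
br⁺≈ (suc j) = begin
  1L +L 0 ⋆ (+ 0 ∷ replicate j (+ 1))   ≈⟨ LS.+-congˡ {1L} {q *L br (+ j)} {0 ⋆ (+ 0 ∷ replicate j (+ 1))} (coeff-q* (replicate j (+ 1))) ⟨
  1L +L q *L br (+ j)                   ≈⟨ LS.+-congˡ {1L} {q *L br (+ j)} {q *L [ j ]} (LS.*-congˡ {q} {br (+ j)} {[ j ]} (br⁺≈ j)) ⟩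
  1L +L q *L [ j ]                      ∎

monomial* : ∀ s r → (s ⋆ (+ 1 ∷ [])) *L (0 ⋆ r) ≈L s ⋆ r
monomial* s r i rewrite ℕP.+-identityʳ s = ≡.trans (coeff-pshift s (pmul (+ 1 ∷ []) r) i)
  (≡.trans (CommutativeRing.*-congˡ ℤS.seriesRing {ℤS.var ℤ^ s} (coeff-1* r) i) (≡.sym (coeff-pshift s r i)))
  where open import Algebra.Properties.CommutativeSemiring.Exp (CommutativeRing.commutativeSemiring ℤS.seriesRing) using () renaming (_^_ to _ℤ^_)

br⁻≈ : ∀ j → br -[1+ j ] ≈L LS.- (p LS.^ suc j *L [ suc j ])
br⁻≈ j = LS.-‿cong {suc j ⋆ replicate (suc j) (+ 1)} {p LS.^ suc j *L [ suc j ]} (begin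
  suc j ⋆ replicate (suc j) (+ 1)     ≈⟨ monomial* (suc j) (replicate (suc j) (+ 1)) ⟨
  zqi (suc j) *L br (+ suc j)         ≈⟨ LS.*-cong {zqi (suc j)} {p LS.^ suc j} {br (+ suc j)} {[ suc j ]} (zqi≈ (suc j)) (br⁺≈ (suc j)) ⟩
  p LS.^ suc j *L [ suc j ]           ∎)

powL≈ : ∀ {a b} → a ≈L b → ∀ n → powL a n ≈L b LS.^ n
powL≈ {a} {b} eq zero    = LS.refl {1L}
powL≈ {a} {b} eq (suc n) = begin
  powL a n *L a       ≈⟨ LS.*-comm (powL a n) a ⟩
  a *L powL a n       ≈⟨ LS.*-cong {a} {b} {powL a n} {b LS.^ n} eq (powL≈ {a} {b} eq n) ⟩
  b *L b LS.^ n       ∎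

sgn≈ : ∀ m → sgn m ≈L (LS.- 1L) LS.^ m
sgn≈ = powL≈ {cL (ℤ.- (+ 1))} {LS.- 1L} (LS.refl {LS.- 1L})

cL≈ : ∀ m → cL (+ m) ≈L m LS.· 1L
cL≈ zero    = λ { zero → ≡.refl ; (suc i) → ≡.refl }
cL≈ (suc m) = LS.+-congˡ {1L} {cL (+ m)} {m LS.· 1L} (cL≈ m)

-- Congruences carrying the expressions of the statement to their abstract counterparts.

open RangeSum laurentRing

lsum≈ : ∀ m {f g} → (∀ i → i ℕ.< m → f i ≈L g i) → lsum m f ≈L ∑ m g
lsum≈ m {f} {g} f≈g = begin
  lsum m f   ≡⟨ lsum≡ m ⟩
  ∑ m f      ≈⟨ ∑-cong< m {f} {g} f≈g ⟩
  ∑ m g      ∎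
  where
  lsum≡ : ∀ m → lsum m f ≡ ∑ m f
  lsum≡ zero    = ≡.refl
  lsum≡ (suc m) = ≡.cong (_+L f m) (lsum≡ m)

open Tableaux laurentRing q using (∑ₗ)
open LinearPowers laurentRing using (bin)
open Bivariate laurentRing
open Recurrence laurentRing q p pq≈1 using (g; g-<; LeDiagrams-g)
open Formulas laurentRing q p pq≈1

-- _≈L_ unfolds, so its endpoints cannot be inferred from it; they can from this record.
infix 4 _≃_ _≃²_

record _≃_ (a b : L) : Set where
  constructor scalar
  field
    eq : a ≈L b
open _≃_ using (eq)

infixl 6 _⊞_ _⊟_
infixl 7 _⊠_
infixl 8 _↑_

_⊞_ : ∀ {a a′ b b′} → a ≃ a′ → b ≃ b′ → a +L b ≃ a′ +L b′
_⊞_ {a} {a′} {b} {b′} (scalar ea) (scalar eb) = scalar (LS.+-cong {a} {a′} {b} {b′} ea eb)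

_⊠_ : ∀ {a a′ b b′} → a ≃ a′ → b ≃ b′ → a *L b ≃ a′ *L b′
_⊠_ {a} {a′} {b} {b′} (scalar ea) (scalar eb) = scalar (LS.*-cong {a} {a′} {b} {b′} ea eb)

_⊟_ : ∀ {a a′ b b′} → a ≃ a′ → b ≃ b′ → a -L b ≃ a′ LS.- b′
_⊟_ {a} {a′} {b} {b′} (scalar ea) (scalar eb) =
  scalar (LS.+-cong {a} {a′} {negL b} {negL b′} ea (LS.-‿cong {b} {b′} eb))

_↑_ : ∀ {a a′} → a ≃ a′ → ∀ n → powL a n ≃ a′ LS.^ n
_↑_ {a} {a′} (scalar ea) n = scalar (powL≈ {a} {a′} ea n)

qˢ : ∀ e → zq e ≃ q LS.^ e
qˢ e = scalar (zq≈ e)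

pˢ : ∀ e → zqi e ≃ p LS.^ e
pˢ e = scalar (zqi≈ e)

signˢ : ∀ m → sgn m ≃ (LS.- 1L) LS.^ m
signˢ m = scalar (sgn≈ m)

binˢ : ∀ n i → binL n i ≃ bin n i
binˢ n i = scalar (cL≈ (n C i))

brˢ : ∀ z j → z ≡ + j → br z ≃ [ j ]
brˢ z j z≡ = scalar (LS.trans {br z} {br (+ j)} {[ j ]} (LS.reflexive (≡.cong br z≡)) (br⁺≈ j))

∑ˢ : ∀ m {f g} → (∀ i → i ℕ.< m → f i ≃ g i) → lsum m f ≃ ∑ m g
∑ˢ m {f} {g} f≃g = scalar (lsum≈ m {f} {g} (λ i i<m → eq (f≃g i i<m)))

record _≃²_ (F G : PS) : Set where
  constructor bivariate
  field
    coefficient : ∀ n k → F n k ≃ G n k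
open _≃²_

infixl 6 _⊞²_ _⊟²_
infixl 7 _⊠²_

_⊞²_ : ∀ {F F′ G G′} → F ≃² F′ → G ≃² G′ → F +S G ≃² F′ S.+ G′
bivariate eF ⊞² bivariate eG = bivariate λ n k → eF n k ⊞ eG n k

neg² : ∀ {F F′} → F ≃² F′ → negS F ≃² S.- F′
neg² {F} {F′} (bivariate eF) = bivariate λ n k → scalar (LS.-‿cong {F n k} {F′ n k} (eq (eF n k)))

_⊟²_ : ∀ {F F′ G G′} → F ≃² F′ → G ≃² G′ → F -S G ≃² F′ S.- G′
bivariate eF ⊟² bivariate eG = bivariate λ n k → eF n k ⊟ eG n k

_⊠²_ : ∀ {F F′ G G′} → F ≃² F′ → G ≃² G′ → F *S G ≃² F′ S.* G′
_⊠²_ {F} {F′} {G} {G′} (bivariate eF) (bivariate eG) = bivariate λ n k → scalar (begin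
  (F *S G) n k
    ≈⟨ eq (∑ˢ (suc n) (λ a _ → ∑ˢ (suc k) (λ b _ → eF a b ⊠ eG (n ℕ.∸ a) (k ℕ.∸ b)))) ⟩
  ∑ (suc n) (λ a → ∑ (suc k) (λ b → F′ a b *L G′ (n ℕ.∸ a) (k ℕ.∸ b)))
    ≈⟨ *-∑∑ F′ G′ n k ⟨
  (F′ S.* G′) n k ∎)

sc² : ∀ {c c′ F F′} → c ≃ c′ → F ≃² F′ → sc c F ≃² scale c′ F′
sc² ec (bivariate eF) = bivariate λ n k → ec ⊠ eF n k

κ² : ∀ {c c′} → c ≃ c′ → cS c ≃² κ c′
κ² ec = bivariate λ { zero zero → ec ; zero (suc k) → scalar (LS.refl {0L}) ; (suc n) k → scalar (LS.refl {0L}) }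

1² : oneS ≃² S.1#
1² = κ² (scalar (LS.refl {1L}))

x² : X ≃² x
x² = bivariate λ { zero k → scalar (LS.refl {0L}) ; (suc zero) zero → scalar (LS.refl {1L}) ; (suc zero) (suc k) → scalar (LS.refl {0L}) ; (suc (suc n)) k → scalar (LS.refl {0L}) }

y² : Y ≃² y
y² = bivariate λ { zero zero → scalar (LS.refl {0L}) ; zero (suc zero) → scalar (LS.refl {1L}) ; zero (suc (suc k)) → scalar (LS.refl {0L}) ; (suc n) k → scalar (LS.refl {0L}) }

pow² : ∀ {F F′} → F ≃² F′ → ∀ m → powS F m ≃² F′ S.^ m
pow² eF zero = 1²
pow² {F} {F′} eF (suc m) = bivariate λ n k → scalar (begin
  (powS F m *S F) n k        ≈⟨ eq (coefficient (pow² eF m ⊠² eF) n k) ⟩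
  (F′ S.^ m S.* F′) n k      ≈⟨ S.*-comm (F′ S.^ m) F′ n k ⟩
  (F′ S.* F′ S.^ m) n k      ∎)

inv² : ∀ {u u′ D D′} → u ≃ u′ → D ≃² D′ → inv u D ≃² geo u′ D′
inv² eu eD = bivariate λ n k → eu ⊠ ∑ˢ (suc (n ℕ.+ k)) (λ m _ → coefficient (pow² (1² ⊟² sc² eu eD) m) n k)

A≈g : ∀ k n → A k n ≈L g n 0 k
A≈g k n with ℕP.<-≤-connex n k
... | inj₁ n<k = begin
  A k n     ≡⟨ ≡.cong (λ b → if b then foldr (λ d acc → qpow (+ rank (proj₂ d)) +L acc) 0L (LeDiagrams k n) else 0L) (≤ᵇ-false n<k) ⟩
  0L        ≈⟨ g-< {n} {k} 0 n<k ⟨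
  g n 0 k   ∎
  where
  ≤ᵇ-false : ∀ {n k} → n ℕ.< k → (k ℕ.≤ᵇ n) ≡ false
  ≤ᵇ-false {n} {k} n<k with k ℕ.≤ᵇ n | ℕP.≤ᵇ⇒≤ k n
  ... | false | _ = ≡.refl
  ... | true  | f with () ← ℕP.<⇒≱ n<k (f _)
... | inj₂ k≤n = begin
  A k n
    ≡⟨ ≡.cong (λ b → if b then foldr (λ d acc → qpow (+ rank (proj₂ d)) +L acc) 0L (LeDiagrams k n) else 0L) (≤ᵇ-true k≤n) ⟩
  foldr (λ d acc → qpow (+ rank (proj₂ d)) +L acc) 0L (LeDiagrams k n)
    ≈⟨ eq (foldr≈ (LeDiagrams k n)) ⟩
  ∑ₗ (LeDiagrams k n) (λ d → q LS.^ rank (proj₂ d))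
    ≡⟨ ≡.cong (λ m → ∑ₗ (LeDiagrams k m) (λ d → q LS.^ rank (proj₂ d))) (≡.sym (ℕP.m+[n∸m]≡n k≤n)) ⟩
  ∑ₗ (LeDiagrams k (k ℕ.+ (n ℕ.∸ k))) (λ d → q LS.^ rank (proj₂ d))
    ≈⟨ LeDiagrams-g k (n ℕ.∸ k) ⟩
  g (k ℕ.+ (n ℕ.∸ k)) 0 k
    ≡⟨ ≡.cong (λ m → g m 0 k) (ℕP.m+[n∸m]≡n k≤n) ⟩
  g n 0 k ∎
  where
  ≤ᵇ-true : ∀ {n k} → k ℕ.≤ n → (k ℕ.≤ᵇ n) ≡ true
  ≤ᵇ-true {n} {k} k≤n with k ℕ.≤ᵇ n | ℕP.≤⇒≤ᵇ k≤n
  ... | true | _ = ≡.refl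
  foldr≈ : ∀ (l : List (List ℕ × Filling)) →
    foldr (λ d acc → qpow (+ rank (proj₂ d)) +L acc) 0L l ≃ ∑ₗ l (λ d → q LS.^ rank (proj₂ d))
  foldr≈ []      = scalar (LS.refl {0L})
  foldr≈ (d ∷ l) = qˢ (rank (proj₂ d)) ⊞ foldr≈ l

-- The let makes Agda read the endpoints off the combinators; unifying them with the goal would unfold both sides.
summand² : ∀ i → (cS (zq (2 ℕ.* i ℕ.+ 1)) -S Y)
           *S inv (zqi (i ℕ.* i ℕ.+ i ℕ.+ 1 ℕ.+ i))
                  (cS (zq (i ℕ.* i ℕ.+ i ℕ.+ 1))
                   *S (cS (zq i) -S sc (zq i *L br (+ (suc i))) X +S sc (br (+ i)) (X *S Y))) ≃² summand i
summand² i = let s = (κ² (qˢ (2 ℕ.* i ℕ.+ 1)) ⊟² y²) ⊠² inv² (pˢ (i ℕ.* i ℕ.+ i ℕ.+ 1 ℕ.+ i))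
                   (κ² (qˢ (i ℕ.* i ℕ.+ i ℕ.+ 1)) ⊠² (κ² (qˢ i) ⊟² sc² (qˢ i ⊠ brˢ (+ suc i) (suc i) ≡.refl) x² ⊞² sc² (brˢ (+ i) i ≡.refl) (x² ⊠² y²))) in s

≃-refl : ∀ a → a ≃ a
≃-refl a = scalar (LS.refl {a})

summand²₀ : negS Y *S inv (zqi 1) (cS (zq 1) *S (oneS -S X)) ≃² summand₀
summand²₀ = let s = neg² y² ⊠² inv² (≃-refl p) (κ² (≃-refl q) ⊠² (1² ⊟² x²)) in s

-- The formulas for the numbers of Le-diagrams.

generating : Aser ≈S RHS1
generating n zero = begin
  0L                    ≈⟨ LS.+-identityʳ 0L ⟨
  0L +L 0L              ≈⟨ LS.+-congʳ {0L} {summand₀ n 0} {0L} (summand₀-zero n) ⟨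
  summand₀ n 0 +L 0L    ≈⟨ (let s = coefficient summand²₀ n 0 ⊞ ≃-refl 0L in eq s) ⟨
  RHS1 n 0              ∎
generating n (suc k) = begin
  A (suc k) n
    ≈⟨ A≈g (suc k) n ⟩
  g n 0 (suc k)
    ≈⟨ g-generating n k ⟩
  summand₀ n (suc k) +L ∑ (suc k) (λ j → summand (suc j) n (k ℕ.∸ j))
    ≈⟨ (let s = coefficient summand²₀ n (suc k)
              ⊞ ∑ˢ (suc k) (λ j _ → coefficient (summand² (suc j)) n (suc k ℕ.∸ suc j)) in eq s) ⟨
  RHS1 n (suc k) ∎

columnA² : ∀ k i → sc (sgn (i ℕ.+ k)) (powS X (k ℕ.∸ i ℕ.∸ 1) *S cS (powL (br (+ i)) (k ℕ.∸ i ℕ.∸ 1)))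
    *S inv (zqi (k ℕ.* i ℕ.+ i ℕ.+ 1))
           (cS (zq (k ℕ.* i ℕ.+ i ℕ.+ 1)) *S powS (oneS -S sc (br (+ (suc i))) X) (k ℕ.∸ i)) ≃² columnA k i
columnA² k i = let s = sc² (signˢ (i ℕ.+ k)) (pow² x² (k ℕ.∸ i ℕ.∸ 1) ⊠² κ² (brˢ (+ i) i ≡.refl ↑ (k ℕ.∸ i ℕ.∸ 1)))
                     ⊠² inv² (pˢ (k ℕ.* i ℕ.+ i ℕ.+ 1)) (κ² (qˢ (k ℕ.* i ℕ.+ i ℕ.+ 1)) ⊠² pow² (1² ⊟² sc² (brˢ (+ suc i) (suc i) ≡.refl) x²) (k ℕ.∸ i)) in s

columnB² : ∀ k i → sc (sgn (i ℕ.+ k)) (powS X (k ℕ.∸ i) *S cS (powL (br (+ i)) (k ℕ.∸ i)))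
    *S inv (zqi (k ℕ.* i))
           (cS (zq (k ℕ.* i)) *S powS (oneS -S sc (br (+ (suc i))) X) (k ℕ.∸ i ℕ.+ 1)) ≃² columnB k i
columnB² k i = let s = sc² (signˢ (i ℕ.+ k)) (pow² x² (k ℕ.∸ i) ⊠² κ² (brˢ (+ i) i ≡.refl ↑ (k ℕ.∸ i)))
                     ⊠² inv² (pˢ (k ℕ.* i)) (κ² (qˢ (k ℕ.* i)) ⊠² pow² (1² ⊟² sc² (brˢ (+ suc i) (suc i) ≡.refl) x²) (k ℕ.∸ i ℕ.+ 1)) in s

RHS2≈ : ∀ k n m → RHS2 k n m ≈L ∑ k (λ i → columnA k i n m) +L ∑ (suc k) (λ i → columnB k i n m)
RHS2≈ k n m = let s = ∑ˢ k (λ i _ → coefficient (columnA² k i) n m) ⊞ ∑ˢ (suc k) (λ i _ → coefficient (columnB² k i) n m) in eq s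

zeros : ∀ m {f} → (∀ i → i ℕ.< m → f i ≈L 0L) → ∑ m f ≃ 0L
zeros m {f} f≈0 = scalar (begin
  ∑ m f             ≈⟨ ∑-cong< m {f} {λ _ → 0L} f≈0 ⟩
  ∑ m (λ _ → 0L)    ≈⟨ ∑-zero m ⟩
  0L                ∎)

column : ∀ k → Ak k ≈S RHS2 k
column k n zero = begin
  A k n
    ≈⟨ A≈g k n ⟩
  g n 0 k
    ≈⟨ g-column n k ⟩
  ∑ k (λ i → columnA k i n 0) +L ∑ (suc k) (λ i → columnB k i n 0)
    ≈⟨ RHS2≈ k n 0 ⟨
  RHS2 k n 0 ∎
column k n (suc m) = begin
  0L
    ≈⟨ LS.+-identityʳ 0L ⟨
  0L +L 0L
    ≈⟨ (let s = zeros k {λ i → columnA k i n (suc m)} (λ i → columnA-suc n m k i) ⊞ zeros (suc k) {λ i → columnB k i n (suc m)} (λ i _ → columnB-suc n m k i) in eq s) ⟨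
  ∑ k (λ i → columnA k i n (suc m)) +L ∑ (suc k) (λ i → columnB k i n (suc m))
    ≈⟨ RHS2≈ k n (suc m) ⟨
  RHS2 k n (suc m) ∎

k-i : ∀ {k i} → i ≤ k → + suc k ℤ.- + i ≡ + suc (k ℕ.∸ i)
k-i {k} {i} i≤k = ≡.trans (ℤP.m-n≡m⊖n (suc k) i) (≡.trans (ℤP.⊖-≥ (ℕP.m≤n⇒m≤1+n i≤k)) (≡.cong +_ (ℕP.+-∸-assoc 1 i≤k)))

k-i+1 : ∀ {k i} → i ≤ k → + suc k ℤ.- + i ℤ.+ + 1 ≡ + suc (suc (k ℕ.∸ i))
k-i+1 {k} {i} i≤k = ≡.trans (≡.cong (ℤ._+ + 1) (k-i i≤k)) (≡.cong (λ m → + suc m) (ℕP.+-comm (k ℕ.∸ i) 1))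

k-i-1 : ∀ {k i} → i ≤ k → + suc k ℤ.- + i ℤ.- + 1 ≡ + (k ℕ.∸ i)
k-i-1 i≤k = ≡.cong (ℤ._- + 1) (k-i i≤k)

i-k : ∀ {k i} → i ≤ k → + i ℤ.- + suc k ≡ -[1+ k ℕ.∸ i ]
i-k {k} {i} i≤k = ≡.trans (ℤP.m-n≡m⊖n i (suc k)) (≡.trans (ℤP.⊖-≤ (ℕP.m≤n⇒m≤1+n i≤k)) (≡.cong (λ m → ℤ.- (+ m)) (ℕP.+-∸-assoc 1 i≤k)))

negBrˢ : ∀ z e → z ≡ -[1+ e ] → br z ≃ LS.- (p LS.^ suc e *L [ suc e ])
negBrˢ z e z≡ = scalar (LS.trans {br z} {br -[1+ e ]} {LS.- (p LS.^ suc e *L [ suc e ])} (LS.reflexive (≡.cong br z≡)) (br⁻≈ e))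

negBr+1ˢ : ∀ z e → z ≡ -[1+ e ] → br (z ℤ.+ + 1) ≃ LS.- (p LS.^ e *L [ e ])
negBr+1ˢ z e z≡ = scalar
  (LS.trans {br (z ℤ.+ + 1)} {br (-[1+ e ] ℤ.+ + 1)} {LS.- (p LS.^ e *L [ e ])} (LS.reflexive (≡.cong (λ z → br (z ℤ.+ + 1)) z≡)) (value e))
  where
  value : ∀ e → br (-[1+ e ] ℤ.+ + 1) ≈L LS.- (p LS.^ e *L [ e ])
  -- At `e = 0` the argument is 0, where `br` takes its nonnegative branch; both sides are zero, but
  -- are represented by different lists.
  value zero    zero    = ≡.refl
  value zero    (suc i) = ≡.refl
  value (suc e) = br⁻≈ e

RHS3a≈ : ∀ k n → RHS3a (suc k) n ≈L p LS.^ (suc k ℕ.* suc k) *L ∑ (suc k) (λ i → explicitA (suc k) n i (k ℕ.∸ i))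
RHS3a≈ k n = let s = pˢ (suc k ℕ.* suc k) ⊠ ∑ˢ (suc k) onTerm in eq s
  where
  onTerm : ∀ i → i ℕ.< suc k → sgn i *L binL n i *L
    (zq (suc k ℕ.* i) *L powL (br (+ suc k ℤ.- + i)) i *L powL (br (+ suc k ℤ.- + i ℤ.+ + 1)) (n ℕ.∸ i)
     -L zq (suc (suc k) ℕ.* i) *L powL (br (+ suc k ℤ.- + i ℤ.- + 1)) i *L powL (br (+ suc k ℤ.- + i)) (n ℕ.∸ i))
    ≃ explicitA (suc k) n i (k ℕ.∸ i)
  onTerm i (ℕ.s≤s i≤k) = let s = signˢ i ⊠ binˢ n i ⊠
                               (qˢ (suc k ℕ.* i) ⊠ brˢ (+ suc k ℤ.- + i) (suc (k ℕ.∸ i)) (k-i i≤k) ↑ i ⊠ brˢ (+ suc k ℤ.- + i ℤ.+ + 1) (suc (suc (k ℕ.∸ i))) (k-i+1 i≤k) ↑ (n ℕ.∸ i)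
                                ⊟ qˢ (suc (suc k) ℕ.* i) ⊠ brˢ (+ suc k ℤ.- + i ℤ.- + 1) (k ℕ.∸ i) (k-i-1 i≤k) ↑ i ⊠ brˢ (+ suc k ℤ.- + i) (suc (k ℕ.∸ i)) (k-i i≤k) ↑ (n ℕ.∸ i)) in s

RHS3b≈ : ∀ k n → RHS3b (suc k) n ≈L ∑ (suc k) (λ i → explicitB n i (k ℕ.∸ i))
RHS3b≈ k n = let s = ∑ˢ (suc k) onTerm in eq s
  where
  onTerm : ∀ i → i ℕ.< suc k → binL n i *L zqi ((suc k ℕ.∸ i) ℕ.* (suc k ℕ.∸ i)) *L
    (powL (br (+ i ℤ.- + suc k)) i *L powL (br (+ suc k ℤ.- + i ℤ.+ + 1)) (n ℕ.∸ i)
     -L powL (br (+ i ℤ.- + suc k ℤ.+ + 1)) i *L powL (br (+ suc k ℤ.- + i)) (n ℕ.∸ i))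
    ≃ explicitB n i (k ℕ.∸ i)
  onTerm i (ℕ.s≤s i≤k) = let s = binˢ n i ⊠ square ⊠
                               (negBrˢ (+ i ℤ.- + suc k) (k ℕ.∸ i) (i-k i≤k) ↑ i ⊠ brˢ (+ suc k ℤ.- + i ℤ.+ + 1) (suc (suc (k ℕ.∸ i))) (k-i+1 i≤k) ↑ (n ℕ.∸ i)
                                ⊟ negBr+1ˢ (+ i ℤ.- + suc k) (k ℕ.∸ i) (i-k i≤k) ↑ i ⊠ brˢ (+ suc k ℤ.- + i) (suc (k ℕ.∸ i)) (k-i i≤k) ↑ (n ℕ.∸ i)) in s
    where
    square : zqi ((suc k ℕ.∸ i) ℕ.* (suc k ℕ.∸ i)) ≃ p LS.^ (suc (k ℕ.∸ i) ℕ.* suc (k ℕ.∸ i))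
    square = scalar (LS.reflexive (≡.trans (zqi≡ ((suc k ℕ.∸ i) ℕ.* (suc k ℕ.∸ i))) (≡.cong (λ m → p LS.^ (m ℕ.* m)) (ℕP.+-∸-assoc 1 i≤k))))

explicit : ∀ k n → (A (suc k) n ≈L RHS3a (suc k) n) × (RHS3a (suc k) n ≈L RHS3b (suc k) n)
explicit k n = (begin
  A (suc k) n       ≈⟨ A≈g (suc k) n ⟩
  g n 0 (suc k)     ≈⟨ g-explicitB n k ⟩
  ∑ (suc k) (λ i → explicitB n i (k ℕ.∸ i))
    ≈⟨ explicitA≈explicitB n k ⟨
  p LS.^ (suc k ℕ.* suc k) *L ∑ (suc k) (λ i → explicitA (suc k) n i (k ℕ.∸ i))
    ≈⟨ RHS3a≈ k n ⟨
  RHS3a (suc k) n   ∎) , (begin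
  RHS3a (suc k) n
    ≈⟨ RHS3a≈ k n ⟩
  p LS.^ (suc k ℕ.* suc k) *L ∑ (suc k) (λ i → explicitA (suc k) n i (k ℕ.∸ i))
    ≈⟨ explicitA≈explicitB n k ⟩
  ∑ (suc k) (λ i → explicitB n i (k ℕ.∸ i))
    ≈⟨ RHS3b≈ k n ⟨
  RHS3b (suc k) n   ∎)

theorem4p1 : (Aser ≈S RHS1)
    × (∀ (k : ℕ) → 1 ≤ k → Ak k ≈S RHS2 k)
    × (∀ (k n : ℕ) → 1 ≤ k → k ≤ n → (A k n ≈L RHS3a k n) × (RHS3a k n ≈L RHS3b k n))
theorem4p1 = generating , (λ k _ → column k) , (λ { (suc k) n _ _ → explicit k n })
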